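{- Let $x\ge 4$ be even. If there exist nonnegative integers $a,b,c$ such that the multiset $L=\{1^a,2^b,x^c\}$ of size $v-1=a+b+c$ is admissible but not realizable in $K_v$, then there exist such $a,b,c$ which additionally satisfy $a+b<x-1$ and $c<x^2-x+1$.
   Context: Exponents denote multiplicities. $K_v$ is the complete graph on vertex set $\{0,1,\dots,v-1\}$, with edge length $\ell(p,q)=\min(|p-q|,v-|p-q|)$. A multiset $L$ is realizable in $K_v$ if some Hamiltonian path of $K_v$ has multiset of edge lengths exactly $L$. A multiset $L$ of size $v-1$ of positive integers is admissible if its largest element is at most $\lfloor v/2\rfloor$ and for every divisor $d$ of $v$ the number of elements of $L$ (with multiplicity) that are multiples of $d$ is at most $v-d$. -}

module Defs where

open import Data.Nat using (ℕ; suc; _+_; _∸_; _≤_; _<_; _⊓_; ∣_-_∣; _/_)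
open import Data.Nat.Divisibility using (_∣_; _∣?_)
open import Data.Fin using (Fin; toℕ)
open import Data.List using (List; []; _∷_; length; filter; map; replicate; _++_)
open import Data.List.Relation.Unary.All using (All)
open import Data.List.Relation.Unary.Unique.Propositional using (Unique)
open import Data.List.Relation.Binary.Permutation.Propositional using (_↭_)
open import Data.Product using (Σ; _×_)

len : ℕ → ℕ → ℕ → ℕ
len v p q = ∣ p - q ∣ ⊓ (v ∸ ∣ p - q ∣)

edgeLengths : (v : ℕ) → List (Fin v) → List ℕ
edgeLengths v []           = []
edgeLengths v (p ∷ [])     = []
edgeLengths v (p ∷ q ∷ ps) = len v (toℕ p) (toℕ q) ∷ edgeLengths v (q ∷ ps)

IsHamPath : (v : ℕ) → List (Fin v) → Set
IsHamPath v ps = Unique ps × length ps ≡′ v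
  where
  open import Relation.Binary.PropositionalEquality using () renaming (_≡_ to _≡′_)

Realizable : ℕ → List ℕ → Set
Realizable v L = Σ (List (Fin v)) λ ps → IsHamPath v ps × (edgeLengths v ps ↭ L)

countMultiples : ℕ → List ℕ → ℕ
countMultiples d L = length (filter (d ∣?_) L)

Admissible : ℕ → List ℕ → Set
Admissible v L =
  (length L ≡′ v ∸ 1) × All (λ ℓ → 1 ≤ ℓ) L × All (λ ℓ → ℓ ≤ v / 2) L
  × (∀ d → d ∣ v → countMultiples d L ≤ v ∸ d)
  where
  open import Relation.Binary.PropositionalEquality using () renaming (_≡_ to _≡′_)

L12x : ℕ → ℕ → ℕ → ℕ → List ℕ
L12x x a b c = replicate a 1 ++ replicate b 2 ++ replicate c x

Counterexample : ℕ → ℕ → ℕ → ℕ → Set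
Counterexample x a b c =
  Admissible (suc (a + b + c)) (L12x x a b c) × ¬′ Realizable (suc (a + b + c)) (L12x x a b c)
  where
  open import Relation.Nullary using () renaming (¬_ to ¬′_)

-- Call steps of length 1 and 2 short and steps of length x = 2y far.
--
-- If a + b ≥ x - 1, the list is realized explicitly. The numbers 0, …, v - 1 are arranged as a run followed by a block
-- of x columns on which far steps move vertically. A path fills the columns one after another, passing between them by
-- 1-steps (snakes) or by 2-steps (two interleaved strands, out and back). With too few 1-steps for this, the even and
-- the odd vertices are treated separately, as problems with steps 1 and y, and the two halves are joined. Apart from the
-- bounds on the lengths, admissibility is needed only to see that v is odd when a = 0.
--
-- If a + b < x - 1 and c ≥ (x - 1)², a realization for c yields one for c + x. Choose a window of x cyclically
-- consecutive vertices and insert x vertices behind it: an arc leaving the window is led through the new vertex above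
-- its low end, at the cost of a far step. This works if every arc leaving the window is far and all x far arcs starting
-- in it occur; by the pigeonhole principle some window meets this except at far arcs missing at the ends of the path.
-- Each end misses one of its two far arcs, and the new vertex above it can be attached to that end. If both ends miss the
-- same arc, the path closes to a cycle, which may be opened elsewhere. Hence a counterexample with large c gives one
-- with c - x.
module Submission where

open import Defs
open import Data.Nat
open import Data.Nat.Properties
open import Data.Nat.DivMod
open import Data.Nat.Divisibility using (_∣_; _∣?_; divides; ∣-trans; 1∣_; n∣m*n; ∣⇒≤; ∣m∣n⇒∣m+n)
open import Data.Nat.Induction using (<-wellFounded)
open import Data.Nat.Tactic.RingSolver using (solve; solve-∀)
open import Data.Empty using (⊥; ⊥-elim)
open import Data.Fin using (Fin; toℕ; fromℕ<)
open import Data.Fin.Properties using (toℕ-injective; toℕ-fromℕ<; toℕ<n)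
open import Data.Sum using (_⊎_; inj₁; inj₂; swap; map₁)
open import Data.Product using (Σ; _×_; _,_; ∃-syntax; proj₁; proj₂; map₂)
open import Data.List using (List; []; _∷_; _++_; map; length; filter; replicate; upTo; concatMap)
open import Data.List.Properties
  using (length-map; length-upTo; length-tabulate; length-++; length-replicate; filter-++; filter-all; filter-none; map-id; ++-identityʳ)
open import Data.List.Membership.Propositional using (_∈_; _∉_)
open import Data.List.Membership.Propositional.Properties
open import Data.List.Membership.DecPropositional _≟_ using (_∈?_)
open import Data.List.Relation.Unary.Any using (here; there)
open import Data.List.Relation.Unary.All using (All)
import Data.List.Relation.Unary.All as All
import Data.List.Relation.Unary.All.Properties as All
open import Data.List.Relation.Unary.Unique.Propositional using (Unique)
import Data.List.Relation.Unary.Unique.Propositional.Properties as Unique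
open import Data.List.Relation.Binary.Permutation.Propositional
  using (_↭_; prep; ↭-refl; ↭-sym; ↭-trans; ↭⇒↭ₛ)
open import Data.List.Relation.Binary.Permutation.Propositional.Properties
  using (shift; ++⁺ˡ; ++-comm; ∈-resp-↭; ↭-length; All-resp-↭; filter-↭)
open import Data.List.Relation.Binary.Permutation.Setoid.Properties using (Unique-resp-↭)
open import Function using (id)
open import Induction.WellFounded using (Acc; acc)
open import Relation.Nullary using (¬_; Dec; yes; no; ¬?)
open import Relation.Nullary.Decidable using (_×-dec_; decidable-stable)
open import Relation.Binary.PropositionalEquality

-- Walks

-- The threshold comes from counting offsets of the window. Of the n = a + b + c + 1 places, a + b +
-- 1 start no far arc. Two of these are excused at the ends of the path; each other one spoils x
-- offsets, and each short arc spoils the two that put its low end at one of the last two places of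
-- the window. So (a + b - 1) x + 2 (a + b) < n is wanted, which follows from a + b ≤ x - 2 and c ≥
-- (x - 1)². If both ends miss the same arc, only one is excused and this budget is exceeded;
-- reopening the cycle at the last place lets a short arc stay there, so that each short arc spoils
-- one offset only. The bound x² - x + 1 is (x - 1)² + x, as one descent removes x far steps. In the
-- explicit part the obstacle is parity. Columns are walked up and down in pairs of equal height, so
-- the incomplete top row should have even length; leaps, swirls, bends and cuts all serve to repair
-- odd remainders. Evenness of x makes the two parity classes separate problems when few 1-steps are
-- present, and it makes any d not dividing x divide none of 1, 2, x, so that the divisor condition
-- survives the descent.

data Kind : Set where
  one two far : Kind

span : ℕ → Kind → ℕ
span x one = 1
span x two = 2
span x far = x

δ : Kind → Kind → ℕ
δ one one = 1
δ two two = 1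
δ far far = 1
δ _   _   = 0

data Walk (R : ℕ → ℕ → ℕ → Set) (x : ℕ) : ℕ → ℕ → Set where
  stop : ∀ {s} → Walk R x s s
  step : ∀ {s p t} (k : Kind) → R (span x k) s p → Walk R x p t → Walk R x s t

module _ {R : ℕ → ℕ → ℕ → Set} {x : ℕ} where

  vertices : ∀ {s t} → Walk R x s t → List ℕ
  vertices {s} stop         = s ∷ []
  vertices {s} (step _ _ w) = s ∷ vertices w

  count : ∀ {s t} → Kind → Walk R x s t → ℕ
  count k stop          = 0
  count k (step k′ _ w) = δ k k′ + count k w

  infixr 5 _⋆ʷ_
  _⋆ʷ_ : ∀ {s t u} → Walk R x s t → Walk R x t u → Walk R x s u
  stop         ⋆ʷ w′ = w′
  (step k r w) ⋆ʷ w′ = step k r (w ⋆ʷ w′)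

  count-⋆ : ∀ {s t u} k (w : Walk R x s t) (w′ : Walk R x t u) →
            count k (w ⋆ʷ w′) ≡ count k w + count k w′
  count-⋆ k stop w′ = refl
  count-⋆ k (step k′ r w) w′ = trans (cong (δ k k′ +_) (count-⋆ k w w′)) (sym (+-assoc (δ k k′) _ _))

  start∈ : ∀ {s t} (w : Walk R x s t) → s ∈ vertices w
  start∈ stop = here refl
  start∈ (step _ _ _) = here refl

  end∈ : ∀ {s t} (w : Walk R x s t) → t ∈ vertices w
  end∈ stop = here refl
  end∈ (step _ _ w) = there (end∈ w)

  ∈-⋆ʳ : ∀ {s t u p} (w : Walk R x s t) (w′ : Walk R x t u) →
         p ∈ vertices w′ → p ∈ vertices (w ⋆ʷ w′)
  ∈-⋆ʳ stop w′ p∈ = p∈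
  ∈-⋆ʳ (step _ _ w) w′ p∈ = there (∈-⋆ʳ w w′ p∈)

  ∈-⋆ˡ : ∀ {s t u p} (w : Walk R x s t) (w′ : Walk R x t u) →
         p ∈ vertices w → p ∈ vertices (w ⋆ʷ w′)
  ∈-⋆ˡ stop w′ (here refl) = start∈ w′
  ∈-⋆ˡ (step _ _ w) w′ (here refl) = here refl
  ∈-⋆ˡ (step _ _ w) w′ (there p∈) = there (∈-⋆ˡ w w′ p∈)

  module Reverse (R-sym : ∀ {d p q} → R d p q → R d q p) where

    revOnto : ∀ {s t u} → Walk R x s t → Walk R x s u → Walk R x t u
    revOnto stop         w₀ = w₀
    revOnto (step k r w) w₀ = revOnto w (step k (R-sym r) w₀)

    count-revOnto : ∀ {s t u} k (w : Walk R x s t) (w₀ : Walk R x s u) →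
                    count k (revOnto w w₀) ≡ count k w + count k w₀
    count-revOnto k stop w₀ = refl
    count-revOnto k (step k′ r w) w₀ =
      trans (count-revOnto k w _)
            (trans (sym (+-assoc (count k w) _ _))
                   (cong (_+ count k w₀) (+-comm (count k w) (δ k k′))))

    ∈-revOntoʳ : ∀ {s t u p} (w : Walk R x s t) (w₀ : Walk R x s u) →
                 p ∈ vertices w₀ → p ∈ vertices (revOnto w w₀)
    ∈-revOntoʳ stop w₀ p∈ = p∈
    ∈-revOntoʳ (step k r w) w₀ p∈ = ∈-revOntoʳ w _ (there p∈)

    ∈-revOntoˡ : ∀ {s t u p} (w : Walk R x s t) (w₀ : Walk R x s u) →
                 p ∈ vertices w → p ∈ vertices (revOnto w w₀)
    ∈-revOntoˡ stop w₀ (here refl) = start∈ w₀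
    ∈-revOntoˡ (step k r w) w₀ (here refl) = ∈-revOntoʳ w _ (there (start∈ w₀))
    ∈-revOntoˡ (step k r w) w₀ (there p∈) = ∈-revOntoˡ w _ p∈

Apart : ℕ → ℕ → ℕ → Set
Apart d p q = q ≡ d + p ⊎ p ≡ d + q

apart-+ : ∀ {d p q} m → Apart d p q → Apart d (m + p) (m + q)
apart-+ {d} {p} m (inj₁ refl) = inj₁ (solve (m ∷ d ∷ p ∷ []))
apart-+ {d} {p} {q} m (inj₂ refl) = inj₂ (solve (m ∷ d ∷ q ∷ []))

-- A walk through at least the vertices in V. That it visits them only once need not be recorded:
-- its step counts are those of a Hamiltonian path, so covering already forces distinctness.
record Path (x : ℕ) (V : ℕ → Set) (s t a b c : ℕ) : Set where
  constructor path
  field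
    walk  : Walk Apart x s t
    cover : ∀ {p} → V p → p ∈ vertices walk
    ones  : count one walk ≡ a
    twos  : count two walk ≡ b
    fars  : count far walk ≡ c

infixr 4 _∪_
_∪_ : (ℕ → Set) → (ℕ → Set) → ℕ → Set
(V ∪ W) p = V p ⊎ W p

∅ : ℕ → Set
∅ _ = ⊥

module _ {x : ℕ} where

  open Path
  open Reverse {Apart} {x} swap

  infixr 5 _⋆_
  _⋆_ : ∀ {V W s t u a b c a′ b′ c′} → Path x V s t a b c → Path x W t u a′ b′ c′ →
        Path x (V ∪ W) s u (a + a′) (b + b′) (c + c′)
  path w cov p q r ⋆ path w′ cov′ p′ q′ r′ = path (w ⋆ʷ w′)
    (λ { (inj₁ v) → ∈-⋆ˡ w w′ (cov v) ; (inj₂ v) → ∈-⋆ʳ w w′ (cov′ v) })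
    (trans (count-⋆ one w w′) (cong₂ _+_ p p′))
    (trans (count-⋆ two w w′) (cong₂ _+_ q q′))
    (trans (count-⋆ far w w′) (cong₂ _+_ r r′))

  rev : ∀ {V s t a b c} → Path x V s t a b c → Path x V t s a b c
  rev (path w cov p q r) = path (revOnto w stop) (λ v → ∈-revOntoˡ w stop (cov v))
    (trans (count-revOnto one w stop) (trans (+-identityʳ _) p))
    (trans (count-revOnto two w stop) (trans (+-identityʳ _) q))
    (trans (count-revOnto far w stop) (trans (+-identityʳ _) r))

  point : ∀ {s} → Path x (_≡ s) s s 0 0 0
  point = path stop (λ { refl → here refl }) refl refl refl

  edge₁ : ∀ {s t} → Apart 1 s t → Path x ∅ s t 1 0 0
  edge₁ r = path (step one r stop) ⊥-elim refl refl refl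

  edge₂ : ∀ {s t} → Apart 2 s t → Path x ∅ s t 0 1 0
  edge₂ r = path (step two r stop) ⊥-elim refl refl refl

  edgeₓ : ∀ {s t} → Apart x s t → Path x ∅ s t 0 0 1
  edgeₓ r = path (step far r stop) ⊥-elim refl refl refl

  recast : ∀ {V W s t s′ t′ a b c a′ b′ c′} → Path x V s t a b c → s ≡ s′ → t ≡ t′ →
           (∀ {p} → W p → V p) → a ≡ a′ → b ≡ b′ → c ≡ c′ → Path x W s′ t′ a′ b′ c′
  recast (path w cov p q r) refl refl f refl refl refl = path w (λ v → cov (f v)) p q r

  Column : ℕ → ℕ → ℕ → Set
  Column s h p = ∃[ j ] j ≤ h × p ≡ j * x + s

  column : ∀ s h → Path x (Column s h) s (h * x + s) 0 0 h
  column s zero    = recast point refl refl (λ { (zero , _ , e) → e ; (suc _ , () , _) }) refl refl refl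
  column s (suc h) = recast (column s h ⋆ edgeₓ (inj₁ (+-assoc x (h * x) s)) ⋆ point) refl refl split refl refl (+-comm h 1)
    where
    split : ∀ {p} → Column s (suc h) p → (Column s h ∪ ∅ ∪ (_≡ (x + h * x + s))) p
    split (j , j≤ , e) with j ≤? h
    ... | yes j≤h = inj₁ (j , j≤h , e)
    ... | no  j≰h rewrite ≤-antisym j≤ (≰⇒> j≰h) = inj₂ (inj₂ e)

  -- Up one column, across at the top and down the other: the heights must agree, and the path is
  -- back in the bottom row.
  pair₁ : ∀ {p q} h → Apart 1 p q → Path x (Column p h ∪ Column q h) p q 1 0 (h + h)
  pair₁ {p} {q} h r = recast (column p h ⋆ edge₁ (apart-+ (h * x) r) ⋆ rev (column q h)) refl refl
      (λ { (inj₁ v) → inj₁ v ; (inj₂ v) → inj₂ (inj₂ v) }) refl refl refl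

  pair₂ : ∀ {p q} h → Apart 2 p q → Path x (Column p h ∪ Column q h) p q 0 1 (h + h)
  pair₂ {p} {q} h r = recast (column p h ⋆ edge₂ (apart-+ (h * x) r) ⋆ rev (column q h)) refl refl
      (λ { (inj₁ v) → inj₁ v ; (inj₂ v) → inj₂ (inj₂ v) }) refl refl refl

  run : ∀ s n → Path x (λ p → s ≤ p × p ≤ n + s) s (n + s) n 0 0
  run s zero = recast point refl refl (λ (l , u) → ≤-antisym u l) refl refl refl
  run s (suc n) = recast (run s n ⋆ edge₁ (inj₁ refl) ⋆ point) refl refl split (+-comm n 1) refl refl
    where
    split : ∀ {p} → s ≤ p × p ≤ suc n + s → ((λ p → s ≤ p × p ≤ n + s) ∪ ∅ ∪ (_≡ suc n + s)) p
    split {p} (l , u) with p ≤? n + s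
    ... | yes h = inj₁ (l , h)
    ... | no  h = inj₂ (inj₂ (≤-antisym u (≰⇒> h)))

-- Columns

-- Putting the new top vertex before the reversed smaller hook makes the two parity classes the two
-- legs; the only 1-step is the turn between 1 and 0.
hook : ∀ {x} n → Path x (_≤ suc n) (suc n) n 1 n 0
hook zero = recast (point ⋆ edge₁ (inj₂ refl) ⋆ point) refl refl split refl refl refl
  where
  split : ∀ {p} → p ≤ 1 → ((_≡ 1) ∪ ∅ ∪ (_≡ 0)) p
  split z≤n       = inj₂ (inj₂ refl)
  split (s≤s z≤n) = inj₁ refl
hook (suc n) = recast (point ⋆ edge₂ (inj₂ refl) ⋆ rev (hook n)) refl refl split refl refl refl
  where
  split : ∀ {p} → p ≤ 2 + n → ((_≡ 2 + n) ∪ ∅ ∪ (_≤ suc n)) p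
  split {p} u with p ≤? suc n
  ... | yes h = inj₂ (inj₂ h)
  ... | no  h = inj₁ (≤-antisym u (≰⇒> h))

-- Absorbs the short steps beyond the x - 1 that a block of x columns uses. The hook costs one
-- 1-step, and the run leads on to the top vertex, where the block begins.
tail : ∀ {x} a b → Path x (_≤ a + suc b) b (a + suc b) (suc a) b 0
tail a b = recast (rev (hook b) ⋆ run (suc b) a) refl refl split refl (+-identityʳ b) refl
  where
  split : ∀ {p} → p ≤ a + suc b → ((_≤ suc b) ∪ (λ p → suc b ≤ p × p ≤ a + suc b)) p
  split {p} u with p ≤? suc b
  ... | yes h = inj₁ h
  ... | no  h = inj₂ (<⇒≤ (≰⇒> h) , u)

↓_ : ∀ {m n} → suc m < n → m < n
↓_ = <-trans (n<1+n _)

-- The columns are the progressions bot i, x + bot i, 2 x + bot i, …; a column of height h has h + 1 cells.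
module Block (x : ℕ) (bot : ℕ → ℕ)
  (adj₁ : ∀ i → 1 + i < x → Apart 1 (bot i) (bot (1 + i)))
  (adj₂ : ∀ i → 2 + i < x → Apart 2 (bot i) (bot (2 + i))) where

  Cols : ℕ → ℕ → ℕ → ℕ → Set
  Cols lo hi h p = ∃[ i ] lo ≤ i × i < hi × Column {x} (bot i) h p

  Cols-empty : ∀ {i h p} → ¬ Cols i i h p
  Cols-empty (j , l , u , _) = <⇒≱ u l

  Cols-one : ∀ {i h p} → Cols i (suc i) h p → Column (bot i) h p
  Cols-one (j , l , s≤s u , v) rewrite ≤-antisym u l = v

  Cols-split : ∀ {lo hi h p} m → Cols lo hi h p → (Cols lo m h ∪ Cols m hi h) p
  Cols-split m (j , l , u , v) with j <? m
  ... | yes j<m = inj₁ (j , l , j<m , v)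
  ... | no  j≮m = inj₂ (j , ≮⇒≥ j≮m , u , v)

  Cols-two : ∀ {i h p} → Cols i (2 + i) h p → (Column (bot i) h ∪ Column (bot (suc i)) h) p
  Cols-two {i} v with Cols-split (suc i) v
  ... | inj₁ w = inj₁ (Cols-one w)
  ... | inj₂ w = inj₂ (Cols-one w)

  Cols-four : ∀ {i h p} → Cols i (4 + i) h p →
              (Column (bot i) h ∪ Column (bot (1 + i)) h ∪ Column (bot (2 + i)) h ∪ Column (bot (3 + i)) h) p
  Cols-four {i} v with Cols-split (2 + i) v
  ... | inj₂ w = inj₂ (inj₂ (Cols-two w))
  ... | inj₁ w with Cols-two w
  ...   | inj₁ u = inj₁ u
  ...   | inj₂ u = inj₂ (inj₁ u)

  -- Since each pair returns to the bottom row, anything may follow, including columns of another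
  -- height. Hence a change of height is wanted after an even number of columns.
  pairs : ∀ k i {h V t a b c} → k * 2 + i < x → Path x V (bot (k * 2 + i)) t a b c →
          Path x (Cols i (k * 2 + i) h ∪ V) (bot i) t (k * 2 + a) b (k * 2 * h + c)
  pairs zero i bd P = recast P refl refl (λ { (inj₁ v) → ⊥-elim (Cols-empty v) ; (inj₂ v) → v }) refl refl refl
  pairs (suc k) i {h} {V} {a = a} {c = c} bd P =
    recast (pairs k i {h} (↓ (↓ bd)) (pair₁ h (adj₁ m (↓ bd)) ⋆ edge₁ (adj₁ (suc m) bd) ⋆ P)) refl refl split (solve (k ∷ a ∷ []))
        refl (solve (k ∷ h ∷ c ∷ []))
    where
    m = k * 2 + i
    split : ∀ {p} → (Cols i (2 + m) h ∪ V) p →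
            (Cols i m h ∪ (Column (bot m) h ∪ Column (bot (1 + m)) h) ∪ ∅ ∪ V) p
    split (inj₂ v) = inj₂ (inj₂ (inj₂ v))
    split (inj₁ v) with Cols-split m v
    ... | inj₁ w = inj₁ w
    ... | inj₂ w = inj₂ (inj₁ (Cols-two w))

  oddSnake : ∀ k i h → k * 2 + i < x →
             Path x (Cols i (1 + (k * 2 + i)) h) (bot i) (h * x + bot (k * 2 + i)) (k * 2) 0 ((1 + k * 2) * h)
  oddSnake k i h bd = recast (pairs k i bd (column _ h)) refl refl split (+-identityʳ _) refl (+-comm (k * 2 * h) h)
    where
    split : ∀ {p} → Cols i (1 + (k * 2 + i)) h p → (Cols i (k * 2 + i) h ∪ Column (bot (k * 2 + i)) h) p
    split v with Cols-split (k * 2 + i) v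
    ... | inj₁ w = inj₁ w
    ... | inj₂ w = inj₂ (Cols-one w)

  evenSnake : ∀ k i h → 1 + (k * 2 + i) < x →
              Path x (Cols i (2 + (k * 2 + i)) h) (bot i) (bot (1 + (k * 2 + i))) (1 + k * 2) 0 ((2 + k * 2) * h)
  evenSnake k i h bd = recast (pairs k i (↓ bd) (pair₁ h (adj₁ _ bd))) refl refl split (+-comm _ 1) refl (solve (k ∷ h ∷ []))
    where
    split : ∀ {p} → Cols i (2 + (k * 2 + i)) h p →
            (Cols i (k * 2 + i) h ∪ Column (bot (k * 2 + i)) h ∪ Column (bot (1 + (k * 2 + i))) h) p
    split v with Cols-split (k * 2 + i) v
    ... | inj₁ w = inj₁ w
    ... | inj₂ w = inj₂ (Cols-two w)

  -- Two strands of 2-steps, one out and one back, enclosing a path across.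
  wrap : ∀ i {h V a b c} → 5 + i < x → Path x V (bot (4 + i)) (bot (5 + i)) a b c →
         Path x (Cols i (4 + i) h ∪ V) (bot i) (bot (1 + i)) a (4 + b) (4 * h + c)
  wrap i {h} {V} {a} {b} {c} bd P = recast (pair₂ h (adj₂ i (↓ ↓ ↓ bd)) ⋆ edge₂ (adj₂ (2 + i) (↓ bd)) ⋆ P
        ⋆ edge₂ (swap (adj₂ (3 + i) bd)) ⋆ pair₂ h (swap (adj₂ (1 + i) (↓ ↓ bd)))) refl refl split (+-identityʳ a)
            (solve (b ∷ [])) (solve (h ∷ c ∷ []))
    where
    split : ∀ {p} → (Cols i (4 + i) h ∪ V) p →
            ((Column (bot i) h ∪ Column (bot (2 + i)) h) ∪ ∅ ∪ V ∪ ∅ ∪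
             (Column (bot (3 + i)) h ∪ Column (bot (1 + i)) h)) p
    split (inj₂ v) = inj₂ (inj₂ (inj₁ v))
    split (inj₁ v) with Cols-four v
    ... | inj₁ w = inj₁ (inj₁ w)
    ... | inj₂ (inj₁ w) = inj₂ (inj₂ (inj₂ (inj₂ (inj₂ w))))
    ... | inj₂ (inj₂ (inj₁ w)) = inj₁ (inj₂ w)
    ... | inj₂ (inj₂ (inj₂ w)) = inj₂ (inj₂ (inj₂ (inj₂ (inj₁ w))))

  -- In each group of four, either strand goes up one column and down another, so both leave the
  -- group in the bottom row and the enclosed path may use another height.
  nest : ∀ k i {h V a b c} → 1 + (k * 4 + i) < x → Path x V (bot (k * 4 + i)) (bot (1 + (k * 4 + i))) a b c →
         Path x (Cols i (k * 4 + i) h ∪ V) (bot i) (bot (1 + i)) a (k * 4 + b) (k * 4 * h + c)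
  nest zero i bd P = recast P refl refl (λ { (inj₁ v) → ⊥-elim (Cols-empty v) ; (inj₂ v) → v }) refl refl refl
  nest (suc k) i {h} {V} {a} {b} {c} bd P =
    recast (nest k i {h} (↓ ↓ ↓ ↓ bd) (wrap (k * 4 + i) {h} bd P)) refl refl split refl (solve (k ∷ b ∷ []))
        (solve (k ∷ h ∷ c ∷ []))
    where
    split : ∀ {p} → (Cols i (4 + (k * 4 + i)) h ∪ V) p →
            (Cols i (k * 4 + i) h ∪ Cols (k * 4 + i) (4 + (k * 4 + i)) h ∪ V) p
    split (inj₂ v) = inj₂ (inj₂ v)
    split (inj₁ v) with Cols-split (k * 4 + i) v
    ... | inj₁ w = inj₁ w
    ... | inj₂ w = inj₂ (inj₁ w)

  -- Two columns or four suffice to turn round with a single 1-step; every larger case is wrapped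
  -- around one of these two.
  strands : ∀ n i h → 1 + (n * 2 + i) < x →
            Path x (Cols i (2 + (n * 2 + i)) h) (bot i) (bot (1 + i)) 1 (n * 2) ((2 + n * 2) * h)
  strands zero i h bd = recast (pair₁ h (adj₁ i bd)) refl refl Cols-two refl refl (cong (h +_) (sym (+-identityʳ h)))
  strands (suc zero) i h bd = recast (pair₂ h (adj₂ i (↓ bd)) ⋆ edge₁ (adj₁ (2 + i) bd) ⋆ pair₂ h (swap (adj₂ (1 + i) bd))) refl
      refl split refl refl (solve (h ∷ []))
    where
    split : ∀ {p} → Cols i (4 + i) h p →
            ((Column (bot i) h ∪ Column (bot (2 + i)) h) ∪ ∅ ∪
             (Column (bot (3 + i)) h ∪ Column (bot (1 + i)) h)) p
    split v with Cols-four v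
    ... | inj₁ w = inj₁ (inj₁ w)
    ... | inj₂ (inj₁ w) = inj₂ (inj₂ (inj₂ w))
    ... | inj₂ (inj₂ (inj₁ w)) = inj₁ (inj₂ w)
    ... | inj₂ (inj₂ (inj₂ w)) = inj₂ (inj₂ (inj₁ w))
  strands (suc (suc n)) i h bd = recast (wrap i {h} (≤-<-trans (m≤n+m (5 + i) (n * 2)) (subst (_< x) eq bd))
      (strands n (4 + i) h (subst (_< x) eq′ bd))) refl refl split refl refl (solve (n ∷ h ∷ []))
    where
    eq : 1 + (4 + n * 2 + i) ≡ n * 2 + (5 + i)
    eq = solve (n ∷ i ∷ [])
    eq′ : 1 + (4 + n * 2 + i) ≡ 1 + (n * 2 + (4 + i))
    eq′ = solve (n ∷ i ∷ [])
    split : ∀ {p} → Cols i (2 + (4 + n * 2 + i)) h p →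
            (Cols i (4 + i) h ∪ Cols (4 + i) (2 + (n * 2 + (4 + i))) h) p
    split v rewrite eq′ = Cols-split (4 + i) v

  -- The order 0, 2, 1, 3 of four columns shifts the position of later strands by four at the cost of a single 1-step.
  swirl : ∀ i h → 3 + i < x → Path x (Cols i (4 + i) h) (bot i) (bot (3 + i)) 1 2 (4 * h)
  swirl i h bd = recast (pair₂ h (adj₂ i (↓ bd)) ⋆ edge₁ (swap (adj₁ (1 + i) (↓ bd))) ⋆ pair₂ h (adj₂ (1 + i) bd)) refl refl split
      refl refl (solve (h ∷ []))
    where
    split : ∀ {p} → Cols i (4 + i) h p →
            ((Column (bot i) h ∪ Column (bot (2 + i)) h) ∪ ∅ ∪
             (Column (bot (1 + i)) h ∪ Column (bot (3 + i)) h)) p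
    split v with Cols-four v
    ... | inj₁ w = inj₁ (inj₁ w)
    ... | inj₂ (inj₁ w) = inj₂ (inj₂ (inj₁ w))
    ... | inj₂ (inj₂ (inj₁ w)) = inj₁ (inj₂ w)
    ... | inj₂ (inj₂ (inj₂ w)) = inj₂ (inj₂ (inj₂ w))

halve : ∀ n → ∃[ k ] (n ≡ k * 2 ⊎ n ≡ 1 + k * 2)
halve zero = 0 , inj₁ refl
halve (suc n) with halve n
... | k , inj₁ refl = k , inj₂ refl
... | k , inj₂ refl = suc k , inj₁ refl

-- Filling a block with two heights

module Ladder (x : ℕ) (bot : ℕ → ℕ)
  (adj₁ : ∀ i → 1 + i < x → Apart 1 (bot i) (bot (1 + i)))
  (adj₂ : ∀ i → 2 + i < x → Apart 2 (bot i) (bot (2 + i))) where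

  open Block x bot adj₁ adj₂ public

  -- In use the heights differ by at most one: the incomplete top row lies over one of the two
  -- groups of columns.
  Level : ℕ → ℕ → ℕ → ℕ → Set
  Level r h₁ h₂ = Cols 0 r h₁ ∪ Cols r x h₂

  crossing : ∀ k n i h₁ h₂ → 1 + (n * 2 + (k * 4 + i)) < x →
             Path x (Cols i (k * 4 + i) h₁ ∪ Cols (k * 4 + i) (2 + (n * 2 + (k * 4 + i))) h₂)
                  (bot i) (bot (1 + i)) 1 (k * 4 + n * 2) (k * 4 * h₁ + (2 + n * 2) * h₂)
  crossing k n i h₁ h₂ bd = nest k i (≤-<-trans (s≤s (m≤n+m _ (n * 2))) bd) (strands n (k * 4 + i) h₂ bd)

  -- The end is left open, since a filling is always the last part of a path.
  record Filling (r h₁ h₂ a b c : ℕ) : Set where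
    constructor filling
    field
      {end} : ℕ
      fill  : Path x (Level r h₁ h₂) (bot 0) end a b c

  -- Filling starts with pairs of columns joined by 1-steps and ends with a pair of strands of 2-steps. Strands cross
  -- the change of height at column r only in whole groups of four columns; otherwise a swirl or a single 2-step
  -- corrects their position. Hence the six shapes, distinguished by the parity of a and the residue of r.
  ladder₁ : ∀ r s n h₁ h₂ → x ≡ 2 + (n * 2 + (s * 2 + (r * 2 + 0))) →
            Filling (r * 2 + 0) h₁ h₂ (r * 2 + (s * 2 + 1)) (n * 2) (r * 2 * h₁ + (s * 2 * h₂ + (2 + n * 2) * h₂))
  ladder₁ r s n h₁ h₂ refl = filling (
    recast (pairs r 0 {h₁} (≤-<-trans (m≤n+m _ (s * 2)) u₁) (pairs s _ {h₂} u₁ (strands n _ h₂ ≤-refl)))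
      refl refl split refl refl refl)
    where
    u₁ : s * 2 + (r * 2 + 0) < x
    u₁ = s≤s (≤-trans (m≤n+m _ (n * 2)) (n≤1+n _))
    split : ∀ {p} → Level (r * 2 + 0) h₁ h₂ p →
            (Cols 0 (r * 2 + 0) h₁ ∪ Cols (r * 2 + 0) (s * 2 + (r * 2 + 0)) h₂ ∪ Cols (s * 2 + (r * 2 + 0)) x h₂) p
    split (inj₁ v) = inj₁ v
    split (inj₂ v) = inj₂ (Cols-split _ v)

  ladder₂ : ∀ j k n h₁ h₂ → x ≡ 2 + (n * 2 + (k * 4 + (j * 2 + 0))) →
            Filling (k * 4 + (j * 2 + 0)) h₁ h₂ (j * 2 + 1) (k * 4 + n * 2) (j * 2 * h₁ + (k * 4 * h₁ + (2 + n * 2) * h₂))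
  ladder₂ j k n h₁ h₂ refl = filling (
    recast (pairs j 0 {h₁} u₁ (crossing k n _ h₁ h₂ ≤-refl)) refl refl split refl refl refl)
    where
    u₁ : j * 2 + 0 < x
    u₁ = s≤s (≤-trans (≤-trans (m≤n+m _ (k * 4)) (m≤n+m _ (n * 2))) (n≤1+n _))
    split : ∀ {p} → Level (k * 4 + (j * 2 + 0)) h₁ h₂ p →
            (Cols 0 (j * 2 + 0) h₁ ∪ Cols (j * 2 + 0) (k * 4 + (j * 2 + 0)) h₁ ∪ Cols (k * 4 + (j * 2 + 0)) x h₂) p
    split (inj₂ v) = inj₂ (inj₂ v)
    split (inj₁ v) with Cols-split (j * 2 + 0) v
    ... | inj₁ w = inj₁ w
    ... | inj₂ w = inj₂ (inj₁ w)

  module _ (j k n h₁ h₂ : ℕ) where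
    private
      m = j * 2 + 0

      split₃ : ∀ d {p} → Level (k * 4 + (d + m)) h₁ h₂ p →
              (Cols 0 m h₁ ∪ Cols m (d + m) h₁ ∪ ∅ ∪ Cols (d + m) (k * 4 + (d + m)) h₁ ∪ Cols (k * 4 + (d + m)) x h₂) p
      split₃ d (inj₂ v) = inj₂ (inj₂ (inj₂ (inj₂ v)))
      split₃ d (inj₁ v) with Cols-split m v
      ... | inj₁ w = inj₁ w
      ... | inj₂ w with Cols-split (d + m) w
      ...   | inj₁ u = inj₂ (inj₁ u)
      ...   | inj₂ u = inj₂ (inj₂ (inj₂ (inj₁ u)))

      u₁ : ∀ d → d + m ≤ n * 2 + (k * 4 + (d + m))
      u₁ d = ≤-trans (m≤n+m _ (k * 4)) (m≤n+m _ (n * 2))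

    ladder₃ : x ≡ 2 + (n * 2 + (k * 4 + (4 + (j * 2 + 0)))) →
              Filling (k * 4 + (4 + (j * 2 + 0))) h₁ h₂ (j * 2 + 3) (2 + (k * 4 + n * 2))
                (j * 2 * h₁ + (4 * h₁ + (k * 4 * h₁ + (2 + n * 2) * h₂)))
    ladder₃ refl = filling (
      recast (pairs j 0 {h₁} (↓ ↓ ↓ ↓ u) (swirl m h₁ (↓ u) ⋆ edge₁ (adj₁ (3 + m) u) ⋆ crossing k n _ h₁ h₂ ≤-refl))
        refl refl (split₃ 4) refl refl refl)
      where
      u : 4 + m < x
      u = s≤s (≤-trans (u₁ 4) (n≤1+n _))

    ladder₅ : x ≡ 2 + (n * 2 + (k * 4 + (2 + (j * 2 + 0)))) →
              Filling (k * 4 + (2 + (j * 2 + 0))) h₁ h₂ (j * 2 + 2) (1 + (k * 4 + n * 2))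
                (j * 2 * h₁ + (h₁ + h₁ + (k * 4 * h₁ + (2 + n * 2) * h₂)))
    ladder₅ refl = filling (
      -- The 2-step skips a column and lands on the second of the remaining ones, so the crossing is
      -- run backwards; this makes the number of 1-steps even.
      recast (pairs j 0 {h₁} (↓ ↓ ↓ u) (pair₁ h₁ (adj₁ m (↓ ↓ u)) ⋆ edge₂ (adj₂ (1 + m) u) ⋆ rev (crossing k n _ h₁ h₂ ≤-refl)))
        refl refl split refl refl refl)
      where
      u : 3 + m < x
      u = s≤s (s≤s (u₁ 2))
      split : ∀ {p} → Level (k * 4 + (2 + m)) h₁ h₂ p →
              (Cols 0 m h₁ ∪ (Column (bot m) h₁ ∪ Column (bot (1 + m)) h₁) ∪ ∅ ∪
               Cols (2 + m) (k * 4 + (2 + m)) h₁ ∪ Cols (k * 4 + (2 + m)) x h₂) p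
      split v with split₃ 2 v
      ... | inj₁ w = inj₁ w
      ... | inj₂ (inj₁ w) = inj₂ (inj₁ (Cols-two w))
      ... | inj₂ (inj₂ w) = inj₂ (inj₂ w)

    ladder₆ : x ≡ 2 + (n * 2 + (k * 4 + (4 + (j * 2 + 0)))) →
              Filling (k * 4 + (4 + (j * 2 + 0))) h₁ h₂ (j * 2 + 2) (3 + (k * 4 + n * 2))
                (j * 2 * h₁ + (4 * h₁ + (k * 4 * h₁ + (2 + n * 2) * h₂)))
    ladder₆ refl = filling (
      recast (pairs j 0 {h₁} (↓ ↓ ↓ ↓ ↓ u) (swirl m h₁ (↓ ↓ u) ⋆ edge₂ (adj₂ (3 + m) u) ⋆ rev (crossing k n _ h₁ h₂ ≤-refl)))
        refl refl (split₃ 4) refl refl refl)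
      where
      u : 5 + m < x
      u = s≤s (s≤s (u₁ 4))

  ladder₄ : ∀ r s n h₁ h₂ → x ≡ 2 + (n * 2 + (2 + (s * 2 + (r * 2 + 0)))) →
            Filling (r * 2 + 0) h₁ h₂ (r * 2 + (s * 2 + 2)) (1 + n * 2)
              (r * 2 * h₁ + (s * 2 * h₂ + (h₂ + h₂ + (2 + n * 2) * h₂)))
  ladder₄ r s n h₁ h₂ refl = filling (
    recast (pairs r 0 {h₁} (≤-<-trans (m≤n+m _ (s * 2)) (↓ ↓ ↓ u))
             (pairs s _ {h₂} (↓ ↓ ↓ u)
               (pair₁ h₂ (adj₁ m (↓ ↓ u)) ⋆ edge₂ (adj₂ (1 + m) u) ⋆ rev (strands n _ h₂ ≤-refl))))
      refl refl split refl refl refl)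
    where
    m = s * 2 + (r * 2 + 0)
    u : 3 + m < x
    u = s≤s (s≤s (m≤n+m _ (n * 2)))
    split : ∀ {p} → Level (r * 2 + 0) h₁ h₂ p →
            (Cols 0 (r * 2 + 0) h₁ ∪ Cols (r * 2 + 0) m h₂ ∪ (Column (bot m) h₂ ∪ Column (bot (1 + m)) h₂) ∪ ∅ ∪
             Cols (2 + m) x h₂) p
    split (inj₁ v) = inj₁ v
    split (inj₂ v) with Cols-split m v
    ... | inj₁ w = inj₂ (inj₁ w)
    ... | inj₂ w with Cols-split (2 + m) w
    ...   | inj₁ u = inj₂ (inj₂ (inj₁ (Cols-two u)))
    ...   | inj₂ u = inj₂ (inj₂ (inj₂ (inj₂ u)))

  private
    fit : ∀ {r h₁ h₂ a b c r′ a′ b′ c′} → Filling r h₁ h₂ a b c → r ≡ r′ → a ≡ a′ → b ≡ b′ → c ≡ c′ → Filling r′ h₁ h₂ a′ b′ c′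
    fit P refl refl refl refl = P

    -- The numbers of 1-steps and 2-steps add up to one less than the number of columns, so each
    -- shape forces its number of 2-steps; this identifies it with the given one.
    cancel : ∀ m n b′ b → n ≡ m + b′ → n ≡ m + b → b′ ≡ b
    cancel m n b′ b e e′ = +-cancelˡ-≡ m b′ b (trans (sym e) e′)

  -- What matters is how far the pairs paid for by 1-steps reach. Beyond the change of height, the
  -- strands see one height only; short of it, they cross the rest of the first group, and `halve d`
  -- tells whether this consists of whole groups of four.
  ladder : ∀ r s a b h₁ h₂ → x ≡ (r + suc s) * 2 → 2 ≤ a → a + suc b ≡ (r + suc s) * 2 →
           Filling (r * 2) h₁ h₂ a b (r * 2 * h₁ + suc s * 2 * h₂)
  ladder r s a b h₁ h₂ ex 2≤a eq with halve a
  ladder r s a b h₁ h₂ ex 2≤a eq | j , inj₂ refl with r ≤? j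
  ... | yes r≤j with m≤n⇒∃[o]m+o≡n r≤j
  ...   | d , refl with m≤n⇒∃[o]m+o≡n d≤s
    where
    d≤s : d ≤ s
    d≤s = s≤s⁻¹ (+-cancelˡ-< r d (suc s) (*-cancelʳ-< 2 (r + d) (r + suc s)
            (subst ((r + d) * 2 <_) eq (s≤s (m≤m+n _ _)))))
  ...     | n , refl = fit (ladder₁ r d n h₁ h₂ (trans ex (solve (r ∷ d ∷ n ∷ []))))
                         (+-identityʳ _) (solve (r ∷ d ∷ []))
                         (cancel (2 + (r + d) * 2) ((r + suc (d + n)) * 2) (n * 2) b (solve (r ∷ d ∷ n ∷ []))
                             (trans (sym eq) (solve (r ∷ d ∷ b ∷ []))))
                         (solve (r ∷ d ∷ n ∷ h₁ ∷ h₂ ∷ []))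
  ladder r s a b h₁ h₂ ex 2≤a eq | j , inj₂ refl | no r≰j with m≤n⇒∃[o]m+o≡n (<⇒≤ (≰⇒> r≰j))
  ... | d , refl with halve d
  ...   | k , inj₁ refl = fit (ladder₂ j k s h₁ h₂ (trans ex (solve (j ∷ k ∷ s ∷ []))))
                         (solve (j ∷ k ∷ [])) (+-comm (j * 2) 1)
                         (cancel (2 + j * 2) ((j + k * 2 + suc s) * 2) (k * 4 + s * 2) b (solve (j ∷ k ∷ s ∷ []))
                             (trans (sym eq) (solve (j ∷ b ∷ []))))
                         (solve (j ∷ k ∷ s ∷ h₁ ∷ h₂ ∷ []))
  -- The excluded case a = 1: the swirl and its link to the strands each need a 1-step besides the
  -- one that closes the strands.
  ladder r s a b h₁ h₂ ex (s≤s ()) eq | zero , inj₂ refl | no r≰j | d , refl | k , inj₂ refl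
  ladder r s a b h₁ h₂ ex 2≤a eq | suc j , inj₂ refl | no r≰j | d , refl | k , inj₂ refl =
      fit (ladder₃ j k s h₁ h₂ (trans ex (solve (j ∷ k ∷ s ∷ []))))
                         (solve (j ∷ k ∷ [])) (solve (j ∷ []))
                         (cancel (4 + j * 2) ((suc j + (1 + k * 2) + suc s) * 2) (2 + (k * 4 + s * 2)) b (solve (j ∷ k ∷ s ∷ []))
                             (trans (sym eq) (solve (j ∷ b ∷ []))))
                         (solve (j ∷ k ∷ s ∷ h₁ ∷ h₂ ∷ []))
  ladder r s a b h₁ h₂ ex () eq | zero , inj₁ refl
  ladder r s a b h₁ h₂ ex 2≤a eq | suc j , inj₁ refl with r ≤? j
  ... | yes r≤j with m≤n⇒∃[o]m+o≡n r≤j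
  ...   | d , refl with m≤n⇒∃[o]m+o≡n d<s
    where
    d<s : d < s
    d<s = s≤s⁻¹ (+-cancelˡ-< r (suc d) (suc s) (*-cancelʳ-< 2 (r + suc d) (r + suc s)
            (subst₂ _<_ (cong (_* 2) (sym (+-suc r d))) eq (m<m+n (suc (r + d) * 2) {suc b} z<s))))
  ...     | n , refl = fit (ladder₄ r d n h₁ h₂ (trans ex (solve (r ∷ d ∷ n ∷ []))))
                         (+-identityʳ _) (solve (r ∷ d ∷ []))
                         (cancel (3 + (r + d) * 2) ((r + suc (suc d + n)) * 2) (1 + n * 2) b (solve (r ∷ d ∷ n ∷ []))
                             (trans (sym eq) (solve (r ∷ d ∷ b ∷ []))))
                         (solve (r ∷ d ∷ n ∷ h₁ ∷ h₂ ∷ []))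
  ladder r s a b h₁ h₂ ex 2≤a eq | suc j , inj₁ refl | no r≰j with m≤n⇒∃[o]m+o≡n (≰⇒> r≰j)
  ... | d , refl with halve d
  ...   | k , inj₁ refl = fit (ladder₅ j k s h₁ h₂ (trans ex (solve (j ∷ k ∷ s ∷ []))))
                         (solve (j ∷ k ∷ [])) (+-comm (j * 2) 2)
                         (cancel (3 + j * 2) ((suc (j + k * 2) + suc s) * 2) (1 + (k * 4 + s * 2)) b (solve (j ∷ k ∷ s ∷ []))
                             (trans (sym eq) (solve (j ∷ b ∷ []))))
                         (solve (j ∷ k ∷ s ∷ h₁ ∷ h₂ ∷ []))
  ...   | k , inj₂ refl = fit (ladder₆ j k s h₁ h₂ (trans ex (solve (j ∷ k ∷ s ∷ []))))
                         (solve (j ∷ k ∷ [])) (+-comm (j * 2) 2)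
                         (cancel (3 + j * 2) ((suc (j + (1 + k * 2)) + suc s) * 2) (3 + (k * 4 + s * 2)) b
                             (solve (j ∷ k ∷ s ∷ [])) (trans (sym eq) (solve (j ∷ b ∷ []))))
                         (solve (j ∷ k ∷ s ∷ h₁ ∷ h₂ ∷ []))

  -- For the problem with steps 1 and y the columns are joined by 1-steps alone. Then the parity of
  -- their number decides whether the path ends in the top row, as here, or in the bottom row.
  oddFill : ∀ k m h₁ h₂ → x ≡ 1 + (m * 2 + k * 2) →
            Path x (Level (k * 2) h₁ h₂) (bot 0) (h₂ * x + bot (m * 2 + k * 2)) (k * 2 + m * 2) 0 (k * 2 * h₁ + (1 + m * 2) * h₂)
  oddFill k m h₁ h₂ ex = recast (pairs k 0 {h₁} (≤-<-trans (m≤n+m _ (m * 2)) u) (oddSnake m _ h₂ u))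
      refl (cong (λ i → h₂ * x + bot (m * 2 + i)) (+-identityʳ (k * 2))) split refl refl refl
    where
    u : m * 2 + (k * 2 + 0) < x
    u = ≤-reflexive (trans (cong (λ i → 1 + (m * 2 + i)) (+-identityʳ (k * 2))) (sym ex))
    split : ∀ {p} → Level (k * 2) h₁ h₂ p → (Cols 0 (k * 2 + 0) h₁ ∪ Cols (k * 2 + 0) (1 + (m * 2 + (k * 2 + 0))) h₂) p
    split rewrite +-identityʳ (k * 2) | ex = λ v → v

  evenFill : ∀ k m h₁ h₂ → x ≡ 2 + (m * 2 + k * 2) →
             Path x (Level (k * 2) h₁ h₂) (bot 0) (bot (1 + (m * 2 + k * 2))) (k * 2 + (1 + m * 2)) 0
                 (k * 2 * h₁ + (2 + m * 2) * h₂)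
  evenFill k m h₁ h₂ ex = recast (pairs k 0 {h₁} (↓ ≤-<-trans (s≤s (m≤n+m _ (m * 2))) u) (evenSnake m _ h₂ u))
      refl (cong (λ i → bot (1 + (m * 2 + i))) (+-identityʳ (k * 2))) split refl refl refl
    where
    u : 1 + (m * 2 + (k * 2 + 0)) < x
    u = ≤-reflexive (trans (cong (λ i → 2 + (m * 2 + i)) (+-identityʳ (k * 2))) (sym ex))
    split : ∀ {p} → Level (k * 2) h₁ h₂ p → (Cols 0 (k * 2 + 0) h₁ ∪ Cols (k * 2 + 0) (2 + (m * 2 + (k * 2 + 0))) h₂) p
    split rewrite +-identityʳ (k * 2) | ex = λ v → v

-- Incomplete grids

-- Rows are numbered from 0; row q + 1 is the incomplete top row, of length r.
locate : ∀ {x q r o} .{{_ : NonZero x}} → o < x + (q * x + r) → r < x →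
         ∃[ i ] ∃[ j ] i < x × o ≡ j * x + i × (j ≤ q ⊎ j ≡ suc q × i < r)
locate {x} {q} {r} {o} o< r<x with o / x ≤? q
... | yes j≤q = o % x , o / x , m%n<n o x , trans (m≡m%n+[m/n]*n o x) (+-comm (o % x) _) , inj₁ j≤q
... | no  j≰q = o % x , o / x , m%n<n o x , trans (m≡m%n+[m/n]*n o x) (+-comm (o % x) _) , inj₂ (j≡ , i<r)
  where
  o≡ : o ≡ o / x * x + o % x
  o≡ = trans (m≡m%n+[m/n]*n o x) (+-comm (o % x) _)
  j≡ : o / x ≡ suc q
  j≡ = ≤-antisym (s≤s⁻¹ (*-cancelʳ-< x (o / x) (2 + q) (≤-<-trans (m/n*n≤m o x) (<-trans o<
         (+-monoʳ-< x (subst (q * x + r <_) (+-comm (q * x) x) (+-monoʳ-< (q * x) r<x))))))) (≰⇒> j≰q)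
  i<r : o % x < r
  i<r = +-cancelˡ-< (suc q * x) (o % x) r (subst (_< suc q * x + r) (trans o≡ (cong (λ t → t * x + o % x) j≡))
          (subst (o <_) (sym (+-assoc x (q * x) r)) o<))

-- The corner e of the block is also the last vertex of the preceding run, so entering the block
-- costs no step.
module Ascending (x e : ℕ) .{{_ : NonZero x}} where

  bot : ℕ → ℕ
  bot i = i + e

  open Ladder x bot (λ _ _ → inj₁ refl) (λ _ _ → inj₁ refl) public

  level : ∀ {q r p} → r < x → e ≤ p → p < e + (x + (q * x + r)) → Level r (suc q) q p
  level {q} {r} {p} r<x e≤p p< with m≤n⇒∃[o]m+o≡n e≤p
  ... | o , refl with locate {x} {q} {r} {o} (+-cancelˡ-< e _ _ p<) r<x
  ...   | i , j , i<x , refl , h = cell h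
    where
    eq : e + (j * x + i) ≡ j * x + (i + e)
    eq = trans (+-comm e _) (+-assoc (j * x) i e)
    cell : (j ≤ q ⊎ j ≡ suc q × i < r) → Level r (suc q) q (e + (j * x + i))
    cell (inj₂ (refl , i<r)) = inj₁ (i , z≤n , i<r , j , ≤-refl , eq)
    cell (inj₁ j≤q) with i <? r
    ... | yes i<r = inj₁ (i , z≤n , i<r , j , m≤n⇒m≤1+n j≤q , eq)
    ... | no  i≮r = inj₂ (i , ≮⇒≥ i≮r , i<x , j , j≤q , eq)

-- The block seen from its other end, entered by a far step from e to e + x. That step turns an odd
-- remainder into an even one, and the lower columns now come first.
module Descending (x e : ℕ) .{{_ : NonZero x}} where

  bot : ℕ → ℕ
  bot i = e + x ∸ i

  private
    down : ∀ {m} i → suc i ≤ m → m ∸ i ≡ suc (m ∸ suc i)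
    down {suc m} i (s≤s h) = +-∸-assoc 1 h

    inside : ∀ {i} → i < x → i ≤ e + x
    inside h = ≤-trans (<⇒≤ h) (m≤n+m x e)

  adj₁ : ∀ i → 1 + i < x → Apart 1 (bot i) (bot (1 + i))
  adj₁ i h = inj₂ (down i (inside h))

  adj₂ : ∀ i → 2 + i < x → Apart 2 (bot i) (bot (2 + i))
  adj₂ i h = inj₂ (trans (down i (inside (<-trans (n<1+n _) h))) (cong suc (down (suc i) (inside h))))

  open Ladder x bot adj₁ adj₂ public

  level : ∀ {q r d p} → r + suc d ≡ x → suc e ≤ p → p < suc e + (x + (q * x + r)) → Level (suc d) q (suc q) p
  level {q} {r} {d} {p} refl e≤p p< with m≤n⇒∃[o]m+o≡n e≤p
  ... | o , refl with locate {x} {q} {r} {o} (+-cancelˡ-< (suc e) _ _ p<) (m<m+n r z<s)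
  ...   | i , j , i<x , refl , h with m≤n⇒∃[o]m+o≡n i<x
  ...     | k , 1+i+k≡x = cell h
    where
    bot≡ : suc e + i ≡ bot k
    bot≡ = sym (trans (cong (λ t → e + t ∸ k) (sym 1+i+k≡x))
                      (trans (cong (_∸ k) (sym (+-assoc e (suc i) k))) (trans (m+n∸n≡m (e + suc i) k) (+-suc e i))))
    eq : suc e + (j * x + i) ≡ j * x + bot k
    eq = trans (trans (+-comm (suc e) _) (trans (+-assoc (j * x) i (suc e)) (cong (j * x +_) (+-comm i (suc e)))))
        (cong (j * x +_) bot≡)
    k<x : k < x
    k<x = ≤-trans (s≤s (m≤n+m k i)) (≤-reflexive 1+i+k≡x)
    cell : (j ≤ q ⊎ j ≡ suc q × i < r) → Level (suc d) q (suc q) (suc e + (j * x + i))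
    cell (inj₂ (refl , i<r)) = inj₂ (k , d<k , k<x , j , ≤-refl , eq)
      where
      d<k : suc d ≤ k
      d<k = +-cancelˡ-≤ (suc i) (suc d) k (≤-trans (+-monoˡ-≤ (suc d) i<r) (≤-reflexive (sym 1+i+k≡x)))
    cell (inj₁ j≤q) with k <? suc d
    ... | yes k< = inj₁ (k , z≤n , k< , j , j≤q , eq)
    ... | no  k≮ = inj₂ (k , ≮⇒≥ k≮ , k<x , j , m≤n⇒m≤1+n j≤q , eq)

-- Paths with at least two 1-steps

quotient : ∀ y .{{_ : NonZero y}} n → ∃[ q ] ∃[ r ] r < y × n ≡ q * y + r
quotient y n = n / y , n % y , m%n<n n y , trans (m≡m%n+[m/n]*n n y) (+-comm (n % y) _)

record Route (x : ℕ) (V : ℕ → Set) (a b c : ℕ) : Set where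
  constructor route
  field
    {start end} : ℕ
    along       : Path x V start end a b c

resize : ∀ {x n n′ a b c a′ b′ c′} → Route x (_< n) a b c → n ≡ n′ → a ≡ a′ → b ≡ b′ → c ≡ c′ → Route x (_< n′) a′ b′ c′
resize P refl refl refl refl = P

complement : ∀ {r y} → r < y → ∃[ t ] r + suc t ≡ y
complement {r} r<y with m≤n⇒∃[o]m+o≡n r<y
... | t , e = t , trans (+-suc r t) e

attach-even : ∀ {y e s a₂ b₂ a b} → Path (y * 2) (_≤ e) s e a₂ b₂ 0 → 2 ≤ a → a + suc b ≡ y * 2 → ∀ q r → r < y →
              Route (y * 2) (_< e + (y * 2 + (q * (y * 2) + r * 2))) (a₂ + a) (b₂ + b) (q * (y * 2) + r * 2)
attach-even {y@(suc _)} {e} {a = a} {b} T 2≤a a+b q r r<y with complement r<y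
... | t , r+t with Ascending.ladder (y * 2) e r t a b (suc q) q (cong (_* 2) (sym r+t)) 2≤a (trans a+b (cong (_* 2) (sym r+t)))
...   | Ascending.filling F = route (recast (T ⋆ F) refl refl cov refl refl eq)
  where
  open Ascending (y * 2) e
  cov : ∀ {p} → p < e + (y * 2 + (q * (y * 2) + r * 2)) → ((_≤ e) ∪ Level (r * 2) (suc q) q) p
  cov {p} p< with p ≤? e
  ... | yes p≤e = inj₁ p≤e
  ... | no  p≰e = inj₂ (level (*-monoˡ-< 2 r<y) (<⇒≤ (≰⇒> p≰e)) p<)
  eq : r * 2 * suc q + suc t * 2 * q ≡ q * (y * 2) + r * 2
  eq = subst (λ y → r * 2 * suc q + suc t * 2 * q ≡ q * (y * 2) + r * 2) r+t (solve (r ∷ q ∷ t ∷ []))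

attach-odd : ∀ {y e s a₂ b₂ a b} → Path (y * 2) (_≤ e) s e a₂ b₂ 0 → 2 ≤ a → a + suc b ≡ y * 2 → ∀ q r → r < y →
             Route (y * 2) (_< suc e + (y * 2 + (q * (y * 2) + r * 2))) (a₂ + a) (b₂ + b) (suc (q * (y * 2) + r * 2))
-- `ladder` wants a nonempty second group, so an empty top row is treated apart, with all columns in
-- that group.
attach-odd {y@(suc y′)} {e} {a = a} {b} T 2≤a a+b q zero r<y
  with Descending.ladder (y * 2) e 0 y′ a b q q refl 2≤a a+b
... | Descending.filling F = route (recast (T ⋆ edgeₓ (inj₁ (+-comm e (y * 2))) ⋆ F) refl refl cov refl refl (cong suc eq))
  where
  open Descending (y * 2) e
  cov : ∀ {p} → p < suc e + (y * 2 + (q * (y * 2) + 0)) → ((_≤ e) ∪ ∅ ∪ Level 0 q q) p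
  cov {p} p< with p ≤? e
  ... | yes p≤e = inj₁ p≤e
  ... | no  p≰e with level {d = suc (y′ * 2)} refl (≰⇒> p≰e) p<
  ...   | inj₁ w = inj₂ (inj₂ (inj₂ w))
  ...   | inj₂ (_ , l , u , _) = ⊥-elim (<⇒≱ u l)
  eq : y * 2 * q ≡ q * (y * 2) + 0
  eq = trans (*-comm (y * 2) q) (sym (+-identityʳ _))
attach-odd {y@(suc y′)} {e} {a = a} {b} T 2≤a a+b q (suc r) r<y with complement (s<s⁻¹ r<y)
... | t , r+t with Descending.ladder (y * 2) e (suc t) r a b q (suc q) (cong (_* 2) y≡) 2≤a (trans a+b (cong (_* 2) y≡))
  where
  y≡ : y ≡ suc t + suc r
  y≡ = cong suc (trans (sym r+t) (trans (+-suc r t) (trans (cong suc (+-comm r t)) (sym (+-suc t r)))))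
...   | Descending.filling F = route (recast (T ⋆ edgeₓ (inj₁ (+-comm e (y * 2))) ⋆ F) refl refl cov refl refl (cong suc eq))
  where
  open Descending (y * 2) e
  cov : ∀ {p} → p < suc e + (y * 2 + (q * (y * 2) + suc r * 2)) → ((_≤ e) ∪ ∅ ∪ Level (suc t * 2) q (suc q)) p
  cov {p} p< with p ≤? e
  ... | yes p≤e = inj₁ p≤e
  ... | no  p≰e = inj₂ (inj₂ (level {d = suc (t * 2)}
      (subst (λ y → suc r * 2 + suc (suc (t * 2)) ≡ suc y * 2) r+t (solve (r ∷ t ∷ []))) (≰⇒> p≰e) p<))
  eq : suc t * 2 * q + suc r * 2 * suc q ≡ q * (y * 2) + suc r * 2
  eq = subst (λ y → suc t * 2 * q + suc r * 2 * suc q ≡ q * (suc y * 2) + suc r * 2) r+t (solve (r ∷ q ∷ t ∷ []))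

-- Halving c before dividing by y makes the length of the incomplete row a whole number of pairs, up
-- to the one far step spent on the leap.
attach : ∀ {y e s a₂ b₂ a b} .{{_ : NonZero y}} → Path (y * 2) (_≤ e) s e a₂ b₂ 0 → 2 ≤ a → a + suc b ≡ y * 2 →
         ∀ c → Route (y * 2) (_< e + (y * 2 + c)) (a₂ + a) (b₂ + b) c
attach {y} {e} T 2≤a a+b c with halve c
... | m , c≡ with quotient y m
...   | q , r , r<y , m≡ with subst (λ m → m * 2 ≡ q * (y * 2) + r * 2) (sym m≡) (solve (q ∷ r ∷ y ∷ [])) | c≡
...     | eq | inj₁ refl = resize (attach-even T 2≤a a+b q r r<y) (cong (λ m → e + (y * 2 + m)) (sym eq)) refl refl (sym eq)
...     | eq | inj₂ refl = resize (attach-odd T 2≤a a+b q r r<y) n≡ refl refl (cong suc (sym eq))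
  where
  n≡ : suc e + (y * 2 + (q * (y * 2) + r * 2)) ≡ e + (y * 2 + suc (m * 2))
  n≡ = trans (cong (λ m → suc e + (y * 2 + m)) (sym eq)) (trans (sym (+-suc e _)) (cong (e +_) (sym (+-suc (y * 2) _))))

-- Surplus short steps go into a `tail`, which takes one 1-step while the block still needs two;
-- hence 3 ≤ a. Without a surplus, a = 2 suffices.
wide : ∀ y .{{_ : NonZero y}} {a b} c → 2 ≤ y → 2 ≤ a → y * 2 ≤ suc (a + b) → (3 ≤ a ⊎ suc (a + b) ≡ y * 2) →
       Route (y * 2) (_< suc (a + b + c)) a b c
wide y {a} {b} c 2≤y 2≤a x≤ h with suc (a + b) ≟ y * 2
... | yes x≡ = resize (attach T₀ 2≤a (trans (+-suc a b) x≡) c) (cong (_+ c) (sym x≡)) refl refl refl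
  where
  T₀ : Path (y * 2) (_≤ 0) 0 0 0 0 0
  T₀ = recast point refl refl (λ { z≤n → refl }) refl refl refl
... | no  x≢ with h
...   | inj₂ x≡ = ⊥-elim (x≢ x≡)
...   | inj₁ (s≤s {n = a₁} 2≤a₁) with suc a₁ ≤? y * 2
...     | yes a≤x with m≤n⇒∃[o]m+o≡n a≤x
...       | b₁ , eq₁ with m≤n⇒∃[o]m+o≡n b₁≤b
  where
  b₁≤b : b₁ ≤ b
  b₁≤b = +-cancelˡ-≤ (suc a₁) b₁ b (≤-trans (≤-reflexive eq₁) (s≤s⁻¹ (≤∧≢⇒< x≤ (λ e → x≢ (sym e)))))
...         | b₂ , refl = resize (attach (tail 0 b₂) 2≤a₁ (trans (+-suc a₁ b₁) eq₁) c) (cong suc count≡) refl (+-comm b₂ b₁) refl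
  where
  count≡ : b₂ + (y * 2 + c) ≡ suc (a₁ + (b₁ + b₂) + c)
  count≡ = subst (λ x → b₂ + (x + c) ≡ suc (a₁ + (b₁ + b₂) + c)) eq₁ (solve (a₁ ∷ b₁ ∷ b₂ ∷ c ∷ []))
wide y@(suc y′) {a} {b} c (s≤s 1≤y′) 2≤a x≤ h | no x≢ | inj₁ (s≤s {n = a₁} 2≤a₁) | no a≰x with m≤n⇒∃[o]m+o≡n (≰⇒> a≰x)
... | d , eq = resize (attach (tail (suc d) b) 2≤x-1 (+-comm (suc (y′ * 2)) 1) c) eq₁ eq₂ (+-identityʳ b) refl
  where
  2≤x-1 : 2 ≤ suc (y′ * 2)
  2≤x-1 = s≤s (≤-trans 1≤y′ (m≤m*n y′ 2))
  eq₁ : suc d + suc b + (y * 2 + c) ≡ suc (suc a₁ + b + c)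
  eq₁ = subst (λ a → suc d + suc b + (y * 2 + c) ≡ suc (a + b + c)) eq (solve (d ∷ b ∷ y′ ∷ c ∷ []))
  eq₂ : suc (suc d) + suc (y′ * 2) ≡ suc a₁
  eq₂ = subst (suc (suc d) + suc (y′ * 2) ≡_) eq (solve (d ∷ y′ ∷ []))

-- Paths with steps 1 and y

-- Two walks over one parity class, to be attached by 1-steps at `s₁` and `e₂` to the two ends of a
-- walk over the other class.
record Pieces (x : ℕ) (V : ℕ → Set) (s₁ s₂ e₂ a₁ c₁ a₂ c₂ : ℕ) : Set₁ where
  constructor pieces
  field
    {V₁ V₂} : ℕ → Set
    {e₁}    : ℕ
    first   : Path x V₁ s₁ e₁ a₁ 0 c₁
    second  : Path x V₂ s₂ e₂ a₂ 0 c₂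
    covers  : ∀ {p} → V p → (V₁ ∪ V₂) p

module _ {y : ℕ} .{{_ : NonZero y}} where

  enter : ∀ {t q r u a c} → r < y → Path y (Ascending.Level y t r (suc q) q) t u a 0 c →
          Path y (_< t + (y + (q * y + r))) 0 u (t + a) 0 c
  enter {t} {q} {r} r<y P = recast (recast (run 0 t) refl (+-identityʳ t) (λ v → v) refl refl refl ⋆ P) refl refl cov refl refl
      refl
    where
    cov : ∀ {p} → p < t + (y + (q * y + r)) → ((λ p → 0 ≤ p × p ≤ t + 0) ∪ Ascending.Level y t r (suc q) q) p
    cov {p} p< with p ≤? t + 0
    ... | yes p≤t = inj₁ (z≤n , p≤t)
    ... | no  p≰t = inj₂ (Ascending.level y t r<y (<⇒≤ (subst (_< p) (+-identityʳ t) (≰⇒> p≰t))) p<)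

  hop : ∀ {t q r d u a c} → r + suc d ≡ y → Path y (Descending.Level y t (suc d) q (suc q)) (t + y) u a 0 c →
        Path y (_< suc t + (y + (q * y + r))) 0 u (t + a) 0 (suc c)
  hop {t} {q} {r} {d} eq P = recast (recast (run 0 t) refl (+-identityʳ t) (λ v → v) refl refl refl ⋆ edgeₓ (inj₁ (+-comm t y)) ⋆
      P) refl refl cov refl refl refl
    where
    cov : ∀ {p} → p < suc t + (y + (q * y + r)) → ((λ p → 0 ≤ p × p ≤ t + 0) ∪ ∅ ∪ Descending.Level y t (suc d) q (suc q)) p
    cov {p} p< with p ≤? t + 0
    ... | yes p≤t = inj₁ (z≤n , p≤t)
    ... | no  p≰t = inj₂ (inj₂ (Descending.level y t eq (subst (_< p) (+-identityʳ t) (≰⇒> p≰t)) p<))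

  hop₀ : ∀ {t q h u a c} → Path y (Descending.Level y t 0 h q) (t + y) u a 0 c →
         Path y (_< suc t + (y + (q * y + 0))) 0 u (t + a) 0 (suc c)
  hop₀ {t} {q} P = hop (suc-pred y) (recast P refl refl cov refl refl refl)
    where
    open Descending y t
    cov : ∀ {p} → Level (suc (pred y)) q (suc q) p → Level 0 _ q p
    cov (inj₁ (i , l , u , v)) = inj₂ (i , l , subst (i <_) (suc-pred y) u , v)
    cov (inj₂ (i , l , u , _)) = ⊥-elim (<⇒≱ u (subst (_≤ i) (suc-pred y) l))

  -- the far count of a filled block of y columns, of which 2k have height q+1
  cells : ∀ k m q → y ≡ 1 + (m * 2 + k * 2) → k * 2 * suc q + (1 + m * 2) * q ≡ q * y + k * 2
  cells k m q refl = solve (k ∷ m ∷ q ∷ [])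

  cells′ : ∀ k m q → y ≡ 2 + (m * 2 + k * 2) → k * 2 * suc q + (2 + m * 2) * q ≡ q * y + k * 2
  cells′ k m q refl = solve (k ∷ m ∷ q ∷ [])

  plainOdd : ∀ t k m q → y ≡ 1 + (m * 2 + k * 2) →
             Path y (_< t + (y + (q * y + k * 2))) 0 (q * y + (m * 2 + k * 2 + t)) (t + (k * 2 + m * 2)) 0 (q * y + k * 2)
  plainOdd t k m q ey = enter (≤-trans (s≤s (m≤n+m (k * 2) (m * 2))) (≤-reflexive (sym ey)))
    (recast (Ascending.oddFill y t k m (suc q) q ey) refl refl (λ v → v) refl refl (cells k m q ey))

  plainEven : ∀ t k m q → y ≡ 2 + (m * 2 + k * 2) →
              Path y (_< t + (y + (q * y + k * 2))) 0 (1 + (m * 2 + k * 2) + t) (t + (k * 2 + (1 + m * 2))) 0 (q * y + k * 2)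
  plainEven t k m q ey = enter (≤-trans (s≤s (≤-trans (m≤n+m (k * 2) (m * 2)) (n≤1+n _))) (≤-reflexive (sym ey)))
    (recast (Ascending.evenFill y t k m (suc q) q ey) refl refl (λ v → v) refl refl (cells′ k m q ey))

  -- twisted paths: the run leaps into the far end of the block, which is filled downwards
  twistOdd : ∀ t k m q → y ≡ 1 + (m * 2 + suc k * 2) →
             Path y (_< suc t + (y + (q * y + (1 + m * 2)))) 0 (suc q * y + suc t) (t + (suc k * 2 + m * 2)) 0
                 (suc (q * y + (1 + m * 2)))
  twistOdd t k m q ey = hop (sym ey)
      (recast (Descending.oddFill y t (suc k) m q (suc q) ey) refl (cong (suc q * y +_) end) (λ v → v) refl refl far≡)
    where
    end : t + y ∸ (m * 2 + suc k * 2) ≡ suc t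
    end = trans (cong (λ y → t + y ∸ (m * 2 + suc k * 2)) ey)
            (trans (cong (_∸ (m * 2 + suc k * 2)) (+-suc t (m * 2 + suc k * 2))) (m+n∸n≡m (suc t) (m * 2 + suc k * 2)))
    far≡ : suc k * 2 * q + (1 + m * 2) * suc q ≡ q * y + (1 + m * 2)
    far≡ = subst (λ y → suc k * 2 * q + (1 + m * 2) * suc q ≡ q * y + (1 + m * 2)) (sym ey) (solve (k ∷ m ∷ q ∷ []))

  twistEven : ∀ t k m q → y ≡ 2 + (m * 2 + suc k * 2) →
              ∃[ u ] Path y (_< suc t + (y + (q * y + (2 + m * 2)))) 0 u (t + (suc k * 2 + (1 + m * 2))) 0
                  (suc (q * y + (2 + m * 2)))
  twistEven t k m q ey = _ , hop (sym ey)
      (recast (Descending.evenFill y t (suc k) m q (suc q) ey) refl refl (λ v → v) refl refl far≡)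
    where
    far≡ : suc k * 2 * q + (2 + m * 2) * suc q ≡ q * y + (2 + m * 2)
    far≡ = subst (λ y → suc k * 2 * q + (2 + m * 2) * suc q ≡ q * y + (2 + m * 2)) (sym ey) (solve (k ∷ m ∷ q ∷ []))

  -- The leap uses up the remainder 1, and with all columns equally high no condition on the parity
  -- of y is left.
  twistFull : ∀ t q → 2 ≤ y → ∃[ u ] Path y (_< suc t + (y + (q * y + 0))) 0 u (t + pred y) 0 (suc (q * y + 0))
  twistFull t q 2≤y with halve y
  ... | zero , inj₁ refl = ⊥-elim (<⇒≱ 2≤y z≤n)
  ... | suc m , inj₁ ey = _ , hop₀ (recast (Descending.evenFill y t 0 m q q (trans ey (cong (2 +_) (sym (+-identityʳ (m * 2))))))
                                refl refl (λ v → v) (cong pred (sym ey)) refl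
                                    (trans (cong (_* q) (sym ey)) (trans (*-comm y q) (sym (+-identityʳ _)))))
  ... | m , inj₂ ey = _ , hop₀ (recast (Descending.oddFill y t 0 m q q (trans ey (cong suc (sym (+-identityʳ (m * 2))))))
                                refl refl (λ v → v) (cong pred (sym ey)) refl
                                    (trans (cong (_* q) (sym ey)) (trans (*-comm y q) (sym (+-identityʳ _)))))

  -- A single row above the run: columns without a second cell can be traversed in any direction, so they need no pairing.
  lowTwist : ∀ t k m → y ≡ 3 + (k * 2 + m * 2) →
             ∃[ u ] Path y (_< suc t + (y + (2 + k * 2))) 0 u (t + (2 + (m * 2 + k * 2))) 0 (3 + k * 2)
  lowTwist t k m ey = _ , hop {q = 0} {d = m * 2} (trans (cong (2 +_) (+-suc (k * 2) (m * 2))) (sym ey))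
      (recast (oddSnake m 0 0 (↓ ↓ u) ⋆ edge₁ (adj₁ (m * 2 + 0) (↓ u)) ⋆ evenSnake k (1 + (m * 2 + 0)) 1 u′)
        refl refl split (solve (m ∷ k ∷ [])) refl (solve (m ∷ k ∷ [])))
    where
    open Descending y t
    eq : ∀ i → 3 + (i + m * 2) ≡ 2 + (i + (1 + (m * 2 + 0)))
    eq i = solve (i ∷ m ∷ [])
    u′ : 1 + (k * 2 + (1 + (m * 2 + 0))) < y
    u′ = ≤-reflexive (trans (sym (eq (k * 2))) (sym ey))
    u : 3 + (m * 2 + 0) ≤ y
    u = ≤-trans (s≤s (s≤s (m≤n+m _ (k * 2)))) u′
    split : ∀ {p} → Level (suc (m * 2)) 0 1 p →
            (Cols 0 (1 + (m * 2 + 0)) 0 ∪ ∅ ∪ Cols (1 + (m * 2 + 0)) (2 + (k * 2 + (1 + (m * 2 + 0)))) 1) p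
    split {p} (inj₁ v) = inj₁ (subst (λ i → Cols 0 (suc i) 0 p) (sym (+-identityʳ (m * 2))) v)
    split {p} (inj₂ v) = inj₂ (inj₂ (subst₂ (λ i j → Cols (suc i) j 1 p) (sym (+-identityʳ (m * 2))) (trans ey (eq (k * 2))) v))

  -- Filling the last two columns of an odd block from the end cell of the last but one: one row is crossed
  -- horizontally, which trades a far step for a 1-step and so changes the parity of the far count.
  module _ (t q : ℕ) where
    open Ascending y t

    across : ∀ h i → Path y ∅ (h * y + bot i) (h * y + bot (suc i)) 1 0 0
    across h i = edge₁ (apart-+ {1} {bot i} {bot (suc i)} (h * y) (inj₁ refl))

    lastHook : ∀ i → Path y ((_≡ suc q * y + bot i) ∪ Column (bot (suc i)) (suc q) ∪ Column (bot i) q)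
                                      (suc q * y + bot i) (q * y + bot i) 2 0 (1 + (q + q))
    lastHook i = recast (point ⋆ across (suc q) i ⋆ rev (column (bot (suc i)) (suc q)) ⋆ rev (across 0 i) ⋆ column (bot i) q)
        refl refl split refl refl refl
      where
      split : ∀ {p} → ((_≡ suc q * y + bot i) ∪ Column (bot (suc i)) (suc q) ∪ Column (bot i) q) p →
              ((_≡ suc q * y + bot i) ∪ ∅ ∪ Column (bot (suc i)) (suc q) ∪ ∅ ∪ Column (bot i) q) p
      split (inj₁ v) = inj₁ v
      split (inj₂ (inj₁ v)) = inj₂ (inj₂ (inj₁ v))
      split (inj₂ (inj₂ v)) = inj₂ (inj₂ (inj₂ (inj₂ v)))

    shorter : ∀ {s p} → Column {y} s (suc q) p → ((_≡ suc q * y + s) ∪ Column s q) p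
    shorter (j , j≤ , e) with j ≤? q
    ... | yes j≤q = inj₂ (j , j≤q , e)
    ... | no  j≰q rewrite ≤-antisym j≤ (≰⇒> j≰q) = inj₁ e

    -- The horizontal crossing saves a far step: 2k high columns give `suc q * y + k * 2` minus one
    -- far steps, at the price of one 1-step beyond `t + pred y`.
    bent₁ : ∀ k m → y ≡ 3 + (m * 2 + k * 2) →
            ∃[ u ] Path y (_< t + (y + (suc q * y + k * 2))) 0 u (t + y) 0 (q * y + (2 + (m * 2 + k * 2) + k * 2))
    bent₁ k m ey = _ , enter {q = suc q} (≤-trans (s≤s (≤-trans (m≤n+m (k * 2) (m * 2)) (m≤n+m _ 2))) (≤-reflexive (sym ey)))
        (recast (pairs k 0 {suc (suc q)} (≤-<-trans (m≤n+m _ (m * 2)) (↓ ↓ u)) (oddSnake m _ (suc q) (↓ ↓ u)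
                  ⋆ across (suc q) (m * 2 + (k * 2 + 0)) ⋆ lastHook (1 + (m * 2 + (k * 2 + 0)))))
          refl refl split ones≡ refl far≡)
      where
      I = m * 2 + (k * 2 + 0)
      I≡ : I ≡ m * 2 + k * 2
      I≡ = cong (m * 2 +_) (+-identityʳ (k * 2))
      u : 2 + (m * 2 + (k * 2 + 0)) < y
      u = ≤-reflexive (trans (cong (3 +_) I≡) (sym ey))
      split : ∀ {p} → Level (k * 2) (suc (suc q)) (suc q) p →
              (Cols 0 (k * 2 + 0) (suc (suc q)) ∪ Cols (k * 2 + 0) (1 + I) (suc q) ∪ ∅ ∪
               ((_≡ suc q * y + bot (1 + I)) ∪ Column (bot (2 + I)) (suc q) ∪ Column (bot (1 + I)) q)) p
      split {p} (inj₁ v) = inj₁ (subst (λ i → Cols 0 i (suc (suc q)) p) (sym (+-identityʳ (k * 2))) v)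
      split {p} (inj₂ v) with Cols-split (1 + I) (subst₂ (λ i j → Cols i j (suc q) p) (sym (+-identityʳ (k * 2)))
          (trans ey (cong (3 +_) (sym I≡))) v)
      ... | inj₁ w = inj₂ (inj₁ w)
      ... | inj₂ w with Cols-two w
      ...   | inj₂ z = inj₂ (inj₂ (inj₂ (inj₂ (inj₁ z))))
      ...   | inj₁ z with shorter z
      ...     | inj₁ e = inj₂ (inj₂ (inj₂ (inj₁ e)))
      ...     | inj₂ z′ = inj₂ (inj₂ (inj₂ (inj₂ (inj₂ z′))))
      ones≡ : k * 2 + (m * 2 + (1 + 2)) ≡ y
      ones≡ = subst (k * 2 + (m * 2 + (1 + 2)) ≡_) (sym ey) (solve (k ∷ m ∷ []))
      far≡ : k * 2 * suc (suc q) + ((1 + m * 2) * suc q + (0 + (1 + (q + q)))) ≡ q * y + (2 + (m * 2 + k * 2) + k * 2)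
      far≡ = subst (λ y → k * 2 * suc (suc q) + ((1 + m * 2) * suc q + (0 + (1 + (q + q)))) ≡ q * y +
          (2 + (m * 2 + k * 2) + k * 2)) (sym ey) (solve (k ∷ m ∷ q ∷ []))

    -- The companion of `bent₁` in which only the last column is low: the last but one has an extra
    -- top cell, which is visited first.
    bent₂ : ∀ k → y ≡ 3 + k * 2 →
            ∃[ u ] Path y (_< t + (y + (suc q * y + suc k * 2))) 0 u (t + y) 0 (q * y + (4 + (k * 2 + k * 2)))
    bent₂ k ey = _ , enter {q = suc q} (≤-reflexive (sym ey))
        (recast (oddSnake k 0 (suc (suc q)) (↓ ↓ u)
                  ⋆ across (suc (suc q)) (k * 2 + 0) ⋆ point
                  ⋆ edgeₓ (inj₂ (+-assoc y (suc q * y) (bot (1 + I)))) ⋆ lastHook (1 + I))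
          refl refl split ones≡ refl far≡)
      where
      I = k * 2 + 0
      I≡ : I ≡ k * 2
      I≡ = +-identityʳ (k * 2)
      u : 2 + (k * 2 + 0) < y
      u = ≤-reflexive (trans (cong (3 +_) I≡) (sym ey))
      V : ℕ → Set
      V = Cols 0 (1 + I) (suc (suc q)) ∪ ∅ ∪ (_≡ suc (suc q) * y + bot (1 + I)) ∪ ∅ ∪
          ((_≡ suc q * y + bot (1 + I)) ∪ Column (bot (2 + I)) (suc q) ∪ Column (bot (1 + I)) q)
      top : ∀ {p} → Column {y} (bot (1 + I)) (suc (suc q)) p → V p
      top (j , j≤ , e) with j ≤? suc q
      ... | no  j≰q rewrite ≤-antisym j≤ (≰⇒> j≰q) = inj₂ (inj₂ (inj₁ e))
      ... | yes j≤q with shorter (j , j≤q , e)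
      ...   | inj₁ e′ = inj₂ (inj₂ (inj₂ (inj₂ (inj₁ e′))))
      ...   | inj₂ z  = inj₂ (inj₂ (inj₂ (inj₂ (inj₂ (inj₂ z)))))
      split : ∀ {p} → Level (suc k * 2) (suc (suc q)) (suc q) p → V p
      split {p} (inj₁ v) with Cols-split (1 + I) (subst (λ i → Cols 0 (2 + i) (suc (suc q)) p) (sym I≡) v)
      ... | inj₁ w = inj₁ w
      ... | inj₂ w = top (Cols-one w)
      split {p} (inj₂ v) = inj₂ (inj₂ (inj₂ (inj₂ (inj₂ (inj₁ (Cols-one
        (subst₂ (λ i j → Cols (2 + i) j (suc q) p) (sym I≡) (trans ey (cong (3 +_) (sym I≡))) v)))))))
      ones≡ : k * 2 + (1 + 2) ≡ y
      ones≡ = trans (+-comm (k * 2) 3) (sym ey)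
      far≡ : (1 + k * 2) * suc (suc q) + (0 + (0 + (1 + (1 + (q + q))))) ≡ q * y + (4 + (k * 2 + k * 2))
      far≡ = subst (λ y → (1 + k * 2) * suc (suc q) + (0 + (0 + (1 + (1 + (q + q))))) ≡ q * y + (4 + (k * 2 + k * 2))) (sym ey)
          (solve (k ∷ q ∷ []))

    -- Down and up instead of up and down: both ends lie in the top row, where a walk over an odd
    -- block in the other parity class ends as well.
    valleys : ∀ m i h → Path y (Cols i (2 + (m * 2 + i)) h) (h * y + bot i) (h * y + bot (1 + (m * 2 + i))) (1 + m * 2) 0
        ((2 + m * 2) * h)
    valleys zero i h = recast (rev (column (bot i) h) ⋆ across 0 i ⋆ column (bot (suc i)) h) refl refl split refl refl
        (cong (h +_) (sym (+-identityʳ h)))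
      where
      split : ∀ {p} → Cols i (2 + i) h p → (Column (bot i) h ∪ ∅ ∪ Column (bot (suc i)) h) p
      split v with Cols-two v
      ... | inj₁ w = inj₁ w
      ... | inj₂ w = inj₂ (inj₂ w)
    valleys (suc m) i h = recast (valleys m i h ⋆ across h (1 + (m * 2 + i)) ⋆ valleys 0 (2 + (m * 2 + i)) h)
        refl refl split (solve (m ∷ [])) refl (solve (m ∷ h ∷ []))
      where
      split : ∀ {p} → Cols i (4 + (m * 2 + i)) h p →
              (Cols i (2 + (m * 2 + i)) h ∪ ∅ ∪ Cols (2 + (m * 2 + i)) (4 + (m * 2 + i)) h) p
      split v with Cols-split (2 + (m * 2 + i)) v
      ... | inj₁ w = inj₁ w
      ... | inj₂ w = inj₂ (inj₂ w)

    within : ∀ {r p} → r < y → p < t + (y + (q * y + r)) → ((λ p → 0 ≤ p × p ≤ t + 0) ∪ Level r (suc q) q) p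
    within {p = p} r<y p< with p ≤? t + 0
    ... | yes p≤t = inj₁ (z≤n , p≤t)
    ... | no  p≰t = inj₂ (level r<y (<⇒≤ (subst (_< p) (+-identityʳ t) (≰⇒> p≰t))) p<)

    run₀ : Path y (λ p → 0 ≤ p × p ≤ t + 0) 0 t t 0 0
    run₀ = recast (run 0 t) refl (+-identityʳ t) (λ v → v) refl refl refl

    -- The last two columns are split off and walked from the top. Without the link to them there is
    -- one 1-step less than in a path on the same vertices.
    detached : ∀ k m → y ≡ 3 + (m * 2 + k * 2) →
               Pieces y (_< t + (y + (q * y + k * 2))) 0 (q * y + (1 + (m * 2 + k * 2) + t)) (q * y + (2 + (m * 2 + k * 2) + t))
                 (t + (k * 2 + m * 2)) (k * 2 * suc q + (1 + m * 2) * q) 1 (q + q)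
    detached k m ey = pieces
        (run₀ ⋆ pairs k 0 {suc q} (≤-<-trans (m≤n+m _ (m * 2)) (↓ ↓ u)) (oddSnake m _ q (↓ ↓ u)))
        (recast (valleys 0 (1 + I) q) (cong (λ i → q * y + (1 + i + t)) I≡) (cong (λ i → q * y + (2 + i + t)) I≡) (λ v → v) refl
            refl (cong (q +_) (+-identityʳ q)))
        cov
      where
      I = m * 2 + (k * 2 + 0)
      I≡ : m * 2 + (k * 2 + 0) ≡ m * 2 + k * 2
      I≡ = cong (m * 2 +_) (+-identityʳ (k * 2))
      u : 2 + (m * 2 + (k * 2 + 0)) < y
      u = ≤-reflexive (trans (cong (3 +_) I≡) (sym ey))
      cov : ∀ {p} → p < t + (y + (q * y + k * 2)) →
            (((λ p → 0 ≤ p × p ≤ t + 0) ∪ Cols 0 (k * 2 + 0) (suc q) ∪ Cols (k * 2 + 0) (1 + I) q) ∪ Cols (1 + I) (3 + I) q) p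
      cov {p} p< with within (≤-trans (s≤s (≤-trans (m≤n+m (k * 2) (m * 2)) (m≤n+m _ 2))) (≤-reflexive (sym ey))) p<
      ... | inj₁ v = inj₁ (inj₁ v)
      ... | inj₂ (inj₁ v) = inj₁ (inj₂ (inj₁ (subst (λ i → Cols 0 i (suc q) p) (sym (+-identityʳ (k * 2))) v)))
      ... | inj₂ (inj₂ v) with Cols-split (1 + I) (subst₂ (λ i j → Cols i j q p) (sym (+-identityʳ (k * 2)))
          (trans ey (cong (3 +_) (sym I≡))) v)
      ...   | inj₁ w = inj₁ (inj₂ (inj₂ w))
      ...   | inj₂ w = inj₂ w

    -- An odd number of high columns ends in row `suc q`, which the next column does not reach. The
    -- walk is cut there, and the low columns form a second piece.
    severed : ∀ k m → y ≡ 3 + (m * 2 + k * 2) →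
              Pieces y (_< t + (y + (q * y + (1 + k * 2)))) 0 (q * y + (1 + k * 2 + t)) (q * y + (2 + (m * 2 + k * 2) + t))
                (t + k * 2) ((1 + k * 2) * suc q) (1 + m * 2) ((2 + m * 2) * q)
    severed k m ey = pieces (run₀ ⋆ oddSnake k 0 (suc q) u)
        (recast (valleys m (1 + k * 2) q) refl (cong (λ i → q * y + (1 + i + t)) (+-suc (m * 2) (k * 2))) (λ v → v) refl refl
            refl)
        cov
      where
      r<y : 1 + k * 2 < y
      r<y = ≤-trans (s≤s (s≤s (≤-trans (m≤n+m (k * 2) (m * 2)) (n≤1+n _)))) (≤-reflexive (sym ey))
      u : k * 2 + 0 < y
      u = subst (_< y) (sym (+-identityʳ (k * 2))) (↓ r<y)
      cov : ∀ {p} → p < t + (y + (q * y + (1 + k * 2))) →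
            (((λ p → 0 ≤ p × p ≤ t + 0) ∪ Cols 0 (1 + (k * 2 + 0)) (suc q)) ∪ Cols (1 + k * 2) (2 + (m * 2 + (1 + k * 2))) q) p
      cov {p} p< with within r<y p<
      ... | inj₁ v = inj₁ (inj₁ v)
      ... | inj₂ (inj₁ v) = inj₁ (inj₂ (subst (λ i → Cols 0 (1 + i) (suc q) p) (sym (+-identityʳ (k * 2))) v))
      ... | inj₂ (inj₂ v) = inj₂ (subst (λ j → Cols (1 + k * 2) j q p) (trans ey (cong (2 +_) (sym (+-suc (m * 2) (k * 2))))) v)

  -- the first column is traversed downwards, so that the pairing of the others starts at the second one
  plunge : ∀ k m q → y ≡ 3 + (m * 2 + k * 2) →
           ∃[ u ] Path y (_< y + (q * y + (1 + k * 2))) (suc q * y) u (2 + (m * 2 + k * 2)) 0 (q * y + (1 + k * 2))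
  plunge k m q ey = _ , recast (rev (column 0 (suc q)) ⋆ across 0 0 0 0 ⋆ pairs k 1 {suc q} (≤-<-trans (m≤n+m _ (m * 2)) (↓ u))
      (evenSnake m _ q u))
      (+-identityʳ (suc q * y)) refl cov (solve (m ∷ k ∷ [])) refl far≡
    where
    open Ascending y 0
    u : 1 + (m * 2 + (k * 2 + 1)) < y
    u = ≤-reflexive (trans eq (sym ey))
      where
      eq : 2 + (m * 2 + (k * 2 + 1)) ≡ 3 + (m * 2 + k * 2)
      eq = solve (m ∷ k ∷ [])
    far≡ : suc q + (0 + (k * 2 * suc q + (2 + m * 2) * q)) ≡ q * y + (1 + k * 2)
    far≡ = subst (λ y → suc q + (0 + (k * 2 * suc q + (2 + m * 2) * q)) ≡ q * y + (1 + k * 2)) (sym ey) (solve (m ∷ k ∷ q ∷ []))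
    r<y : 1 + k * 2 < y
    r<y = ≤-trans (s≤s (s≤s (≤-trans (m≤n+m (k * 2) (m * 2)) (n≤1+n _)))) (≤-reflexive (sym ey))
    cov : ∀ {p} → p < y + (q * y + (1 + k * 2)) →
          (Column 0 (suc q) ∪ ∅ ∪ Cols 1 (k * 2 + 1) (suc q) ∪ Cols (k * 2 + 1) (2 + (m * 2 + (k * 2 + 1))) q) p
    cov {p} p< with level {q} {1 + k * 2} r<y z≤n p<
    ... | inj₂ v = inj₂ (inj₂ (inj₂ (subst₂ (λ i j → Cols i j q p) (+-comm 1 (k * 2)) (trans ey eq) v)))
      where
      eq : 3 + (m * 2 + k * 2) ≡ 2 + (m * 2 + (k * 2 + 1))
      eq = solve (m ∷ k ∷ [])
    ... | inj₁ v with Cols-split 1 v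
    ...   | inj₁ w = inj₁ (Cols-one w)
    ...   | inj₂ w = inj₂ (inj₂ (inj₁ (subst (λ i → Cols 1 i (suc q) p) (+-comm 1 (k * 2)) w)))

-- The even and the odd vertices of a walk on steps 1, 2 and x = 2 y each carry a problem with steps 1 and y only,
-- in which the old 2-steps are the 1-steps.
record HalfPath (y b c : ℕ) : Set where
  constructor halfPath
  field
    {end} : ℕ
    along : Path y (_< suc (b + c)) 0 end b 0 c

dbl-≤ : ∀ {k j} → k * 2 ≤ suc (j * 2) → k ≤ j
dbl-≤ {zero} _ = z≤n
dbl-≤ {suc k} {suc j} (s≤s (s≤s h)) = s≤s (dbl-≤ h)
dbl-≤ {suc zero} {zero} (s≤s ())

private
  mk : ∀ {y n u b b′ c c′} → Path y (_< n) 0 u b 0 c → n ≡ suc (b′ + c′) → b ≡ b′ → c ≡ c′ → HalfPath y b′ c′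
  mk P refl refl refl = halfPath P

  diff : ∀ {m n} → m ≤ n → ∃[ d ] n ≡ d + m
  diff {m} h with m≤n⇒∃[o]m+o≡n h
  ... | d , refl = d , +-comm m d

  size : ∀ t y z → t + (suc y + z) ≡ suc (t + y + z)
  size = solve-∀

  size′ : ∀ t y z → suc t + (suc y + z) ≡ suc (t + y + suc z)
  size′ = solve-∀

half-even : ∀ {y} t q k → k * 2 < y → HalfPath y (t + pred y) (q * y + k * 2)
half-even {y@(suc y′)} t q k r<y with halve y
... | suc j , inj₁ refl with diff (dbl-≤ {k} {j} (s≤s⁻¹ r<y))
...   | m , refl = mk (plainEven t k m q (solve (m ∷ k ∷ []))) (size t y′ _) (solve (t ∷ m ∷ k ∷ [])) refl
half-even {y@(suc y′)} t q k r<y | j , inj₂ refl with diff (dbl-≤ {k} {j} (≤-trans (s≤s⁻¹ r<y) (n≤1+n _)))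
...   | m , refl = mk (plainOdd t k m q (solve (m ∷ k ∷ []))) (size t y′ _) (solve (t ∷ m ∷ k ∷ [])) refl

half-full : ∀ {y} t q → 2 ≤ y → HalfPath y (t + pred y) (q * y + 1)
half-full {y@(suc y′)} t q 2≤y = mk (proj₂ (twistFull t q 2≤y)) (trans (size′ t y′ _) (cong (λ c → suc (t + y′ + c)) c≡)) refl c≡
  where
  c≡ : suc (q * y + 0) ≡ q * y + 1
  c≡ = sym (+-suc (q * y) 0)

-- The leap takes one of the 3 + 2k far steps beyond the full rows and leaves an even number of high
-- columns; as y is even, the low ones pair up too.
half-odd-even : ∀ {y} j t q k → y ≡ j * 2 → 3 + k * 2 < y → HalfPath y (t + pred y) (q * y + (3 + k * 2))
half-odd-even (suc j) t q k refl r<y with complement (k<j r<y)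
  where
  k<j : 3 + k * 2 < suc j * 2 → k < j
  k<j h = *-cancelʳ-< 2 k j (≤-trans (n≤1+n _) (s≤s⁻¹ (s≤s⁻¹ h)))
... | m , refl = mk (proj₂ (twistEven {suc (k + suc m) * 2} t m k q (solve (m ∷ k ∷ []))))
    (trans (size′ t _ _) (cong (λ c → suc (t + suc ((k + suc m) * 2) + c)) c≡)) (solve (t ∷ m ∷ k ∷ [])) c≡
  where
  c≡ : suc (q * (suc (k + suc m) * 2) + (2 + k * 2)) ≡ q * (suc (k + suc m) * 2) + (3 + k * 2)
  c≡ = sym (+-suc (q * (suc (k + suc m) * 2)) (2 + k * 2))

-- For odd y a leap leaves an odd number of low columns in front. With q = 0 these are single cells
-- and need no pairing; otherwise the bends are used, which consume the 1-step by which b exceeds y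
-- - 1.
half-odd-odd : ∀ {j} t q k → 3 + k * 2 < 1 + j * 2 → HalfPath (1 + j * 2) (t + (1 + j * 2)) (q * (1 + j * 2) + (3 + k * 2))
half-odd-odd {j} t q k r<y with complement {suc k} {j} (*-cancelʳ-< 2 (suc k) j (s≤s⁻¹ r<y))
half-odd-odd t zero k r<y | m , refl = low refl
  where
  low : ∀ {y} → y ≡ 1 + (suc k + suc m) * 2 → HalfPath y (t + y) (3 + k * 2)
  low {y} eq = mk (proj₂ (lowTwist {{nz}} (suc t) k (suc m) (trans eq (solve (m ∷ k ∷ [])))))
      (lift₁ t y (2 + k * 2)) (subst (λ y → suc t + (2 + (suc m * 2 + k * 2)) ≡ t + y) (sym eq) (solve (t ∷ m ∷ k ∷ []))) refl
    where
    nz : NonZero y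
    nz = subst NonZero (sym eq) _
    lift₁ : ∀ t y c → suc (suc t) + (y + c) ≡ suc (t + y + suc c)
    lift₁ = solve-∀
half-odd-odd t (suc q) k r<y | m , refl = bend m refl
  where
  bend : ∀ m {y} → y ≡ 1 + (suc k + suc m) * 2 → HalfPath y (t + y) (suc q * y + (3 + k * 2))
  rows : ∀ t y z k → t + (y + (z + suc k)) ≡ suc (t + y + (z + k))
  rows = solve-∀
  far≡ : ∀ z y k {y′} → suc y ≡ y′ → z + (y + suc k) ≡ y′ + z + k
  far≡ z y k refl = solve (z ∷ y ∷ k ∷ [])
  bend zero {y} eq = mk (proj₂ (bent₂ {{nz}} t q (suc k) y≡)) (rows t y (suc q * y) (3 + k * 2)) refl
      (trans (cong (q * y +_) (four (k * 2))) (far≡ (q * y) (4 + k * 2) (3 + k * 2) (sym y≡)))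
    where
    nz : NonZero y
    nz = subst NonZero (sym eq) _
    y≡ : y ≡ 5 + k * 2
    y≡ = trans eq (cong (λ k → 1 + k * 2) (cong suc (+-comm k 1)))
    four : ∀ k → 4 + (2 + k + (2 + k)) ≡ 4 + k + (4 + k)
    four = solve-∀
  bend (suc m) {y} eq = mk (proj₂ (bent₁ {{nz}} t q (2 + k) m y≡)) (rows t y (suc q * y) (3 + k * 2)) refl
      (far≡ (q * y) (2 + (m * 2 + (2 + k) * 2)) (3 + k * 2) (sym y≡))
    where
    nz : NonZero y
    nz = subst NonZero (sym eq) _
    y≡ : y ≡ 3 + (m * 2 + (2 + k) * 2)
    y≡ = trans eq (solve (m ∷ k ∷ []))

-- The remainder of c is even, or a shape insensitive to it is available.
data Fits (y b c : ℕ) : Set where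
  long : y ≤ b → Fits y b c
  even : ∀ j → y ≡ j * 2 → Fits y b c
  flat : ∀ q k → k * 2 < y → c ≡ q * y + k * 2 → Fits y b c

half-path : ∀ {y b} c → 2 ≤ y → y ≤ suc b → Fits y b c → HalfPath y b c
half-path {suc y} {b} c 2≤y (s≤s y≤b) f with diff y≤b
half-path {suc y} c 2≤y y≤b (flat q k r< refl) | t , refl = half-even t q k r<
half-path {suc y} c 2≤y y≤b (even j eq) | t , refl with quotient (suc y) c
... | q , r , r<y , refl with halve r
...   | k , inj₁ refl = half-even t q k r<y
...   | zero , inj₂ refl = half-full t q 2≤y
...   | suc k , inj₂ refl = half-odd-even j t q k eq r<y
half-path {suc y} c 2≤y y≤b (long y<b) | t , eq with quotient (suc y) c
half-path {suc y} c 2≤y y≤b (long y<b) | t , refl | q , r , r<y , refl with halve r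
... | k , inj₁ refl = half-even t q k r<y
... | zero , inj₂ refl = half-full t q 2≤y
... | suc k , inj₂ refl with halve (suc y)
...   | suc j , inj₁ refl = half-odd-even (suc j) t q k refl r<y
half-path {suc y} c 2≤y y≤b (long y<b) | zero , refl | q , r , r<y , refl | suc k , inj₂ refl | j , inj₂ refl =
    ⊥-elim (<-irrefl refl y<b)
half-path {suc y} c 2≤y y≤b (long y<b) | suc t , refl | q , r , r<y , refl | suc k , inj₂ refl | j , inj₂ refl =
  mk (HalfPath.along (half-odd-odd {j} t q k r<y)) (cong (λ b → suc (b + (q * (1 + j * 2) + (3 + k * 2)))) (+-suc t (j * 2)))
      (+-suc t (j * 2)) refl

-- Doubling

Dbl : ℕ → (ℕ → Set) → ℕ → Set
Dbl o V p = ∃[ q ] V q × p ≡ o + q * 2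

module _ {y : ℕ} (o : ℕ) where

  private
    f : ℕ → ℕ
    f p = o + p * 2

    near : ∀ {p q} → Apart 1 p q → Apart 2 (f p) (f q)
    near {p} (inj₁ refl) = inj₁ (trans (+-suc o _) (cong suc (+-suc o (p * 2))))
    near {q = q} (inj₂ refl) = inj₂ (trans (+-suc o _) (cong suc (+-suc o (q * 2))))

    distant : ∀ p → o + (y + p) * 2 ≡ y * 2 + (o + p * 2)
    distant p = solve (o ∷ y ∷ p ∷ [])

    afar : ∀ {p q} → Apart y p q → Apart (y * 2) (f p) (f q)
    afar {p} (inj₁ refl) = inj₁ (distant p)
    afar {q = q} (inj₂ refl) = inj₂ (distant q)

  doubleʷ : ∀ {s t} (w : Walk Apart y s t) → count two w ≡ 0 → Walk Apart (y * 2) (f s) (f t)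
  doubleʷ stop z = stop
  doubleʷ (step one r w) z = step two (near r) (doubleʷ w z)
  doubleʷ (step far r w) z = step far (afar r) (doubleʷ w z)

  count-double : ∀ {s t} (w : Walk Apart y s t) z → count one (doubleʷ w z) ≡ 0 ×
                 count two (doubleʷ w z) ≡ count one w × count far (doubleʷ w z) ≡ count far w
  count-double stop z = refl , refl , refl
  count-double (step one r w) z with count-double w z
  ... | e₁ , e₂ , e₃ = e₁ , cong suc e₂ , e₃
  count-double (step far r w) z with count-double w z
  ... | e₁ , e₂ , e₃ = e₁ , e₂ , cong suc e₃

  ∈-double : ∀ {s t p} (w : Walk Apart y s t) z → p ∈ vertices w → f p ∈ vertices (doubleʷ w z)
  ∈-double stop z (here refl) = here refl
  ∈-double (step one _ w) z (here refl) = here refl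
  ∈-double (step far _ w) z (here refl) = here refl
  ∈-double (step one _ w) z (there p∈) = there (∈-double w z p∈)
  ∈-double (step far _ w) z (there p∈) = there (∈-double w z p∈)

  double : ∀ {V s t b c} → Path y V s t b 0 c → Path (y * 2) (Dbl o V) (o + s * 2) (o + t * 2) 0 b c
  double (path w cov e₁ e₂ e₃) = path (doubleʷ w e₂) (λ { (q , v , refl) → ∈-double w e₂ (cov v) })
    (proj₁ (count-double w e₂)) (trans (proj₁ (proj₂ (count-double w e₂))) e₁) (trans (proj₂ (proj₂ (count-double w e₂))) e₃)

-- Opening a cycle through both parity classes

module _ {R : ℕ → ℕ → ℕ → Set} {x : ℕ} where

  record Cut {s t} (k : Kind) (w : Walk R x s t) : Set where
    constructor cut
    field
      {p q} : ℕ
      edge  : R (span x k) p q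
      left  : Walk R x s p
      right : Walk R x q t
      sums  : ∀ j → count j w ≡ count j left + (δ j k + count j right)
      parts : ∀ {v} → v ∈ vertices w → v ∈ vertices left ⊎ v ∈ vertices right

  cutAt : ∀ {s t} k (w : Walk R x s t) → 0 < count k w → Cut k w
  cutFirst : ∀ {s p t} k → R (span x k) s p → (w : Walk R x p t) → ∀ r → Cut k (step {R} {x} {s} k r w)
  cutFirst k r w r′ = cut r′ stop w (λ _ → refl) λ { (here refl) → inj₁ (here refl) ; (there v∈) → inj₂ v∈ }
  cutLater : ∀ {s p t} k k′ (r : R (span x k′) s p) (w : Walk R x p t) → Cut k w → Cut k (step k′ r w)
  cutLater k k′ r w (cut e l m sums parts) = cut e (step k′ r l) m
    (λ j → trans (cong (δ j k′ +_) (sums j)) (sym (+-assoc (δ j k′) _ _)))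
    λ { (here refl) → inj₁ (here refl) ; (there v∈) → map₁ there (parts v∈) }
  cutAt one (step one r w) h = cutFirst one r w r
  cutAt two (step two r w) h = cutFirst two r w r
  cutAt far (step far r w) h = cutFirst far r w r
  cutAt one (step two r w) h = cutLater one two r w (cutAt one w h)
  cutAt one (step far r w) h = cutLater one far r w (cutAt one w h)
  cutAt two (step one r w) h = cutLater two one r w (cutAt two w h)
  cutAt two (step far r w) h = cutLater two far r w (cutAt two w h)
  cutAt far (step one r w) h = cutLater far one r w (cutAt far w h)
  cutAt far (step two r w) h = cutLater far two r w (cutAt far w h)

-- Typically E and a walk over the other class have neighbouring ends and form a cycle; P and Q are
-- what is left of the other class when the cycle is opened inside it.
ring : ∀ {x W V V₁ V₂ s e s₁ e₁ s₂ e₂ b c b₁ c₁ b₂ c₂} → Path x W s e 0 b c → Apart 1 s s₁ → Apart 1 e e₂ →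
       Path x V₁ s₁ e₁ 0 b₁ c₁ → Path x V₂ s₂ e₂ 0 b₂ c₂ → (∀ {p} → V p → (V₁ ∪ V₂) p) →
       Route x (W ∪ V) 2 (b + (b₁ + b₂)) (c + (c₁ + c₂))
ring {x} {W} {V} {V₁} {V₂} {b = b} {c} {b₁} {c₁} {b₂} {c₂} E α β P Q cov =
  route (recast (rev P ⋆ edge₁ (swap α) ⋆ E ⋆ edge₁ β ⋆ rev Q) refl refl split refl (shuffle b₁ b b₂) (shuffle c₁ c c₂))
  where
  shuffle : ∀ m n k → m + (0 + (n + (0 + k))) ≡ n + (m + k)
  shuffle = solve-∀
  split : ∀ {p} → (W ∪ V) p → (V₁ ∪ ∅ ∪ W ∪ ∅ ∪ V₂) p
  split (inj₁ w) = inj₂ (inj₂ (inj₁ w))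
  split (inj₂ v) with cov v
  ... | inj₁ v₁ = inj₁ v₁
  ... | inj₂ v₂ = inj₂ (inj₂ (inj₂ (inj₂ v₂)))

module _ {x : ℕ} {W V : ℕ → Set} {s e s′ e′ b c : ℕ} (E : Path x W s e 0 b c) (α : Apart 1 s s′) (β : Apart 1 e e′) where

  -- The step at which the cycle is opened drops out of the total, so two halves with equally many
  -- 2-steps yield an odd number of them. `ringₓ` does the same for far steps.
  ring₂ : ∀ {b′ c′} → Path x V s′ e′ 0 (suc b′) c′ → Route x (W ∪ V) 2 (b + b′) (c + c′)
  ring₂ (path w cov e₁ e₂ e₃) with cutAt two w (subst (0 <_) (sym e₂) z<s)
  ... | cut r l m sums parts with m+n≡0⇒m≡0 (count one l) (trans (sym (sums one)) e₁) | m+n≡0⇒n≡0 (count one l)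
      (trans (sym (sums one)) e₁)
  ...   | l₁ | m₁ with suc-injective (trans (sym (+-suc (count two l) (count two m))) (trans (sym (sums two)) e₂)) | trans
      (sym (sums far)) e₃
  ...     | refl | refl = ring E α β (path l (λ v → v) l₁ refl refl) (path m (λ v → v) m₁ refl refl) (λ v → parts (cov v))

  ringₓ : ∀ {b′ c′} → Path x V s′ e′ 0 b′ (suc c′) → Route x (W ∪ V) 2 (b + b′) (c + c′)
  ringₓ (path w cov e₁ e₂ e₃) with cutAt far w (subst (0 <_) (sym e₃) z<s)
  ... | cut r l m sums parts with m+n≡0⇒m≡0 (count one l) (trans (sym (sums one)) e₁) | m+n≡0⇒n≡0 (count one l)
      (trans (sym (sums one)) e₁)
  ...   | l₁ | m₁ with trans (sym (sums two)) e₂ | suc-injective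
      (trans (sym (+-suc (count far l) (count far m))) (trans (sym (sums far)) e₃))
  ...     | refl | refl = ring E α β (path l (λ v → v) l₁ refl refl) (path m (λ v → v) m₁ refl refl) (λ v → parts (cov v))

reroute : ∀ {x V W a b c a′ b′ c′} → Route x V a b c → (∀ {p} → W p → V p) → a ≡ a′ → b ≡ b′ → c ≡ c′ → Route x W a′ b′ c′
reroute (route P) f e₁ e₂ e₃ = route (recast P refl refl f e₁ e₂ e₃)

alternate : ∀ {n} p → p < n + n → (Dbl 0 (_< n) ∪ Dbl 1 (_< n)) p
alternate {n} p p< with halve p
... | k , inj₁ refl = inj₁ (k , *-cancelʳ-< 2 k n (≤-trans p< (≤-reflexive (solve (n ∷ [])))) , refl)
... | k , inj₂ refl = inj₂ (k , *-cancelʳ-< 2 k n (≤-trans (n≤1+n _) (≤-trans p< (≤-reflexive (solve (n ∷ []))))) , refl)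

alternate⁺ : ∀ {n} p → p < suc (n + n) → (Dbl 0 (_< suc n) ∪ Dbl 1 (_< n)) p
alternate⁺ {n} p p< with halve p
... | k , inj₁ refl = inj₁ (k , s≤s (*-cancelʳ-≤ k n 2 (≤-trans (s≤s⁻¹ p<) (≤-reflexive (solve (n ∷ []))))) , refl)
... | k , inj₂ refl = inj₂ (k , *-cancelʳ-< 2 k n (≤-trans (s≤s⁻¹ p<) (≤-reflexive (solve (n ∷ [])))) , refl)

-- For odd orders, setting 0 apart leaves two classes of equal size, so that one half-path serves
-- both.
shifted : ∀ {n} p → p < suc (n + n) → ((_≡ 0) ∪ Dbl 1 (_< n) ∪ Dbl 2 (_< n)) p
shifted zero p< = inj₁ refl
shifted {n} (suc p) p< with alternate {n} p (s≤s⁻¹ p<)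
... | inj₁ (q , h , refl) = inj₂ (inj₁ (q , h , refl))
... | inj₂ (q , h , refl) = inj₂ (inj₂ (q , h , refl))

-- The only shapes not covered by half-path: y odd, no spare 1-step, and odd remainder.
data Shape (y b c : ℕ) : Set where
  fits   : Fits y b c → Shape y b c
  pinned : ∀ k m q → y ≡ 3 + (m * 2 + k * 2) → b ≡ pred y → c ≡ q * y + (1 + k * 2) → Shape y b c

shape : ∀ {y} b c → 2 ≤ y → y ≤ suc b → Shape y b c
shape {y@(suc y′)} b c 2≤y y≤ with y ≤? b
... | yes h = fits (long h)
... | no y≰b with halve y
...   | j , inj₁ e = fits (even j e)
...   | j , inj₂ e with quotient y c
...     | q , r , r<y , c≡ with halve r
...       | k , inj₁ refl = fits (flat q k r<y c≡)
...       | k , inj₂ refl with complement (*-cancelʳ-< 2 k j (s≤s⁻¹ (subst (suc (k * 2) <_) e r<y)))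
...         | m , refl = pinned k m q (trans e (solve (k ∷ m ∷ []))) (≤-antisym (s≤s⁻¹ (≰⇒> y≰b)) (s≤s⁻¹ y≤)) c≡

-- Paths with one or two 1-steps

join : ∀ {y V W s t s′ t′ b c b′ c′} → Path y V s t b 0 c → Apart 1 (t * 2) (1 + s′ * 2) → Path y W s′ t′ b′ 0 c′ →
       Route (y * 2) (Dbl 0 V ∪ Dbl 1 W) 1 (b + b′) (c + c′)
join P α Q = route (recast (double 0 P ⋆ edge₁ α ⋆ double 1 Q)
  refl refl (λ { (inj₁ v) → inj₁ v ; (inj₂ v) → inj₂ (inj₂ v) }) refl refl refl)

joined : ∀ {y b₁ c₁ b₂ c₂} → HalfPath y b₁ c₁ → HalfPath y b₂ c₂ →
         Route (y * 2) (Dbl 0 (_< suc (b₁ + c₁)) ∪ Dbl 1 (_< suc (b₂ + c₂))) 1 (b₁ + b₂) (c₁ + c₂)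
joined H₁ H₂ = join (rev (HalfPath.along H₁)) (inj₁ refl) (HalfPath.along H₂)

-- The single 1-step is the only passage between the parity classes, and the other steps are shared
-- out as equally as possible. Half-paths start at 0, so their copies start at the neighbours 0 and
-- 1.
single : ∀ {y} b c → 2 ≤ y → y * 2 ≤ 2 + b → Route (y * 2) (_< 2 + (b + c)) 1 b c
single {y} b c 2≤y y≤ with halve b | halve c
... | k , inj₁ refl | m , inj₁ refl = even-even
  where
  cov : ∀ {p} → p < 2 + (k * 2 + m * 2) → (Dbl 0 (_< suc (k + m)) ∪ Dbl 1 (_< suc (k + m))) p
  cov {p} p< = alternate {suc (k + m)} p (≤-trans p< (≤-reflexive (solve (k ∷ m ∷ []))))
  dbl : ∀ k → k + k ≡ k * 2
  dbl = solve-∀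
  even-even : Route (y * 2) (_< 2 + (k * 2 + m * 2)) 1 (k * 2) (m * 2)
  even-even with shape k m 2≤y (dbl-≤ (≤-trans y≤ (n≤1+n _)))
  ... | fits f = reroute (joined (half-path m 2≤y (dbl-≤ (≤-trans y≤ (n≤1+n _))) f)
      (half-path m 2≤y (dbl-≤ (≤-trans y≤ (n≤1+n _))) f))
                   cov refl (dbl k) (dbl m)
  -- Both classes are walked by the same `plunge`, whose two copies again start at neighbours.
  ... | pinned k′ m′ q refl refl refl = reroute (join (rev P) (inj₁ refl) P) cov refl (dbl k) (dbl m)
    where P = proj₂ (plunge k′ m′ q refl)
... | k , inj₂ refl | m , inj₂ refl = odd-odd
  where
  y≤k : y ≤ suc k
  y≤k = dbl-≤ y≤
  -- The even class gets the odd 2-step and the odd class the odd far step, so the classes are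
  -- equally large.
  E = half-path m 2≤y (≤-trans y≤k (n≤1+n _)) (long y≤k)
  cov : ∀ {p} → p < 2 + (suc (k * 2) + suc (m * 2)) → (Dbl 0 (_< suc (suc k + m)) ∪ Dbl 1 (_< suc (k + suc m))) p
  cov {p} p< rewrite +-suc k m = alternate {suc (suc (k + m))} p (≤-trans p< (≤-reflexive (solve (k ∷ m ∷ []))))
  sum : ∀ k → suc k + k ≡ suc (k * 2)
  sum = solve-∀
  sum′ : ∀ m → m + suc m ≡ suc (m * 2)
  sum′ = solve-∀
  odd-odd : Route (y * 2) (_< 2 + (suc (k * 2) + suc (m * 2))) 1 (suc (k * 2)) (suc (m * 2))
  odd-odd with shape k (suc m) 2≤y y≤k
  ... | fits f = reroute (joined E (half-path (suc m) 2≤y y≤k f)) cov refl (sum k) (sum′ m)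
  ... | pinned k′ m′ q ey refl c≡ = reroute (join (plainOdd {{nz}} 1 k′ (suc m′) q ey) α (proj₂ (plunge {{nz}} k′ m′ q ey))) cov′
      refl
          (ones k′ m′ ey) (trans (cong (_+ (q * y + suc (k′ * 2))) (sym m≡)) (trans (cong (m +_) (sym c≡)) (sum′ m)))
    where
    nz : NonZero y
    nz = subst NonZero (sym ey) _
    m≡ : m ≡ q * y + k′ * 2
    m≡ = suc-injective (trans c≡ (+-suc (q * y) (k′ * 2)))
    α : Apart 1 ((q * y + (suc m′ * 2 + k′ * 2 + 1)) * 2) (1 + (suc q * y) * 2)
    α = inj₁ (cong (λ z → 1 + z * 2) (subst (λ z → z + q * y ≡ q * y + (suc m′ * 2 + k′ * 2 + 1)) (sym ey) (lemma (q * y) k′ m′)))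
      where
      lemma : ∀ z k m → 3 + (m * 2 + k * 2) + z ≡ z + (suc m * 2 + k * 2 + 1)
      lemma = solve-∀
    ones : ∀ k m {y} → y ≡ 3 + (m * 2 + k * 2) → 1 + (k * 2 + suc m * 2) + (2 + (m * 2 + k * 2)) ≡ suc (pred y * 2)
    ones k m refl = go k m
      where
      go : ∀ k m → 1 + (k * 2 + suc m * 2) + (2 + (m * 2 + k * 2)) ≡ suc ((2 + (m * 2 + k * 2)) * 2)
      go = solve-∀
    n≡₁ : suc (suc (pred y) + m) ≡ 1 + (y + (q * y + k′ * 2))
    n≡₁ = cong suc (cong₂ _+_ (suc-pred y {{nz}}) m≡)
    n≡₂ : suc (pred y + suc m) ≡ y + (q * y + (1 + k′ * 2))
    n≡₂ = cong₂ _+_ (suc-pred y {{nz}}) c≡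
    cov′ : ∀ {p} → p < 2 + (suc (pred y * 2) + suc (m * 2)) →
           (Dbl 0 (_< 1 + (y + (q * y + k′ * 2))) ∪ Dbl 1 (_< y + (q * y + (1 + k′ * 2)))) p
    cov′ {p} p< = subst₂ (λ m n → (Dbl 0 (_< m) ∪ Dbl 1 (_< n)) p) n≡₁ n≡₂ (cov p<)
single {y} b c 2≤y y≤ | k , inj₂ refl | m , inj₁ refl = odd-even
  where
  y≤k : y ≤ suc k
  y≤k = dbl-≤ y≤
  odd-even : Route (y * 2) (_< 2 + (suc (k * 2) + m * 2)) 1 (suc (k * 2)) (m * 2)
  odd-even with shape k m 2≤y y≤k
  -- The passage 2, 0, 1 joins the copy on the positive even vertices to the copy on the odd ones.
  ... | fits f = route (recast (rev (double 2 P) ⋆ edge₂ (inj₂ refl) ⋆ point ⋆ edge₁ (inj₁ refl) ⋆ double 1 P)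
                   refl refl cov refl (twos k) (fars m))
    where
    P = HalfPath.along (half-path m 2≤y y≤k f)
    twos : ∀ k → k + (1 + (0 + (0 + k))) ≡ suc (k * 2)
    twos = solve-∀
    fars : ∀ m → m + (0 + (0 + (0 + m))) ≡ m * 2
    fars = solve-∀
    cov : ∀ {p} → p < 2 + (suc (k * 2) + m * 2) → (Dbl 2 (_< suc (k + m)) ∪ ∅ ∪ (_≡ 0) ∪ ∅ ∪ Dbl 1 (_< suc (k + m))) p
    cov {p} p< with shifted {suc (k + m)} p (≤-trans p< (≤-reflexive (solve (k ∷ m ∷ []))))
    ... | inj₁ v = inj₂ (inj₂ (inj₁ v))
    ... | inj₂ (inj₁ v) = inj₂ (inj₂ (inj₂ (inj₂ v)))
    ... | inj₂ (inj₂ v) = inj₁ v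
  -- Sharing the far steps as m + 1 and m - 1 makes both remainders even.
  ... | pinned k′ m′ q ey _ refl = reroute (joined
            (half-path (suc m) 2≤y y≤k (flat q (suc k′) r<y (sym (+-suc (q * y) _))))
            (half-path (q * y + k′ * 2) 2≤y (≤-trans y≤k (n≤1+n _)) (flat q k′ (<-trans (n<1+n _) (<-trans (n<1+n _) r<y)) refl)))
          cov refl (twos k) (fars (q * y) (k′ * 2))
    where
    r<y : suc k′ * 2 < y
    r<y = ≤-trans (s≤s (s≤s (s≤s (m≤n+m (k′ * 2) (m′ * 2))))) (≤-reflexive (sym ey))
    twos : ∀ k → k + suc k ≡ suc (k * 2)
    twos = solve-∀
    fars : ∀ z r → suc (z + (1 + r)) + (z + r) ≡ (z + (1 + r)) * 2
    fars = solve-∀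
    size≡ : ∀ k z r → 2 + (suc (k * 2) + (z + (1 + r)) * 2) ≡ suc (suc (suc k + (z + r)) + suc (suc k + (z + r)))
    size≡ = solve-∀
    n≡ : ∀ k z r → suc (suc (suc k + (z + r))) ≡ suc (k + suc (z + (1 + r)))
    n≡ = solve-∀
    cov : ∀ {p} → p < 2 + (suc (k * 2) + m * 2) →
          (Dbl 0 (_< suc (k + suc m)) ∪ Dbl 1 (_< suc (suc k + (q * y + k′ * 2)))) p
    cov {p} p< = subst (λ n → (Dbl 0 (_< n) ∪ Dbl 1 (_< suc (suc k + (q * y + k′ * 2)))) p) (n≡ k (q * y) (k′ * 2))
                   (alternate⁺ {suc (suc k + (q * y + k′ * 2))} p (≤-trans p< (≤-reflexive (size≡ k (q * y) (k′ * 2)))))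
single {y} b c 2≤y y≤ | k , inj₁ refl | m , inj₂ refl = even-odd
  where
  y≤k : y ≤ suc k
  y≤k = dbl-≤ (≤-trans y≤ (n≤1+n _))
  twos : ∀ k → k + k ≡ k * 2
  twos = solve-∀
  fars : ∀ m → suc m + m ≡ suc (m * 2)
  fars = solve-∀
  cov : ∀ {p} → p < 2 + (k * 2 + suc (m * 2)) → (Dbl 0 (_< suc (k + suc m)) ∪ Dbl 1 (_< suc (k + m))) p
  cov {p} p< rewrite +-suc k m = alternate⁺ {suc (k + m)} p (≤-trans p< (≤-reflexive (solve (k ∷ m ∷ []))))
  even-odd : Route (y * 2) (_< 2 + (k * 2 + suc (m * 2))) 1 (k * 2) (suc (m * 2))
  even-odd with shape k (suc m) 2≤y y≤k | shape k m 2≤y y≤k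
  ... | fits f | fits g = reroute (joined (half-path (suc m) 2≤y y≤k f) (half-path m 2≤y y≤k g)) cov refl (twos k) (fars m)
  -- The odd class has the even remainder, and there `plainOdd` ends at a neighbour of the start of
  -- `plunge`.
  ... | pinned k′ m′ q ey refl c≡ | _ = reroute (join (rev (proj₂ (plunge {{nz}} k′ m′ q ey))) α
      (rev (plainOdd {{nz}} 0 k′ (suc m′) q ey)))
          cov′ refl (ones k′ m′ ey) (trans (cong₂ _+_ (sym c≡) (sym m≡)) (fars m))
    where
    nz : NonZero y
    nz = subst NonZero (sym ey) _
    m≡ : m ≡ q * y + k′ * 2
    m≡ = suc-injective (trans c≡ (+-suc (q * y) (k′ * 2)))
    α : Apart 1 ((suc q * y) * 2) (1 + (q * y + (suc m′ * 2 + k′ * 2 + 0)) * 2)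
    α = inj₂ (cong (_* 2) (subst (λ z → z + q * y ≡ suc (q * y + (suc m′ * 2 + k′ * 2 + 0))) (sym ey) (lemma (q * y) k′ m′)))
      where
      lemma : ∀ z k m → 3 + (m * 2 + k * 2) + z ≡ suc (z + (suc m * 2 + k * 2 + 0))
      lemma = solve-∀
    ones : ∀ k m {y} → y ≡ 3 + (m * 2 + k * 2) → 2 + (m * 2 + k * 2) + (0 + (k * 2 + suc m * 2)) ≡ pred y * 2
    ones k m refl = go k m
      where
      go : ∀ k m → 2 + (m * 2 + k * 2) + (0 + (k * 2 + suc m * 2)) ≡ (2 + (m * 2 + k * 2)) * 2
      go = solve-∀
    cov′ : ∀ {p} → p < 2 + (pred y * 2 + suc (m * 2)) →
           (Dbl 0 (_< y + (q * y + (1 + k′ * 2))) ∪ Dbl 1 (_< 0 + (y + (q * y + k′ * 2)))) p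
    cov′ {p} p< = subst₂ (λ m n → (Dbl 0 (_< m) ∪ Dbl 1 (_< n)) p)
                    (cong₂ _+_ (suc-pred y {{nz}}) c≡) (cong₂ _+_ (suc-pred y {{nz}}) m≡) (cov p<)
  -- Now the odd class has the odd remainder. For the other class `plainOdd` ends in the wrong
  -- place; `twistOdd` has the same counts and ends next to the start of `plunge`.
  ... | fits _ | pinned k′ m′ q ey refl refl = reroute (join (twistOdd {{nz}} 0 m′ k′ q ey′) α (proj₂ (plunge {{nz}} k′ m′ q ey)))
          cov′ refl (ones k′ m′ ey) (fars m)
    where
    nz : NonZero y
    nz = subst NonZero (sym ey) _
    ey′ : y ≡ 1 + (k′ * 2 + suc m′ * 2)
    ey′ = trans ey (solve (k′ ∷ m′ ∷ []))
    α : Apart 1 ((suc q * y + 1) * 2) (1 + (suc q * y) * 2)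
    α = inj₂ (cong (_* 2) (+-comm (suc q * y) 1))
    ones : ∀ k m {y} → y ≡ 3 + (m * 2 + k * 2) → 0 + (suc m * 2 + k * 2) + (2 + (m * 2 + k * 2)) ≡ pred y * 2
    ones k m refl = go k m
      where
      go : ∀ k m → 0 + (suc m * 2 + k * 2) + (2 + (m * 2 + k * 2)) ≡ (2 + (m * 2 + k * 2)) * 2
      go = solve-∀
    cov′ : ∀ {p} → p < 2 + (pred y * 2 + suc (m * 2)) →
           (Dbl 0 (_< 1 + (y + (q * y + (1 + k′ * 2)))) ∪ Dbl 1 (_< y + (q * y + (1 + k′ * 2)))) p
    cov′ {p} p< = subst₂ (λ i j → (Dbl 0 (_< i) ∪ Dbl 1 (_< j)) p)
                    (trans (+-suc (suc (pred y)) m) (cong (λ y → suc (y + m)) (suc-pred y {{nz}})))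
                        (cong (_+ m) (suc-pred y {{nz}})) (cov p<)

-- Two copies of one half-path have neighbouring ends at both sides, so two 1-steps close them to a
-- cycle; the place where it is opened settles the parities of b and c. If both are even, 0 is
-- attached to the shorter structure instead.
twin : ∀ {y} b c → 2 ≤ y → y * 2 ≤ 2 + b → Route (y * 2) (_< 3 + (b + c)) 2 b c
twin {y} b c 2≤y y≤ with halve b | halve c
... | k , inj₂ refl | m , inj₁ refl =
  reroute (ring₂ (double 0 P) (inj₁ refl) (inj₁ refl) (double 1 P)) cov refl (cong suc (twos k)) (fars m)
  where
  y≤k : y ≤ suc k
  y≤k = dbl-≤ y≤
  P = HalfPath.along (half-path m 2≤y (≤-trans y≤k (n≤1+n _)) (long y≤k))
  twos : ∀ k → k + k ≡ k * 2
  twos = solve-∀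
  fars : ∀ m → m + m ≡ m * 2
  fars = solve-∀
  cov : ∀ {p} → p < 3 + (suc (k * 2) + m * 2) → (Dbl 0 (_< suc (suc k + m)) ∪ Dbl 1 (_< suc (suc k + m))) p
  cov {p} p< = alternate {suc (suc k + m)} p (≤-trans p< (≤-reflexive (solve (k ∷ m ∷ []))))
... | k , inj₁ refl | m , inj₂ refl = even-odd
  where
  y≤k : y ≤ suc k
  y≤k = dbl-≤ (≤-trans y≤ (n≤1+n _))
  twos : ∀ k → k + k ≡ k * 2
  twos = solve-∀
  fars : ∀ m → suc m + m ≡ suc (m * 2)
  fars = solve-∀
  cov : ∀ {p} → p < 3 + (k * 2 + suc (m * 2)) → (Dbl 0 (_< suc (k + suc m)) ∪ Dbl 1 (_< suc (k + suc m))) p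
  cov {p} p< = alternate {suc (k + suc m)} p (≤-trans p< (≤-reflexive (solve (k ∷ m ∷ []))))
  twice : ∀ {s e} → Path y (_< suc (k + suc m)) s e k 0 (suc m) → Route (y * 2) (_< 3 + (k * 2 + suc (m * 2))) 2 (k * 2)
      (suc (m * 2))
  twice P = reroute (ringₓ (double 0 P) (inj₁ refl) (inj₁ refl) (double 1 P)) cov refl (twos k) (fars m)
  even-odd : Route (y * 2) (_< 3 + (k * 2 + suc (m * 2))) 2 (k * 2) (suc (m * 2))
  even-odd with shape k (suc m) 2≤y y≤k
  ... | fits f = twice (HalfPath.along (half-path (suc m) 2≤y y≤k f))
  ... | pinned k′ m′ q ey refl c≡ = twice (recast (proj₂ (plunge {{nz}} k′ m′ q ey)) refl refl n≡ (sym (cong pred ey)) refl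
      (sym c≡))
    where
    nz : NonZero y
    nz = subst NonZero (sym ey) _
    n≡ : ∀ {p} → p < suc (pred y + suc m) → p < y + (q * y + (1 + k′ * 2))
    n≡ {p} = subst (p <_) (cong₂ _+_ (suc-pred y {{nz}}) c≡)
twin {y} b c 2≤y y≤ | k , inj₁ refl | m , inj₁ refl = even-even
  where
  y≤k : y ≤ suc k
  y≤k = dbl-≤ (≤-trans y≤ (n≤1+n _))
  even-even : Route (y * 2) (_< 3 + (k * 2 + m * 2)) 2 (k * 2) (m * 2)
  even-even with shape k m 2≤y y≤k
  ... | fits f = route (recast (point ⋆ edge₁ (inj₁ refl) ⋆ double 1 P ⋆ edge₁ (inj₁ refl) ⋆ rev (double 2 P))
                   refl refl cov refl (twos k) (fars m))
    where
    P = HalfPath.along (half-path m 2≤y y≤k f)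
    twos : ∀ k → 0 + (0 + (k + (0 + k))) ≡ k * 2
    twos = solve-∀
    fars : ∀ m → 0 + (0 + (m + (0 + m))) ≡ m * 2
    fars = solve-∀
    cov : ∀ {p} → p < 3 + (k * 2 + m * 2) → ((_≡ 0) ∪ ∅ ∪ Dbl 1 (_< suc (k + m)) ∪ ∅ ∪ Dbl 2 (_< suc (k + m))) p
    cov {p} p< with shifted {suc (k + m)} p (≤-trans p< (≤-reflexive (solve (k ∷ m ∷ []))))
    ... | inj₁ v = inj₁ v
    ... | inj₂ (inj₁ v) = inj₂ (inj₂ (inj₁ v))
    ... | inj₂ (inj₂ v) = inj₂ (inj₂ (inj₂ (inj₂ v)))
  ... | pinned k′ m′ q refl refl refl with detached 1 q k′ m′ refl
  -- The far steps are shared as m + 1 and m - 1, which makes both remainders even. The odd class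
  -- then has two vertices more than steps, exactly as two pieces do.
  ...   | pieces {V₁} {V₂} P Q covers = reroute (ring (double 0 (plainOdd 0 (suc k′) m′ q E≡)) (inj₁ refl) β (double 1 P)
      (rev (double 1 Q)) covers′)
                                   cov refl (twos k′ m′) (fars k′ m′ q)
    where
    E≡ : 3 + (m′ * 2 + k′ * 2) ≡ 1 + (m′ * 2 + suc k′ * 2)
    E≡ = solve (m′ ∷ k′ ∷ [])
    z = q * (3 + (m′ * 2 + k′ * 2))
    β : Apart 1 ((z + (m′ * 2 + suc k′ * 2 + 0)) * 2) (1 + (z + (1 + (m′ * 2 + k′ * 2) + 1)) * 2)
    β = inj₁ (cong (λ e → 1 + (z + e) * 2) (lemma k′ m′))
      where
      lemma : ∀ k m → 1 + (m * 2 + k * 2) + 1 ≡ m * 2 + suc k * 2 + 0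
      lemma = solve-∀
    V = _< 1 + (3 + (m′ * 2 + k′ * 2) + (z + k′ * 2))
    covers′ : ∀ {p} → Dbl 1 V p → (Dbl 1 V₁ ∪ Dbl 1 V₂) p
    covers′ (i , v , e) with covers v
    ... | inj₁ w = inj₁ (i , w , e)
    ... | inj₂ w = inj₂ (i , w , e)
    twos : ∀ k m → 0 + (suc k * 2 + m * 2) + (1 + (k * 2 + m * 2) + 1) ≡ (2 + (m * 2 + k * 2)) * 2
    twos = solve-∀
    fars : ∀ k m q → q * (3 + (m * 2 + k * 2)) + suc k * 2 + (k * 2 * suc q + (1 + m * 2) * q + (q + q))
           ≡ (q * (3 + (m * 2 + k * 2)) + (1 + k * 2)) * 2
    fars = solve-∀
    size≡ : ∀ y z r → 3 + ((2 + y) * 2 + (z + (1 + r)) * 2) ≡ suc (suc (3 + y + (z + r)) + suc (3 + y + (z + r)))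
    size≡ = solve-∀
    n≡ : ∀ y z r → suc (suc (3 + y + (z + r))) ≡ 0 + (3 + y + (z + suc (suc r)))
    n≡ = solve-∀
    cov : ∀ {p} → p < 3 + ((2 + (m′ * 2 + k′ * 2)) * 2 + (z + (1 + k′ * 2)) * 2) →
          (Dbl 0 (_< 0 + (3 + (m′ * 2 + k′ * 2) + (z + suc k′ * 2))) ∪ Dbl 1 V) p
    cov {p} p< = subst (λ n → (Dbl 0 (_< n) ∪ Dbl 1 V) p) (n≡ (m′ * 2 + k′ * 2) z (k′ * 2))
                   (alternate⁺ {suc (3 + (m′ * 2 + k′ * 2) + (z + k′ * 2))} p
                       (≤-trans p< (≤-reflexive (size≡ (m′ * 2 + k′ * 2) z (k′ * 2)))))
twin {y} b c 2≤y y≤ | k , inj₂ refl | m , inj₂ refl = odd-odd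
  where
  y≤k : y ≤ suc k
  y≤k = dbl-≤ y≤
  odd-odd : Route (y * 2) (_< 3 + (suc (k * 2) + suc (m * 2))) 2 (suc (k * 2)) (suc (m * 2))
  odd-odd with shape k (suc m) 2≤y y≤k
  ... | fits f = reroute (ringₓ E (inj₁ refl) (inj₂ refl) (double 1 P)) cov refl (twos k) (fars m)
    where
    P = HalfPath.along (half-path (suc m) 2≤y y≤k f)
    E = point ⋆ edge₂ (inj₁ refl) ⋆ double 2 P
    twos : ∀ k → suc k + k ≡ suc (k * 2)
    twos = solve-∀
    fars : ∀ m → suc m + m ≡ suc (m * 2)
    fars = solve-∀
    cov : ∀ {p} → p < 3 + (suc (k * 2) + suc (m * 2)) → (((_≡ 0) ∪ ∅ ∪ Dbl 2 (_< suc (k + suc m))) ∪ Dbl 1 (_< suc (k + suc m))) p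
    cov {p} p< with shifted {suc (k + suc m)} p (≤-trans p< (≤-reflexive (solve (k ∷ m ∷ []))))
    ... | inj₁ v = inj₁ (inj₁ v)
    ... | inj₂ (inj₁ v) = inj₂ v
    ... | inj₂ (inj₂ v) = inj₁ (inj₂ (inj₂ v))
  ... | pinned k′ m′ q refl refl c≡ with suc-injective (trans c≡ (+-suc (q * (3 + (m′ * 2 + k′ * 2))) (k′ * 2))) | severed 1 q k′
      m′ refl
  ...   | refl | pieces {V₁} {V₂} P Q covers = reroute
      (ring (double 1 (plainOdd 1 k′ (suc m′) q refl)) (inj₂ refl) β (double 0 P) (double 0 Q) covers′)
                                   cov refl (twos k′ m′) (fars k′ m′ q)
    where
    z = q * (3 + (m′ * 2 + k′ * 2))
    β : Apart 1 (1 + (z + (suc m′ * 2 + k′ * 2 + 1)) * 2) ((z + (2 + (m′ * 2 + k′ * 2) + 1)) * 2)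
    β = inj₂ refl
    V = _< 1 + (3 + (m′ * 2 + k′ * 2) + (z + (1 + k′ * 2)))
    U = _< 1 + (3 + (m′ * 2 + k′ * 2) + (z + k′ * 2))
    covers′ : ∀ {p} → Dbl 0 V p → (Dbl 0 V₁ ∪ Dbl 0 V₂) p
    covers′ (i , v , e) with covers v
    ... | inj₁ w = inj₁ (i , w , e)
    ... | inj₂ w = inj₂ (i , w , e)
    twos : ∀ k m → 1 + (k * 2 + suc m * 2) + (1 + k * 2 + (1 + m * 2)) ≡ suc ((2 + (m * 2 + k * 2)) * 2)
    twos = solve-∀
    fars : ∀ k m q → q * (3 + (m * 2 + k * 2)) + k * 2 + ((1 + k * 2) * suc q + (2 + m * 2) * q)
           ≡ suc ((q * (3 + (m * 2 + k * 2)) + k * 2) * 2)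
    fars = solve-∀
    size≡ : ∀ y z r → 3 + (suc ((2 + y) * 2) + suc ((z + r) * 2)) ≡ suc (suc (3 + y + (z + r)) + suc (3 + y + (z + r)))
    size≡ = solve-∀
    n≡ : ∀ y z r → suc (suc (3 + y + (z + r))) ≡ 1 + (3 + y + (z + suc r))
    n≡ = solve-∀
    cov : ∀ {p} → p < 3 + (suc ((2 + (m′ * 2 + k′ * 2)) * 2) + suc ((z + k′ * 2) * 2)) → (Dbl 1 U ∪ Dbl 0 V) p
    cov {p} p< = swap (subst (λ n → (Dbl 0 (_< n) ∪ Dbl 1 U) p) (n≡ (m′ * 2 + k′ * 2) z (k′ * 2))
                   (alternate⁺ {suc (3 + (m′ * 2 + k′ * 2) + (z + k′ * 2))} p
                       (≤-trans p< (≤-reflexive (size≡ (m′ * 2 + k′ * 2) z (k′ * 2))))))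

-- Only from here on: in scope of these constructors, solve cannot tell which kind of list its argument is.
open import Data.List.Relation.Unary.All using ([]; _∷_)
open import Data.List.Relation.Unary.AllPairs using ([]; _∷_)

-- From walks to realizations

private variable
  A : Set

cong-L : ∀ {x a a′ b b′ c c′} → a ≡ a′ → b ≡ b′ → c ≡ c′ → L12x x a b c ≡ L12x x a′ b′ c′
cong-L refl refl refl = refl

Unique-resp : ∀ {xs ys : List A} → xs ↭ ys → Unique xs → Unique ys
Unique-resp π = Unique-resp-↭ (setoid _) (↭⇒↭ₛ π)

unique-∉ : ∀ {z : A} {zs} → Unique (z ∷ zs) → z ∉ zs
unique-∉ (z∉ ∷ _) z∈ = All.lookup z∉ z∈ refl

extract : ∀ {z : A} {xs} → z ∈ xs → ∃[ ys ] xs ↭ z ∷ ys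
extract z∈ with ∈-∃++ z∈
... | as , bs , refl = as ++ bs , shift _ as bs

length-⊆ : ∀ {zs xs : List A} → Unique zs → (∀ {z} → z ∈ zs → z ∈ xs) → length zs ≤ length xs
length-⊆ {zs = []} _ _ = z≤n
length-⊆ {zs = z ∷ zs} {xs} uu@(_ ∷ u) f with extract (f (here refl))
... | ys , π = ≤-trans (s≤s (length-⊆ u g)) (≤-reflexive (sym (↭-length π)))
  where
  g : ∀ {w} → w ∈ zs → w ∈ ys
  g w∈ with ∈-resp-↭ π (f (there w∈))
  ... | here refl = ⊥-elim (unique-∉ uu w∈)
  ... | there w∈′ = w∈′

-- With a repetition, too few distinct entries would remain to cover `zs`. This supplies the
-- distinctness that `Path` does not record.
covering⇒unique : ∀ {zs xs : List A} → Unique zs → (∀ {z} → z ∈ zs → z ∈ xs) → length xs ≤ length zs → Unique xs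
covering⇒unique {zs = []} {[]} _ _ _ = []
covering⇒unique {zs = z ∷ zs} {xs} uu@(_ ∷ u) f l with extract (f (here refl))
... | ys , π = Unique-resp (↭-sym π) (All.¬Any⇒All¬ ys z∉ ∷ covering⇒unique u g l′)
  where
  l′ : length ys ≤ length zs
  l′ = s≤s⁻¹ (≤-trans (≤-reflexive (sym (↭-length π))) l)
  g : ∀ {w} → w ∈ zs → w ∈ ys
  g w∈ with ∈-resp-↭ π (f (there w∈))
  ... | here refl = ⊥-elim (unique-∉ uu w∈)
  ... | there w∈′ = w∈′
  z∉ : z ∉ ys
  z∉ z∈ = <⇒≱ (s≤s l′) (length-⊆ uu λ { (here refl) → z∈ ; (there w∈) → g w∈ })

-- Representatives need not be reduced: the doubled walk for a = 0 runs through the even numbers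
-- below 2v.
Near : (v : ℕ) .{{_ : NonZero v}} → ℕ → ℕ → ℕ → Set
Near v d p q = q % v ≡ (d + p) % v ⊎ p % v ≡ (d + q) % v

apart⇒near : ∀ {v} .{{_ : NonZero v}} {d p q} → Apart d p q → Near v d p q
apart⇒near (inj₁ refl) = inj₁ refl
apart⇒near (inj₂ refl) = inj₂ refl

len-comm : ∀ v p q → len v p q ≡ len v q p
len-comm v p q rewrite ∣-∣-comm p q = refl

len-+ : ∀ {v d} .{{_ : NonZero v}} p → d * 2 ≤ v → len v (p % v) ((d + p) % v) ≡ d
len-+ {v} {d} p 2d≤v = trans (cong (len v u) eq) (go (d + u <? v))
  where
  u = p % v
  eq : (d + p) % v ≡ (d + u) % v
  eq = trans (%-distribˡ-+ d p v) (trans (cong (λ w → (d % v + w) % v) (sym (m%n%n≡m%n p v))) (sym (%-distribˡ-+ d u v)))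
  d+d≤v : d + d ≤ v
  d+d≤v = ≤-trans (≤-reflexive (trans (cong (d +_) (sym (+-identityʳ d))) (*-comm 2 d))) 2d≤v
  go : Dec (d + u < v) → len v u ((d + u) % v) ≡ d
  go (yes lt) rewrite m<n⇒m%n≡m lt | +-comm d u | ∣m-m+n∣≡n u d = m≤n⇒m⊓n≡m (m+n≤o⇒m≤o∸n d d+d≤v)
  go (no ≮) = trans (cong (λ e → e ⊓ (v ∸ e)) dist) (trans (cong ((v ∸ d) ⊓_) (m∸[m∸n]≡n d≤v)) (m≥n⇒m⊓n≡n (m+n≤o⇒m≤o∸n d d+d≤v)))
    where
    v≤ = ≮⇒≥ ≮
    d≤v : d ≤ v
    d≤v = ≤-trans (m≤m+n d d) d+d≤v
    w = d + u ∸ v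
    w<v : w < v
    w<v = +-cancelʳ-< v w v (subst (_< v + v) (sym (m∸n+n≡m v≤)) (+-mono-≤-< d≤v (m%n<n p v)))
    r≡ : (d + u) % v ≡ w
    r≡ = trans (sym (m≤n⇒[n∸m]%m≡n%m v≤)) (m<n⇒m%n≡m w<v)
    -- After wrapping round, the residues differ by v - d, and the minimum is attained by the other
    -- term.
    u≡ : u ≡ w + (v ∸ d)
    u≡ = +-cancelˡ-≡ d u (w + (v ∸ d)) (begin
      d + u             ≡⟨ m∸n+n≡m v≤ ⟨
      w + v             ≡⟨ cong (w +_) (m+[n∸m]≡n d≤v) ⟨
      w + (d + (v ∸ d)) ≡⟨ +-assoc w d _ ⟨
      w + d + (v ∸ d)   ≡⟨ cong (_+ (v ∸ d)) (+-comm w d) ⟩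
      d + w + (v ∸ d)   ≡⟨ +-assoc d w _ ⟩
      d + (w + (v ∸ d)) ∎)
      where open ≡-Reasoning
    dist : ∣ u - (d + u) % v ∣ ≡ v ∸ d
    dist = trans (cong (λ t → ∣ u - t ∣) r≡) (trans (cong (λ t → ∣ t - w ∣) u≡)
        (trans (∣-∣-comm (w + (v ∸ d)) w) (∣m-m+n∣≡n w (v ∸ d))))

near⇒len : ∀ {v d} .{{_ : NonZero v}} p q → d * 2 ≤ v → Near v d p q → len v (p % v) (q % v) ≡ d
near⇒len {v} {d} p q b (inj₁ e) = trans (cong (len v (p % v)) e) (len-+ p b)
near⇒len {v} {d} p q b (inj₂ e) = trans (len-comm v (p % v) (q % v)) (trans (cong (len v (q % v)) e) (len-+ q b))

L-two : ∀ x a b c → 2 ∷ L12x x a b c ↭ L12x x a (suc b) c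
L-two x a b c = ↭-sym (shift 2 (replicate a 1) (replicate b 2 ++ replicate c x))

L-far : ∀ x a b c → x ∷ L12x x a b c ↭ L12x x a b (suc c)
L-far x a b c = ↭-sym (↭-trans (++⁺ˡ (replicate a 1) (shift x (replicate b 2) (replicate c x)))
                              (shift x (replicate a 1) (replicate b 2 ++ replicate c x)))

module _ {R : ℕ → ℕ → ℕ → Set} {x : ℕ} where

  spans : ∀ {s t} → Walk R x s t → List ℕ
  spans stop         = []
  spans (step k _ w) = span x k ∷ spans w

  spans-↭ : ∀ {s t} (w : Walk R x s t) → spans w ↭ L12x x (count one w) (count two w) (count far w)
  spans-↭ stop = ↭-refl
  spans-↭ (step one _ w) = prep 1 (spans-↭ w)
  spans-↭ (step two _ w) = ↭-trans (prep 2 (spans-↭ w)) (L-two x (count one w) (count two w) (count far w))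
  spans-↭ (step far _ w) = ↭-trans (prep x (spans-↭ w)) (L-far x (count one w) (count two w) (count far w))

  length-vertices : ∀ {s t} (w : Walk R x s t) → length (vertices w) ≡ suc (count one w + count two w + count far w)
  length-vertices stop = refl
  length-vertices (step one _ w) = cong suc (length-vertices w)
  length-vertices (step two _ w) = cong suc (trans (length-vertices w)
    (cong (_+ count far w) (sym (+-suc (count one w) (count two w)))))
  length-vertices (step far _ w) = cong suc (trans (length-vertices w) (sym (+-suc (count one w + count two w) _)))

module _ {x : ℕ} (v : ℕ) .{{_ : NonZero v}} where

  residue : ℕ → Fin v
  residue p = fromℕ< (m%n<n p v)

  edgeLengths-walk : ∀ {s t} (w : Walk (Near v) x s t) → (∀ k → 0 < count k w → span x k * 2 ≤ v) →
                     edgeLengths v (map residue (vertices w)) ≡ spans w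
  edgeLengths-walk stop short = refl
  edgeLengths-walk {s} (step {p = p} k r w) short = trans (edgeLengths-∷ w)
      (cong₂ _∷_ (near⇒len s p (short k (≤-trans (δ>0 k) (m≤m+n (δ k k) _))) r)
                 (edgeLengths-walk w (λ k′ h → short k′ (≤-trans h (m≤n+m _ (δ k′ k))))))
    where
    δ>0 : ∀ k → 0 < δ k k
    δ>0 one = s≤s z≤n
    δ>0 two = s≤s z≤n
    δ>0 far = s≤s z≤n
    edgeLengths-∷ : ∀ {t} (w : Walk (Near v) x p t) →
      edgeLengths v (residue s ∷ map residue (vertices w)) ≡ len v (s % v) (p % v) ∷ edgeLengths v (map residue (vertices w))
    edgeLengths-∷ stop = cong (_∷ []) (cong₂ (len v) (toℕ-fromℕ< (m%n<n s v)) (toℕ-fromℕ< (m%n<n p v)))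
    edgeLengths-∷ (step _ _ _) = cong (_∷ _) (cong₂ (len v) (toℕ-fromℕ< (m%n<n s v)) (toℕ-fromℕ< (m%n<n p v)))

  -- The length condition is asked only for the kinds that occur, since x may exceed v / 2 when c =
  -- 0.
  realize : ∀ {s t} (w : Walk (Near v) x s t) → v ≡ suc (count one w + count two w + count far w) →
            (∀ k → 0 < count k w → span x k * 2 ≤ v) →
            (∀ p → p < v → ∃[ q ] q ∈ vertices w × q % v ≡ p) →
            Realizable v (L12x x (count one w) (count two w) (count far w))
  realize w v≡ short cov = ps , (unique , len≡) , subst (_↭ L12x x (count one w) (count two w) (count far w))
      (sym (edgeLengths-walk w short)) (spans-↭ w)
    where
    ps = map residue (vertices w)
    len≡ : length ps ≡ v
    len≡ = trans (length-map residue (vertices w)) (trans (length-vertices w) (sym v≡))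
    unique : Unique ps
    unique = covering⇒unique (Unique.allFin⁺ v) (λ {i} _ → hit i) (≤-reflexive (trans len≡ (sym (length-tabulate {n = v} id))))
      where
      hit : ∀ i → i ∈ ps
      hit i with cov (toℕ i) (toℕ<n i)
      ... | q , q∈ , e = subst (_∈ ps) (toℕ-injective (trans (toℕ-fromℕ< (m%n<n q v)) e)) (∈-map⁺ residue q∈)

module _ {R S : ℕ → ℕ → ℕ → Set} {x x′ : ℕ} (f : ℕ → ℕ)
         (g : ∀ k {p q} → R (span x k) p q → S (span x′ k) (f p) (f q)) where

  mapʷ : ∀ {s t} → Walk R x s t → Walk S x′ (f s) (f t)
  mapʷ stop         = stop
  mapʷ (step k r w) = step k (g k r) (mapʷ w)

  count-map : ∀ {s t} k (w : Walk R x s t) → count k (mapʷ w) ≡ count k w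
  count-map k stop          = refl
  count-map k (step k′ _ w) = cong (δ k k′ +_) (count-map k w)

  vertices-map : ∀ {s t} (w : Walk R x s t) → vertices (mapʷ w) ≡ map f (vertices w)
  vertices-map stop             = refl
  vertices-map (step {s} _ _ w) = cong (f s ∷_) (vertices-map w)

realize-path : ∀ {x V s t a b c} → Path x V s t a b c →
               (0 < b → 4 ≤ suc (a + b + c)) → (0 < c → x * 2 ≤ suc (a + b + c)) →
               (∀ p → p < suc (a + b + c) → ∃[ q ] V q × q % suc (a + b + c) ≡ p) →
               Realizable (suc (a + b + c)) (L12x x a b c)
realize-path {x} {V} {a = a} {b} {c} (path w cov refl refl refl) b-short c-short f =
  subst (Realizable v) (cong-L (same one) (same two) (same far))
    (realize v w′ v≡ short hit)
  where
  v = suc (count one w + count two w + count far w)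
  id-near : ∀ k {p q} → Apart (span x k) p q → Near v (span x k) p q
  id-near k = apart⇒near
  w′ : Walk (Near v) x _ _
  w′ = mapʷ {Apart} {Near v} {x} {x} id id-near w
  same : ∀ k → count k w′ ≡ count k w
  same k = count-map {Apart} {Near v} {x} {x} id id-near k w
  v≡ : v ≡ suc (count one w′ + count two w′ + count far w′)
  v≡ = sym (cong suc (cong₂ _+_ (cong₂ _+_ (same one) (same two)) (same far)))
  short : ∀ k → 0 < count k w′ → span x k * 2 ≤ v
  short one h = s≤s (≤-trans (subst (0 <_) (same one) h) (≤-trans (m≤m+n _ (count two w)) (m≤m+n _ _)))
  short two h = b-short (subst (0 <_) (same two) h)
  short far h = c-short (subst (0 <_) (same far) h)
  hit : ∀ p → p < v → ∃[ q ] q ∈ vertices w′ × q % v ≡ p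
  hit p p<v with f p p<v
  ... | q , vq , e = q , subst (q ∈_) (sym (trans (vertices-map {Apart} {Near v} {x} {x} id id-near w) (map-id (vertices w))))
      (cov vq) , e

-- At least x - 1 short steps

module _ {P : ℕ → Set} (x a b c : ℕ) (all : All P (L12x x a b c)) where

  private
    first : ∀ {n z} → 0 < n → All P (replicate n z) → P z
    first {suc _} _ (pz ∷ _) = pz

    all₂ = proj₂ (All.++⁻ (replicate a 1) all)

  at-two : 0 < b → P 2
  at-two h = first h (proj₁ (All.++⁻ (replicate b 2) all₂))

  at-x : 0 < c → P x
  at-x h = first h (proj₂ (All.++⁻ (replicate b 2) all₂))

≤half⇒ : ∀ {d v} → d ≤ v / 2 → d * 2 ≤ v
≤half⇒ {d} {v} h = ≤-trans (*-monoˡ-≤ 2 h) (m/n*n≤m v 2)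

route⇒realizable : ∀ {x a b c V} → Admissible (suc (a + b + c)) (L12x x a b c) → Route x V a b c →
                   (∀ p → p < suc (a + b + c) → ∃[ q ] V q × q % suc (a + b + c) ≡ p) →
                   Realizable (suc (a + b + c)) (L12x x a b c)
route⇒realizable {x} {a} {b} {c} (_ , _ , short , _) (route P) =
  realize-path P (λ h → ≤half⇒ (at-two x a b c short h)) (λ h → ≤half⇒ (at-x x a b c short h))

all-even : ∀ y b c → All (2 ∣_) (L12x (y * 2) 0 b c)
all-even y b c = All.++⁺ (All.replicate⁺ b (n∣m*n 1)) (All.replicate⁺ c (n∣m*n y))

-- For even v all v - 1 entries would be multiples of the divisor 2, one more than admissibility
-- allows.
odd-order : ∀ y b c → 0 < b → Admissible (suc (b + c)) (L12x (y * 2) 0 b c) → ∃[ n ] suc (b + c) ≡ 1 + n * 2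
odd-order y b c 0<b (_ , _ , _ , few) with halve (suc (b + c))
... | n , inj₂ e = n , e
... | n , inj₁ e = ⊥-elim (<⇒≱ (∸-monoʳ-< {m = suc (b + c)} {n = 2} {o = 1} ≤-refl (s≤s (≤-trans 0<b (m≤m+n b c))))
    (subst (_≤ suc (b + c) ∸ 2) count≡ (few 2 (subst (2 ∣_) (sym e) (n∣m*n n)))))
  where
  count≡ : countMultiples 2 (L12x (y * 2) 0 b c) ≡ b + c
  count≡ = trans (cong length (filter-all (2 ∣?_) (all-even y b c)))
             (trans (length-++ (replicate b 2)) (cong₂ _+_ (length-replicate b) (length-replicate c)))

linear⇒realizable : ∀ {x a b c} → Admissible (suc (a + b + c)) (L12x x a b c) → Route x (_< suc (a + b + c)) a b c →
                    Realizable (suc (a + b + c)) (L12x x a b c)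
linear⇒realizable adm P = route⇒realizable adm P (λ p h → p , h , m<n⇒m%n≡m h)

-- The doubles of 0, …, v - 1 are all residues modulo the odd number v.
double-hits : ∀ {v n} .{{_ : NonZero v}} → v ≡ 1 + n * 2 → ∀ p → p < v → ∃[ q ] Dbl 0 (_< v) q × q % v ≡ p
double-hits {v} {n} e p p< with halve p
... | k , inj₁ p≡ = p , (k , ≤-<-trans (m≤m*n k 2) (subst (_< v) p≡ p<) , p≡) , m<n⇒m%n≡m p<
... | k , inj₂ p≡ = p + v , (suc (k + n) , bound , p+v≡) , trans ([m+n]%n≡m%n p v) (m<n⇒m%n≡m p<)
  where
  k<n : k < n
  k<n = *-cancelʳ-< 2 k n (s≤s⁻¹ (subst₂ _<_ p≡ e p<))
  n+n≡ : n + n ≡ n * 2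
  n+n≡ = trans (cong (n +_) (sym (+-identityʳ n))) (*-comm 2 n)
  bound : suc (k + n) < v
  bound = subst (suc (k + n) <_) (sym e) (s≤s (≤-trans (+-monoˡ-≤ n k<n) (≤-reflexive n+n≡)))
  p+v≡ : p + v ≡ suc (k + n) * 2
  p+v≡ = trans (cong₂ _+_ p≡ e) (sum k n)
    where
    sum : ∀ k n → suc (k * 2) + (1 + n * 2) ≡ suc (k + n) * 2
    sum = solve-∀

-- All steps are even, so a half-path on 0, ..., v - 1 is doubled; modulo the odd v it meets every
-- residue. As 2y - 1 ≥ y, the shape `long` is available.
no-ones : ∀ y b c → 2 ≤ y → y * 2 ≤ suc b → Admissible (suc (b + c)) (L12x (y * 2) 0 b c) →
          Realizable (suc (b + c)) (L12x (y * 2) 0 b c)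
no-ones y@(suc y′) b c 2≤y y≤ adm =
  route⇒realizable adm (route (double 0 (HalfPath.along (half-path c 2≤y (≤-trans y≤b (n≤1+n b)) (long y≤b)))))
    (double-hits {n = proj₁ odd} (proj₂ odd))
  where
  odd : ∃[ n ] suc (b + c) ≡ 1 + n * 2
  odd = odd-order y b c (≤-trans (s≤s z≤n) (s≤s⁻¹ y≤)) adm
  y≤b : y ≤ b
  y≤b = ≤-trans (s≤s (m≤m*n y′ 2)) (s≤s⁻¹ y≤)

one-one : ∀ y b c → 2 ≤ y → y * 2 ≤ 2 + b → Admissible (suc (1 + b + c)) (L12x (y * 2) 1 b c) →
          Realizable (suc (1 + b + c)) (L12x (y * 2) 1 b c)
one-one y b c 2≤y y≤ adm = linear⇒realizable adm (single b c 2≤y y≤)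

two-ones : ∀ y .{{_ : NonZero y}} b c → 2 ≤ y → y * 2 ≤ 3 + b → Admissible (suc (2 + b + c)) (L12x (y * 2) 2 b c) →
           Realizable (suc (2 + b + c)) (L12x (y * 2) 2 b c)
two-ones y b c 2≤y y≤ adm = linear⇒realizable adm (path-of (y * 2 ≟ 3 + b))
  where
  path-of : Dec (y * 2 ≡ 3 + b) → Route (y * 2) (_< suc (2 + b + c)) 2 b c
  path-of (yes e) = wide y c 2≤y ≤-refl y≤ (inj₂ (sym e))
  path-of (no ne) = twin b c 2≤y (s≤s⁻¹ (≤∧≢⇒< y≤ ne))

more-ones : ∀ y .{{_ : NonZero y}} a b c → 2 ≤ y → 3 ≤ a → y * 2 ≤ suc (a + b) →
    Admissible (suc (a + b + c)) (L12x (y * 2) a b c) →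
            Realizable (suc (a + b + c)) (L12x (y * 2) a b c)
more-ones y a b c 2≤y 3≤a y≤ adm = linear⇒realizable adm (wide y c 2≤y (≤-trans (s≤s (s≤s z≤n)) 3≤a) y≤ (inj₁ 3≤a))

many-short : ∀ y .{{_ : NonZero y}} a b c → 2 ≤ y → y * 2 ≤ suc (a + b) → Admissible (suc (a + b + c)) (L12x (y * 2) a b c) →
             Realizable (suc (a + b + c)) (L12x (y * 2) a b c)
many-short y 0 b c 2≤y y≤ adm = no-ones y b c 2≤y y≤ adm
many-short y 1 b c 2≤y y≤ adm = one-one y b c 2≤y y≤ adm
many-short y 2 b c 2≤y y≤ adm = two-ones y b c 2≤y y≤ adm
many-short y a@(suc (suc (suc _))) b c 2≤y y≤ adm = more-ones y a b c 2≤y (s≤s (s≤s (s≤s z≤n))) y≤ adm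

-- Arcs of a Hamiltonian path

Arc : Set
Arc = Kind × ℕ

module _ (n : ℕ) .{{_ : NonZero n}} where

  -- Both ends are reduced modulo n; the end from which the other one is reached upwards is the low end.
  Link : ℕ → ℕ → ℕ → Set
  Link d p q = (p < n × q ≡ (d + p) % n) ⊎ (q < n × p ≡ (d + q) % n)

low : ∀ {n d p q} .{{_ : NonZero n}} → Link n d p q → ℕ
low {p = p} (inj₁ _) = p
low {q = q} (inj₂ _) = q

module _ {n x : ℕ} .{{_ : NonZero n}} where

  Incident : Arc → ℕ → Set
  Incident (k , l) p = p ≡ l ⊎ p ≡ (span x k + l) % n

  arcs : ∀ {s t} → Walk (Link n) x s t → List Arc
  arcs stop         = []
  arcs (step k r w) = (k , low r) ∷ arcs w

  incident-start : ∀ {k p q} (r : Link n (span x k) p q) → Incident (k , low r) p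
  incident-start (inj₁ _)       = inj₁ refl
  incident-start (inj₂ (_ , e)) = inj₂ e

  incident-ends : ∀ {k p q v} (r : Link n (span x k) p q) → Incident (k , low r) v → v ≡ p ⊎ v ≡ q
  incident-ends (inj₁ (_ , e)) (inj₁ refl) = inj₁ refl
  incident-ends (inj₁ (_ , e)) (inj₂ refl) = inj₂ (sym e)
  incident-ends (inj₂ (_ , e)) (inj₁ refl) = inj₂ refl
  incident-ends (inj₂ (_ , e)) (inj₂ refl) = inj₁ (sym e)

  incident∈ : ∀ {s t e v} (w : Walk (Link n) x s t) → e ∈ arcs w → Incident e v → v ∈ vertices w
  incident∈ (step k r w) (here refl) i with incident-ends {k} r i
  ... | inj₁ refl = here refl
  ... | inj₂ refl = there (start∈ w)
  incident∈ (step k r w) (there e∈) i = there (incident∈ w e∈ i)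

  -- An arc through s after the first step would bring s back into the rest of the walk.
  end-arc : ∀ {s t e e′} (w : Walk (Link n) x s t) → Unique (vertices w) →
            e ∈ arcs w → Incident e s → e′ ∈ arcs w → Incident e′ s → e ≡ e′
  end-arc (step k r w) u (here refl) i (here refl) i′ = refl
  end-arc (step k r w) u (there e∈) i _ _ = ⊥-elim (unique-∉ u (incident∈ w e∈ i))
  end-arc (step k r w) u _ _ (there e∈) i = ⊥-elim (unique-∉ u (incident∈ w e∈ i))

  arcs-unique : ∀ {s t} (w : Walk (Link n) x s t) → Unique (vertices w) → Unique (arcs w)
  arcs-unique stop _ = []
  arcs-unique (step k r w) uu@(_ ∷ u) =
    All.¬Any⇒All¬ _ (λ e∈ → unique-∉ uu (incident∈ w e∈ (incident-start {k} r))) ∷ arcs-unique w u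

  vertices-edge : ∀ {s p q t} k (r : Link n (span x k) p q) (w : Walk (Link n) x s p) (w′ : Walk (Link n) x q t) →
                  vertices (w ⋆ʷ step k r w′) ≡ vertices w ++ vertices w′
  vertices-edge k r stop w′ = refl
  vertices-edge k r (step {s} _ _ w) w′ = cong (s ∷_) (vertices-edge k r w w′)

  arcs-⋆ : ∀ {s t u} (w : Walk (Link n) x s t) (w′ : Walk (Link n) x t u) → arcs (w ⋆ʷ w′) ≡ arcs w ++ arcs w′
  arcs-⋆ stop w′ = refl
  arcs-⋆ (step k r w) w′ = cong ((k , low r) ∷_) (arcs-⋆ w w′)

  record Splitting {s t} (e : Arc) (w : Walk (Link n) x s t) : Set where
    constructor splitting
    field
      {p q}    : ℕ
      edge     : Link n (span x (proj₁ e)) p q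
      low≡     : low edge ≡ proj₂ e
      left     : Walk (Link n) x s p
      right    : Walk (Link n) x q t
      rebuild  : w ≡ left ⋆ʷ step (proj₁ e) edge right

  splitAt : ∀ {s t e} (w : Walk (Link n) x s t) → e ∈ arcs w → Splitting e w
  splitAt (step k r w) (here refl) = splitting r refl stop w refl
  splitAt (step k r w) (there e∈) with splitAt w e∈
  ... | splitting r′ eq l m reb = splitting r′ eq (step k r l) m (cong (step k r) reb)

  open Reverse {Link n} {x} swap public

  low-swap : ∀ {d p q} (r : Link n d p q) → low (swap r) ≡ low r
  low-swap (inj₁ _) = refl
  low-swap (inj₂ _) = refl

  arcs-revOntoʳ : ∀ {s t u e} (w : Walk (Link n) x s t) (w₀ : Walk (Link n) x s u) → e ∈ arcs w₀ → e ∈ arcs (revOnto w w₀)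
  arcs-revOntoʳ stop w₀ e∈ = e∈
  arcs-revOntoʳ (step k r w) w₀ e∈ = arcs-revOntoʳ w _ (there e∈)

  arcs-revOntoˡ : ∀ {s t u e} (w : Walk (Link n) x s t) (w₀ : Walk (Link n) x s u) → e ∈ arcs w → e ∈ arcs (revOnto w w₀)
  arcs-revOntoˡ (step k r w) w₀ (here refl) = arcs-revOntoʳ w _ (here (cong (k ,_) (sym (low-swap r))))
  arcs-revOntoˡ (step k r w) w₀ (there e∈) = arcs-revOntoˡ w _ e∈

  flip : ∀ {s t} → Walk (Link n) x s t → Walk (Link n) x t s
  flip w = revOnto w stop

  count-flip : ∀ {s t} k (w : Walk (Link n) x s t) → count k (flip w) ≡ count k w
  count-flip k w = trans (count-revOnto k w stop) (+-identityʳ _)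

  arcs-flip : ∀ {s t e} (w : Walk (Link n) x s t) → e ∈ arcs w → e ∈ arcs (flip w)
  arcs-flip w = arcs-revOntoˡ w stop

  vertices-flip : ∀ {s t} (w : Walk (Link n) x s t) → Unique (vertices w) → Unique (vertices (flip w))
  vertices-flip w u = covering⇒unique u (∈-revOntoˡ w stop)
      (≤-reflexive (trans (length-vertices (flip w))
          (trans (cong suc (cong₂ _+_ (cong₂ _+_ (count-flip one w) (count-flip two w)) (count-flip far w)))
                                                          (sym (length-vertices w)))))

len⇒link : ∀ {n d} .{{_ : NonZero n}} p q → p < n → q < n → len n p q ≡ d → Link n d p q
len⇒link {n} {d} p q p<n q<n e = case (≤-total p q)
  where
  ordered : ∀ {p q} → p ≤ q → q < n → len n p q ≡ d → Link n d p q
  ordered {p} p≤q q<n e with m≤n⇒∃[o]m+o≡n p≤q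
  ... | o , refl with trans (cong (λ z → z ⊓ (n ∸ z)) (sym (∣m-m+n∣≡n p o))) e | ⊓-sel o (n ∸ o)
  ...   | e′ | inj₁ s with trans (sym s) e′
  ...     | refl = inj₁ (≤-<-trans (m≤m+n p o) q<n , trans (+-comm p o) (sym (m<n⇒m%n≡m (subst (_< n) (+-comm p o) q<n))))
  ordered {p} p≤q q<n e | o , refl | e′ | inj₂ s with trans (sym s) e′
  ...     | refl = inj₂ (q<n , sym (trans (cong (_% n) eq) (trans ([m+n]%n≡m%n p n) (m<n⇒m%n≡m (≤-<-trans (m≤m+n p o) q<n)))))
    where
    eq : n ∸ o + (p + o) ≡ p + n
    eq = trans (cong (n ∸ o +_) (+-comm p o)) (trans (sym (+-assoc (n ∸ o) o p))
           (trans (cong (_+ p) (m∸n+n≡m (≤-trans (m≤n+m o p) (<⇒≤ q<n)))) (+-comm n p)))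
  case : p ≤ q ⊎ q ≤ p → Link n d p q
  case (inj₁ p≤q) = ordered p≤q q<n e
  case (inj₂ q≤p) = swap (ordered q≤p p<n (trans (len-comm n q p) e))

occurrences : ℕ → List ℕ → ℕ
occurrences d L = length (filter (d ≟_) L)

occurrences-++ : ∀ d L M → occurrences d (L ++ M) ≡ occurrences d L + occurrences d M
occurrences-++ d L M = trans (cong length (filter-++ (d ≟_) L M)) (length-++ (filter (d ≟_) L))

occurrences-same : ∀ d n → occurrences d (replicate n d) ≡ n
occurrences-same d n = trans (cong length (filter-all (d ≟_) (All.replicate⁺ n refl))) (length-replicate n)

occurrences-other : ∀ {d e} n → d ≢ e → occurrences d (replicate n e) ≡ 0
occurrences-other {d} n d≢e = cong length (filter-none (d ≟_) (All.replicate⁺ n d≢e))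

occurrences-L : ∀ d x a b c → occurrences d (L12x x a b c) ≡
                occurrences d (replicate a 1) + (occurrences d (replicate b 2) + occurrences d (replicate c x))
occurrences-L d x a b c = trans (occurrences-++ d (replicate a 1) _)
    (cong (occurrences d (replicate a 1) +_) (occurrences-++ d (replicate b 2) _))

-- A realization fixes only the multiset of lengths. As 1, 2 and x differ, the numbers of steps of
-- each kind can be read off.
L-injective : ∀ {x a b c a′ b′ c′} → 3 ≤ x → L12x x a b c ↭ L12x x a′ b′ c′ → a ≡ a′ × b ≡ b′ × c ≡ c′
L-injective {x} {a} {b} {c} {a′} {b′} {c′} 3≤x π =
    trans (sym (ones a b c)) (trans (same 1) (ones a′ b′ c′))
  , trans (sym (twos a b c)) (trans (same 2) (twos a′ b′ c′))
  , trans (sym (fars a b c)) (trans (same x) (fars a′ b′ c′))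
  where
  same : ∀ d → occurrences d (L12x x a b c) ≡ occurrences d (L12x x a′ b′ c′)
  same d = ↭-length (filter-↭ (d ≟_) π)
  1≢x : 1 ≢ x
  1≢x = <⇒≢ (<-≤-trans (s≤s (s≤s z≤n)) 3≤x)
  2≢x : 2 ≢ x
  2≢x = <⇒≢ 3≤x
  ones : ∀ a b c → occurrences 1 (L12x x a b c) ≡ a
  ones a b c = trans (occurrences-L 1 x a b c) (trans
      (cong₂ _+_ (occurrences-same 1 a) (cong₂ _+_ (occurrences-other b (λ ())) (occurrences-other c 1≢x))) (+-identityʳ a))
  twos : ∀ a b c → occurrences 2 (L12x x a b c) ≡ b
  twos a b c = trans (occurrences-L 2 x a b c) (trans
      (cong₂ _+_ (occurrences-other a (λ ())) (cong₂ _+_ (occurrences-same 2 b) (occurrences-other c 2≢x))) (+-identityʳ b))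
  fars : ∀ a b c → occurrences x (L12x x a b c) ≡ c
  fars a b c = trans (occurrences-L x x a b c) (cong₂ _+_ (occurrences-other a (λ e → 1≢x (sym e)))
      (cong₂ _+_ (occurrences-other b (λ e → 2≢x (sym e))) (occurrences-same x c)))

unique-full : ∀ {xs n} → Unique xs → (∀ {p} → p ∈ xs → p < n) → n ≤ length xs → ∀ {p} → p < n → p ∈ xs
unique-full {xs} {n} u bound n≤ {p} p<n with p ∈? xs
... | yes p∈ = p∈
... | no  p∉ = ⊥-elim (<⇒≱ (s≤s n≤) (subst (suc (length xs) ≤_) (length-upTo n)
    (length-⊆ (All.¬Any⇒All¬ xs p∉ ∷ u) λ { (here refl) → ∈-upTo⁺ p<n ; (there q∈) → ∈-upTo⁺ (bound q∈) })))

record Ham (n x a b c : ℕ) .{{_ : NonZero n}} : Set where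
  field
    {s t}  : ℕ
    walk   : Walk (Link n) x s t
    simple : Unique (vertices walk)
    all    : ∀ {p} → p < n → p ∈ vertices walk
    bound  : ∀ {p} → p ∈ vertices walk → p < n
    ones   : count one walk ≡ a
    twos   : count two walk ≡ b
    fars   : count far walk ≡ c

module _ {n x : ℕ} .{{_ : NonZero n}} where

  trace : (i : Fin n) (ps : List (Fin n)) → All (λ ℓ → ∃[ k ] ℓ ≡ span x k) (edgeLengths n (i ∷ ps)) →
          ∃[ t ] Σ (Walk (Link n) x (toℕ i) t) λ w → vertices w ≡ map toℕ (i ∷ ps) × spans w ≡ edgeLengths n (i ∷ ps)
  trace i [] _ = _ , stop , refl , refl
  trace i (j ∷ ps) ((k , e) ∷ all) with trace j ps all
  ... | t , w , v≡ , s≡ = t , step k (len⇒link (toℕ i) (toℕ j) (toℕ<n i) (toℕ<n j) e) w , cong (toℕ i ∷_) v≡ ,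
      cong₂ _∷_ (sym e) s≡

  kinds : ∀ a b c → All (λ ℓ → ∃[ k ] ℓ ≡ span x k) (L12x x a b c)
  kinds a b c = All.++⁺ (All.replicate⁺ a (one , refl)) (All.++⁺ (All.replicate⁺ b (two , refl)) (All.replicate⁺ c (far , refl)))

  realizable⇒ham : ∀ {a b c} → 3 ≤ x → Realizable n (L12x x a b c) → Ham n x a b c
  realizable⇒ham 3≤x ([] , (_ , l) , _) = ⊥-elim (≢-nonZero⁻¹ n (sym l))
  realizable⇒ham {a} {b} {c} 3≤x (i ∷ ps , (u , l) , π) with trace i ps (All-resp-↭ (↭-sym π) (kinds a b c))
  ... | t , w , v≡ , s≡ = record
    { walk   = w
    ; simple = simple
    ; all    = unique-full simple bound (≤-reflexive (sym (trans (cong length v≡) (trans (length-map toℕ (i ∷ ps)) l))))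
    ; bound  = bound
    ; ones   = proj₁ counts
    ; twos   = proj₁ (proj₂ counts)
    ; fars   = proj₂ (proj₂ counts) }
    where
    counts = L-injective 3≤x (↭-trans (↭-sym (spans-↭ w)) (subst (_↭ L12x x a b c) (sym s≡) π))
    simple = subst Unique (sym v≡) (Unique.map⁺ toℕ-injective u)
    bound : ∀ {p} → p ∈ vertices w → p < n
    bound p∈ with ∈-map⁻ toℕ (subst (_ ∈_) v≡ p∈)
    ... | j , _ , refl = toℕ<n j

-- Insertion of x vertices

module _ (n : ℕ) .{{_ : NonZero n}} where

  %-absorbˡ : ∀ a b → (a % n + b) % n ≡ (a + b) % n
  %-absorbˡ a b = trans (%-distribˡ-+ (a % n) b n)
      (trans (cong (λ z → (z + b % n) % n) (m%n%n≡m%n a n)) (sym (%-distribˡ-+ a b n)))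

  %-absorbʳ : ∀ a b → (a + b % n) % n ≡ (a + b) % n
  %-absorbʳ a b = trans (cong (_% n) (+-comm a (b % n))) (trans (%-absorbˡ b a) (cong (_% n) (+-comm b a)))

-- Subtraction of o modulo n: the window of x vertices from o on becomes 0, ..., x - 1, the only one
-- behind which vertices are inserted.
module Rotation (n x : ℕ) .{{_ : NonZero n}} (o : ℕ) (o≤n : o ≤ n) where

  rot : ℕ → ℕ
  rot p = (p + (n ∸ o)) % n

  rot-link : ∀ {d p q} → Link n d p q → Link n d (rot p) (rot q)
  rot-link {d} {p} (inj₁ (p<n , e)) = inj₁ (m%n<n _ n ,
    trans (cong rot e) (trans (%-absorbˡ n (d + p) (n ∸ o))
        (trans (cong (_% n) (+-assoc d p (n ∸ o))) (sym (%-absorbʳ n d (p + (n ∸ o)))))))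
  rot-link {d} {q = q} (inj₂ (q<n , e)) = inj₂ (m%n<n _ n ,
    trans (cong rot e) (trans (%-absorbˡ n (d + q) (n ∸ o))
        (trans (cong (_% n) (+-assoc d q (n ∸ o))) (sym (%-absorbʳ n d (q + (n ∸ o)))))))

  rot-low : ∀ {d p q} (r : Link n d p q) → low (rot-link r) ≡ rot (low r)
  rot-low (inj₁ _) = refl
  rot-low (inj₂ _) = refl

  unrot : ∀ {l} → l < n → (o + rot l) % n ≡ l
  unrot {l} l<n = trans (%-absorbʳ n o (l + (n ∸ o))) (trans (cong (_% n) eq) (trans ([m+n]%n≡m%n l n) (m<n⇒m%n≡m l<n)))
    where
    eq : o + (l + (n ∸ o)) ≡ l + n
    eq = trans (+-comm o _) (trans (+-assoc l (n ∸ o) o) (cong (l +_) (m∸n+n≡m o≤n)))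

  rot-unrot : ∀ {j} → j < n → rot ((o + j) % n) ≡ j
  rot-unrot {j} j<n = trans (%-absorbˡ n (o + j) (n ∸ o)) (trans (cong (_% n) eq) (trans ([m+n]%n≡m%n j n) (m<n⇒m%n≡m j<n)))
    where
    eq : o + j + (n ∸ o) ≡ j + n
    eq = trans (cong (_+ (n ∸ o)) (+-comm o j)) (trans (+-assoc j o (n ∸ o)) (cong (j +_) (m+[n∸m]≡n o≤n)))

  rotʷ : ∀ {s t} → Walk (Link n) x s t → Walk (Link n) x (rot s) (rot t)
  rotʷ = mapʷ {Link n} {Link n} {x} {x} rot (λ k → rot-link)

  count-rot : ∀ {s t} k (w : Walk (Link n) x s t) → count k (rotʷ w) ≡ count k w
  count-rot = count-map {Link n} {Link n} {x} {x} rot (λ k → rot-link)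

  vertices-rot : ∀ {s t} (w : Walk (Link n) x s t) → vertices (rotʷ w) ≡ map rot (vertices w)
  vertices-rot = vertices-map {Link n} {Link n} {x} {x} rot (λ k → rot-link)

  arcs-rot : ∀ {s t} (w : Walk (Link n) x s t) → arcs (rotʷ w) ≡ map (map₂ rot) (arcs w)
  arcs-rot stop = refl
  arcs-rot (step k r w) = cong₂ _∷_ (cong (k ,_) (rot-low r)) (arcs-rot w)

  rotate : ∀ {a b c} → Ham n x a b c → Ham n x a b c
  rotate H = record
    { walk   = rotʷ walk
    ; simple = covering⇒unique (Unique.upTo⁺ n) (λ p∈ → full (∈-upTo⁻ p∈))
        (≤-trans (≤-reflexive (trans (cong length (vertices-rot walk)) (length-map rot (vertices walk))))
          (length-⊆ simple (λ p∈ → ∈-upTo⁺ (bound p∈))))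
    ; all    = full
    ; bound  = bound′
    ; ones   = trans (count-rot one walk) ones
    ; twos   = trans (count-rot two walk) twos
    ; fars   = trans (count-rot far walk) fars }
    where
    open Ham H
    full : ∀ {p} → p < n → p ∈ vertices (rotʷ walk)
    full {p} p<n = subst₂ _∈_ (rot-unrot p<n) (sym (vertices-rot walk)) (∈-map⁺ rot (all (m%n<n (o + p) n)))
    bound′ : ∀ {p} → p ∈ vertices (rotʷ walk) → p < n
    bound′ p∈ with ∈-map⁻ rot (subst (_ ∈_) (vertices-rot walk) p∈)
    ... | q , _ , refl = m%n<n _ n

unique-map : ∀ {A B : Set} (f : A → B) {xs} → Unique xs → (∀ {a b} → a ∈ xs → b ∈ xs → f a ≡ f b → a ≡ b) → Unique (map f xs)
unique-map f [] inj = []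
unique-map f (x∉ ∷ u) inj = All.map⁺ (All.tabulate (λ b∈ e → All.lookup x∉ b∈ (inj (here refl) (there b∈) e)))
  ∷ unique-map f u (λ a∈ b∈ → inj (there a∈) (there b∈))

-- Insertion of the x new vertices x, …, 2x-1 between x-1 and x: an arc across the gap is led through the new vertex above its low end.
module Growth (n x : ℕ) .{{_ : NonZero n}} .{{_ : NonZero (n + x)}} (2≤x : 2 ≤ x) (2x≤n : x + x ≤ n) where

  φ : ℕ → ℕ
  φ p with p <? x
  ... | yes _ = p
  ... | no  _ = p + x

  φ-low : ∀ {p} → p < x → φ p ≡ p
  φ-low {p} h with p <? x
  ... | yes _ = refl
  ... | no ¬h = ⊥-elim (¬h h)

  φ-high : ∀ {p} → x ≤ p → φ p ≡ p + x
  φ-high {p} h with p <? x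
  ... | yes h′ = ⊥-elim (<⇒≱ h′ h)
  ... | no  _  = refl

  -- The circle is opened only behind the window, so arcs that enter the window past 0 are not
  -- affected.
  Crossing : Arc → Set
  Crossing (k , l) = l < x × x ≤ span x k + l

  crossing? : ∀ e → Dec (Crossing e)
  crossing? (k , l) = (l <? x) ×-dec (x ≤? span x k + l)

  span≤x : ∀ k → span x k ≤ x
  span≤x one = <⇒≤ 2≤x
  span≤x two = 2≤x
  span≤x far = ≤-refl

  private
    Near′ = Near (n + x)

    near-refl : ∀ {d p q} → q ≡ d + p → Near′ d p q
    near-refl e = inj₁ (cong (_% (n + x)) e)

    level : ∀ k l → l < n → ¬ Crossing (k , l) → Near′ (span x k) (φ l) (φ ((span x k + l) % n))
    level k l l<n ¬c with l <? x
    ... | yes l<x = near-refl (trans (cong φ (m<n⇒m%n≡m (<-≤-trans h< (≤-trans (m≤m+n x x) 2x≤n)))) (φ-low h<))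
      where
      h< : span x k + l < x
      h< = ≰⇒> (λ x≤ → ¬c (l<x , x≤))
    ... | no l≮x with span x k + l <? n
    ...   | yes h<n = near-refl (trans (cong φ (m<n⇒m%n≡m h<n))
        (trans (φ-high (≤-trans (≮⇒≥ l≮x) (m≤n+m l _))) (+-assoc (span x k) l x)))
    -- An arc wrapping past n into the window: its upper end stays, its low end moves up by x, and
    -- the larger modulus makes up for this.
    ...   | no  h≮n = inj₁ (trans (cong (_% (n + x)) (trans (cong φ h≡) (φ-low h<x)))
                        (trans (sym ([m+n]%n≡m%n h (n + x))) (cong (_% (n + x)) eq)))
      where
      h = span x k + l ∸ n
      n≤ = ≮⇒≥ h≮n
      h<x : h < x
      h<x = +-cancelʳ-< n h x (subst (_< x + n) (sym (m∸n+n≡m n≤)) (+-mono-≤-< (span≤x k) l<n))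
      h≡ : (span x k + l) % n ≡ h
      h≡ = trans (sym (m≤n⇒[n∸m]%m≡n%m n≤)) (m<n⇒m%n≡m (<-≤-trans h<x (≤-trans (m≤m+n x x) 2x≤n)))
      eq : h + (n + x) ≡ span x k + (l + x)
      eq = trans (sym (+-assoc h n x)) (trans (cong (_+ x) (m∸n+n≡m n≤)) (+-assoc (span x k) l x))

    climb₁ : ∀ l → l < x → Near′ x (φ l) (x + l)
    climb₁ l l<x = near-refl (cong (x +_) (sym (φ-low l<x)))

    climb₂ : ∀ k l → l < x → x ≤ span x k + l → Near′ (span x k) (x + l) (φ ((span x k + l) % n))
    climb₂ k l l<x x≤ = near-refl (trans (cong φ (m<n⇒m%n≡m (<-≤-trans (+-mono-≤-< (span≤x k) l<x) 2x≤n)))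
                           (trans (φ-high x≤) (trans (+-assoc (span x k) l x) (cong (span x k +_) (+-comm l x)))))

  growArc : ∀ k l → l < n → Walk Near′ x (φ l) (φ ((span x k + l) % n))
  growArc k l l<n with crossing? (k , l)
  ... | yes (l<x , x≤) = step far (climb₁ l l<x) (step k (climb₂ k l l<x x≤) stop)
  ... | no  ¬c         = step k (level k l l<n ¬c) stop

  extra : Arc → List Arc
  extra e with crossing? e
  ... | yes _ = e ∷ []
  ... | no  _ = []

  count-growArc : ∀ j k l (l<n : l < n) → count j (growArc k l l<n) ≡ δ j k + δ j far * length (extra (k , l))
  count-growArc j k l l<n with crossing? (k , l)
  ... | yes _ = trans (cong (δ j far +_) (+-identityʳ _))
      (trans (+-comm (δ j far) (δ j k)) (cong (δ j k +_) (sym (*-identityʳ (δ j far)))))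
  ... | no  _ = cong (δ j k +_) (sym (*-zeroʳ (δ j far)))

  grown∈ : ∀ k l (l<n : l < n) → Crossing (k , l) → x + l ∈ vertices (growArc k l l<n)
  grown∈ k l l<n c with crossing? (k , l)
  ... | yes _ = there (here refl)
  ... | no ¬c = ⊥-elim (¬c c)

  private
    module Rev = Reverse {Near′} {x} swap

  crossings : List Arc → List Arc
  crossings []       = []
  crossings (e ∷ es) = extra e ++ crossings es

  ∈-crossings⁺ : ∀ {e es} → e ∈ es → Crossing e → e ∈ crossings es
  ∈-crossings⁺ {e} (here refl) c with crossing? e
  ... | yes _ = here refl
  ... | no ¬c = ⊥-elim (¬c c)
  ∈-crossings⁺ (there e∈) c = ∈-++⁺ʳ _ (∈-crossings⁺ e∈ c)

  ∈-crossings⁻ : ∀ {e es} → e ∈ crossings es → e ∈ es × Crossing e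
  ∈-crossings⁻ {e} {f ∷ es} e∈ with crossing? f
  ∈-crossings⁻ {e} {f ∷ es} (here refl) | yes c = here refl , c
  ∈-crossings⁻ {e} {f ∷ es} (there e∈) | yes c with ∈-crossings⁻ {es = es} e∈
  ... | e∈′ , c′ = there e∈′ , c′
  ∈-crossings⁻ {e} {f ∷ es} e∈ | no _ with ∈-crossings⁻ {es = es} e∈
  ... | e∈′ , c′ = there e∈′ , c′

  crossings-unique : ∀ {es} → Unique es → Unique (crossings es)
  crossings-unique [] = []
  crossings-unique {e ∷ es} (e∉ ∷ u) with crossing? e
  ... | yes _ = All.tabulate (λ f∈ → All.lookup e∉ (proj₁ (∈-crossings⁻ {es = es} f∈))) ∷ crossings-unique u
  ... | no  _ = crossings-unique u

  grow : ∀ {s t} → Walk (Link n) x s t → Walk Near′ x (φ s) (φ t)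
  grow stop = stop
  grow (step {s} k (inj₁ (s<n , refl)) w) = growArc k s s<n ⋆ʷ grow w
  grow (step k (inj₂ (p<n , refl)) w) = Rev.revOnto (growArc k _ p<n) (grow w)

  count-grow : ∀ {s t} j (w : Walk (Link n) x s t) → count j (grow w) ≡ count j w + δ j far * length (crossings (arcs w))
  count-grow j stop = sym (*-zeroʳ (δ j far))
  count-grow j (step k r w) = trans (split r) (trans (cong₂ _+_ (count-growArc j k _ (low<n r)) (count-grow j w)) rearrange)
    where
    low<n : ∀ {p q} (r : Link n (span x k) p q) → low r < n
    low<n (inj₁ (h , _)) = h
    low<n (inj₂ (h , _)) = h
    split : ∀ {p} (r : Link n (span x k) p _) → count j (grow (step k r w)) ≡ count j (growArc k (low r) (low<n r)) + count j
        (grow w)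
    split (inj₁ (h , refl)) = count-⋆ j (growArc k _ h) (grow w)
    split (inj₂ (h , refl)) = Rev.count-revOnto j (growArc k _ h) (grow w)
    e = (k , low r)
    rearrange : δ j k + δ j far * length (extra e) + (count j w + δ j far * length (crossings (arcs w))) ≡
                δ j k + count j w + δ j far * length (extra e ++ crossings (arcs w))
    rearrange rewrite length-++ (extra e) {crossings (arcs w)} | *-distribˡ-+ (δ j far) (length (extra e))
        (length (crossings (arcs w))) =
      interchange (δ j k) (δ j far * length (extra e)) (count j w) _
      where
      interchange : ∀ a b c d → a + b + (c + d) ≡ a + c + (b + d)
      interchange a b c d = trans (+-assoc a b _) (trans
          (cong (a +_) (trans (sym (+-assoc b c d)) (trans (cong (_+ d) (+-comm b c)) (+-assoc c b d)))) (sym (+-assoc a c _)))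

  φ∈-grow : ∀ {s t p} (w : Walk (Link n) x s t) → p ∈ vertices w → φ p ∈ vertices (grow w)
  φ∈-grow stop (here refl) = here refl
  φ∈-grow (step k (inj₁ (h , refl)) w) (here refl) = start∈ (growArc k _ h ⋆ʷ grow w)
  φ∈-grow (step k (inj₁ (h , refl)) w) (there p∈) = ∈-⋆ʳ (growArc k _ h) (grow w) (φ∈-grow w p∈)
  φ∈-grow (step k (inj₂ (h , refl)) w) (here refl) = start∈ (Rev.revOnto (growArc k _ h) (grow w))
  φ∈-grow (step k (inj₂ (h , refl)) w) (there p∈) = Rev.∈-revOntoʳ (growArc k _ h) (grow w) (φ∈-grow w p∈)

  new∈-grow : ∀ {s t k l} (w : Walk (Link n) x s t) → (k , l) ∈ arcs w → Crossing (k , l) → x + l ∈ vertices (grow w)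
  new∈-grow (step k (inj₁ (h , refl)) w) (here refl) c = ∈-⋆ˡ (growArc k _ h) (grow w) (grown∈ k _ h c)
  new∈-grow (step k (inj₂ (h , refl)) w) (here refl) c = Rev.∈-revOntoˡ (growArc k _ h) (grow w) (grown∈ k _ h c)
  new∈-grow (step k (inj₁ (h , refl)) w) (there e∈) c = ∈-⋆ʳ (growArc k _ h) (grow w) (new∈-grow w e∈ c)
  new∈-grow (step k (inj₂ (h , refl)) w) (there e∈) c = Rev.∈-revOntoʳ (growArc k _ h) (grow w) (new∈-grow w e∈ c)

-- New vertices at the ends of the path

module Sprouting (n x : ℕ) .{{_ : NonZero n}} .{{_ : NonZero (n + x)}} (2≤x : 2 ≤ x) (2x≤n : x + x ≤ n) where

  open Growth n x 2≤x 2x≤n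

  -- A missing far arc at an end of the path: the new vertex above its low end is attached to that end.
  data Bud (s : ℕ) : Set where
    none : Bud s
    bud  : ∀ u → u < x → Incident {n} {x} (far , u) s → Bud s

  lows : ∀ {s} → Bud s → List ℕ
  lows none        = []
  lows (bud u _ _) = u ∷ []

  bud-near : ∀ {u s} → u < x → Incident {n} {x} (far , u) s → Near (n + x) x (x + u) (φ s)
  bud-near {u} u<x (inj₁ refl) = inj₂ (cong (λ z → (x + z) % (n + x)) (sym (φ-low u<x)))
  bud-near {u} u<x (inj₂ refl) = inj₁ (cong (_% (n + x)) (trans (cong φ (m<n⇒m%n≡m (<-≤-trans (+-monoʳ-< x u<x) 2x≤n)))
    (trans (φ-high (m≤m+n x u)) (+-comm (x + u) x))))

  sprig : ∀ {s} → Bud s → ∃[ s′ ] Walk (Near (n + x)) x s′ (φ s)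
  sprig none         = _ , stop
  sprig (bud u u<x i) = _ , step far (bud-near u<x i) stop

  count-sprig : ∀ {s} j (β : Bud s) → count j (proj₂ (sprig β)) ≡ δ j far * length (lows β)
  count-sprig j none        = sym (*-zeroʳ (δ j far))
  count-sprig j (bud u _ _) = trans (+-identityʳ _) (sym (*-identityʳ _))

  ∈-sprig : ∀ {s u} (β : Bud s) → u ∈ lows β → x + u ∈ vertices (proj₂ (sprig β))
  ∈-sprig (bud u _ _) (here refl) = here refl

  lows< : ∀ {s u} (β : Bud s) → u ∈ lows β → u < x
  lows< (bud u u<x _) (here refl) = u<x

  crossingsOf : ∀ {a b c} → Ham n x a b c → List Arc
  crossingsOf H = crossings (arcs (Ham.walk H))

  -- Together the hypotheses say that each new vertex is reached exactly once, from a crossing arc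
  -- or a bud. This makes the number of added far steps exactly x, and from this count and coverage
  -- the distinctness of the vertices follows.
  module _ {a b c : ℕ} (H : Ham n x a b c) (n≡ : n ≡ suc (a + b + c)) (β : Bud (Ham.s H)) (γ : Bud (Ham.t H))
    (injective : ∀ {e f} → e ∈ crossingsOf H → f ∈ crossingsOf H → proj₂ e ≡ proj₂ f → e ≡ f)
    (covered   : ∀ {y} → y < x → y ∈ map proj₂ (crossingsOf H) ++ lows β ++ lows γ)
    (distinct  : Unique (lows β ++ lows γ))
    (missing   : ∀ {e} → e ∈ crossingsOf H → proj₂ e ∉ lows β ++ lows γ)
    where

    open Ham H

    private
      X = crossings (arcs walk)
      module Rev = Reverse {Near (n + x)} {x} swap

      tip : Walk (Near (n + x)) x (φ t) (proj₁ (sprig γ))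
      tip = Rev.revOnto (proj₂ (sprig γ)) stop

      full : Walk (Near (n + x)) x (proj₁ (sprig β)) (proj₁ (sprig γ))
      full = proj₂ (sprig β) ⋆ʷ grow walk ⋆ʷ tip

      new≡ : length (lows β) + (length X + length (lows γ)) ≡ x
      new≡ = trans (trans eq (sym lengths)) (≤-antisym upper lower)
        where
        Z = map proj₂ X ++ lows β ++ lows γ
        lengths : length Z ≡ length X + (length (lows β) + length (lows γ))
        lengths = trans (length-++ (map proj₂ X)) (cong₂ _+_ (length-map proj₂ X) (length-++ (lows β)))
        eq : length (lows β) + (length X + length (lows γ)) ≡ length X + (length (lows β) + length (lows γ))
        eq = trans (sym (+-assoc (length (lows β)) (length X) _))
            (trans (cong (_+ length (lows γ)) (+-comm (length (lows β)) (length X))) (+-assoc (length X) _ _))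
        unique : Unique Z
        unique = Unique.++⁺ (unique-map proj₂ (crossings-unique (arcs-unique walk simple)) injective) distinct
          λ (y∈ , y∈′) → clash y∈ y∈′
          where
          clash : ∀ {y} → y ∈ map proj₂ X → y ∉ lows β ++ lows γ
          clash y∈ y∈′ with ∈-map⁻ proj₂ y∈
          ... | e , e∈ , refl = missing e∈ y∈′
        small : ∀ {y} → y ∈ Z → y < x
        small y∈ with ∈-++⁻ (map proj₂ X) y∈
        small y∈ | inj₁ h with ∈-map⁻ proj₂ h
        ... | e , e∈ , refl = proj₁ (proj₂ (∈-crossings⁻ {es = arcs walk} e∈))
        small y∈ | inj₂ h with ∈-++⁻ (lows β) h
        ... | inj₁ h′ = lows< β h′
        ... | inj₂ h′ = lows< γ h′
        upper : length Z ≤ x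
        upper = subst (length Z ≤_) (length-upTo x) (length-⊆ unique (λ y∈ → ∈-upTo⁺ (small y∈)))
        lower : x ≤ length Z
        lower = subst (_≤ length Z) (length-upTo x) (length-⊆ (Unique.upTo⁺ x) (λ y∈ → covered (∈-upTo⁻ y∈)))

      counts : ∀ j → count j full ≡ count j walk + δ j far * x
      counts j = trans (count-⋆ j (proj₂ (sprig β)) _) (trans (cong₂ _+_ (count-sprig j β)
          (trans (count-⋆ j (grow walk) tip) (cong₂ _+_ (count-grow j walk)
              (trans (Rev.count-revOnto j (proj₂ (sprig γ)) stop) (trans (+-identityʳ _) (count-sprig j γ))))))
        (trans (collect (δ j far) (length (lows β)) (count j walk) (length X) (length (lows γ)))
            (cong (λ z → count j walk + δ j far * z) new≡)))
        where
        collect : ∀ d p q r s → d * p + (q + d * r + d * s) ≡ q + d * (p + (r + s))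
        collect = solve-∀

      hits : ∀ p → p < n + x → p ∈ vertices full
      hits p p< with p <? x
      ... | yes p<x = old (subst (_∈ vertices (grow walk)) (φ-low p<x)
          (φ∈-grow walk (all (<-≤-trans p<x (≤-trans (m≤m+n x x) 2x≤n)))))
        where
        old : ∀ {q} → q ∈ vertices (grow walk) → q ∈ vertices full
        old q∈ = ∈-⋆ʳ (proj₂ (sprig β)) _ (∈-⋆ˡ (grow walk) tip q∈)
      ... | no p≮x with m≤n⇒∃[o]m+o≡n (≮⇒≥ p≮x)
      ...   | y , refl with y <? x
      ...     | no y≮x = ∈-⋆ʳ (proj₂ (sprig β)) _ (∈-⋆ˡ (grow walk) tip
                  (subst (_∈ vertices (grow walk)) (trans (φ-high (≮⇒≥ y≮x)) (+-comm y x))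
                      (φ∈-grow walk (all (+-cancelˡ-< x y n (subst (x + y <_) (+-comm n x) p<))))))
      ...     | yes y<x with ∈-++⁻ (map proj₂ X) (covered y<x)
      ...       | inj₁ h with ∈-map⁻ proj₂ h
      ...         | (k , _) , e∈ , refl = ∈-⋆ʳ (proj₂ (sprig β)) _ (∈-⋆ˡ (grow walk) tip (new∈-grow walk (proj₁ cr) (proj₂ cr)))
        where cr = ∈-crossings⁻ {es = arcs walk} e∈
      hits p p< | no p≮x | y , refl | yes y<x | inj₂ h with ∈-++⁻ (lows β) h
      ... | inj₁ h′ = ∈-⋆ˡ (proj₂ (sprig β)) _ (∈-sprig β h′)
      ... | inj₂ h′ = ∈-⋆ʳ (proj₂ (sprig β)) _ (∈-⋆ʳ (grow walk) tip (Rev.∈-revOntoˡ (proj₂ (sprig γ)) stop (∈-sprig γ h′)))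

    sprout : Realizable (n + x) (L12x x a b (c + x))
    sprout = subst (Realizable (n + x)) (cong-L ones≡ twos≡ fars≡)
        (realize (n + x) full v≡ short (λ p h → p , hits p h , m<n⇒m%n≡m h))
      where
      ones≡ : count one full ≡ a
      ones≡ = trans (counts one) (trans (+-identityʳ _) ones)
      twos≡ : count two full ≡ b
      twos≡ = trans (counts two) (trans (+-identityʳ _) twos)
      fars≡ : count far full ≡ c + x
      fars≡ = trans (counts far) (cong₂ _+_ fars (+-identityʳ x))
      v≡ : n + x ≡ suc (count one full + count two full + count far full)
      v≡ = trans (cong (_+ x) n≡) (cong suc (trans (+-assoc (a + b) c x) (sym (cong₂ _+_ (cong₂ _+_ ones≡ twos≡) fars≡))))
      short : ∀ k → 0 < count k full → span x k * 2 ≤ n + x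
      short k _ = ≤-trans (*-monoˡ-≤ 2 (span≤x k))
          (≤-trans (≤-reflexive (trans (*-comm x 2) (cong (x +_) (+-identityʳ x)))) (≤-trans 2x≤n (m≤m+n n x)))

-- Choice of the cut

farLows shortLows : List Arc → List ℕ
farLows []               = []
farLows ((far , l) ∷ es) = l ∷ farLows es
farLows ((_   , _) ∷ es) = farLows es
shortLows []               = []
shortLows ((far , _) ∷ es) = shortLows es
shortLows ((_   , l) ∷ es) = l ∷ shortLows es

∈-farLows⁺ : ∀ {l es} → (far , l) ∈ es → l ∈ farLows es
∈-farLows⁺ {es = (far , _) ∷ _} (here refl) = here refl
∈-farLows⁺ {es = (far , _) ∷ _} (there h) = there (∈-farLows⁺ h)
∈-farLows⁺ {es = (one , _) ∷ _} (there h) = ∈-farLows⁺ h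
∈-farLows⁺ {es = (two , _) ∷ _} (there h) = ∈-farLows⁺ h

∈-farLows⁻ : ∀ {l es} → l ∈ farLows es → (far , l) ∈ es
∈-farLows⁻ {es = (far , _) ∷ _} (here refl) = here refl
∈-farLows⁻ {es = (far , _) ∷ _} (there h) = there (∈-farLows⁻ h)
∈-farLows⁻ {es = (one , _) ∷ _} h = there (∈-farLows⁻ h)
∈-farLows⁻ {es = (two , _) ∷ _} h = there (∈-farLows⁻ h)

∈-shortLows⁺ : ∀ {k l es} → k ≢ far → (k , l) ∈ es → l ∈ shortLows es
∈-shortLows⁺ {es = (one , _) ∷ _} k≢ (here refl) = here refl
∈-shortLows⁺ {es = (two , _) ∷ _} k≢ (here refl) = here refl
∈-shortLows⁺ {es = (far , _) ∷ _} k≢ (here refl) = ⊥-elim (k≢ refl)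
∈-shortLows⁺ {es = (far , _) ∷ _} k≢ (there h) = ∈-shortLows⁺ k≢ h
∈-shortLows⁺ {es = (one , _) ∷ _} k≢ (there h) = there (∈-shortLows⁺ k≢ h)
∈-shortLows⁺ {es = (two , _) ∷ _} k≢ (there h) = there (∈-shortLows⁺ k≢ h)

∈-shortLows⁻ : ∀ {l es} → l ∈ shortLows es → ∃[ k ] k ≢ far × (k , l) ∈ es
∈-shortLows⁻ {es = (one , _) ∷ _} (here refl) = one , (λ ()) , here refl
∈-shortLows⁻ {es = (two , _) ∷ _} (here refl) = two , (λ ()) , here refl
∈-shortLows⁻ {es = (one , _) ∷ _} (there h) with ∈-shortLows⁻ h
... | k , k≢ , h′ = k , k≢ , there h′
∈-shortLows⁻ {es = (two , _) ∷ _} (there h) with ∈-shortLows⁻ h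
... | k , k≢ , h′ = k , k≢ , there h′
∈-shortLows⁻ {es = (far , _) ∷ _} h with ∈-shortLows⁻ h
... | k , k≢ , h′ = k , k≢ , there h′

farLows-unique : ∀ {es} → Unique es → Unique (farLows es)
farLows-unique [] = []
farLows-unique {(far , _) ∷ es} (e∉ ∷ u) = All.¬Any⇒All¬ _ (λ h → unique-∉ (e∉ ∷ u) (∈-farLows⁻ h)) ∷ farLows-unique u
farLows-unique {(one , _) ∷ es} (_ ∷ u) = farLows-unique u
farLows-unique {(two , _) ∷ es} (_ ∷ u) = farLows-unique u

module _ {n x : ℕ} .{{_ : NonZero n}} where

  length-farLows : ∀ {s t} (w : Walk (Link n) x s t) → length (farLows (arcs w)) ≡ count far w
  length-farLows stop = refl
  length-farLows (step one _ w) = length-farLows w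
  length-farLows (step two _ w) = length-farLows w
  length-farLows (step far _ w) = cong suc (length-farLows w)

  length-shortLows : ∀ {s t} (w : Walk (Link n) x s t) → length (shortLows (arcs w)) ≡ count one w + count two w
  length-shortLows stop = refl
  length-shortLows (step one _ w) = cong suc (length-shortLows w)
  length-shortLows (step two _ w) = trans (cong suc (length-shortLows w)) (sym (+-suc (count one w) (count two w)))
  length-shortLows (step far _ w) = length-shortLows w

pigeonhole : ∀ {n} (bad : List ℕ) → length bad < n → ∃[ o ] o < n × o ∉ bad
pigeonhole {n} bad bad<n with anyUpTo? (λ o → ¬? (o ∈? bad)) n
... | yes h = h
... | no ¬h = ⊥-elim (<⇒≱ bad<n (subst (_≤ length bad) (length-upTo n) (length-⊆ (Unique.upTo⁺ n)
                (λ {o} o∈ → decidable-stable (o ∈? bad) (λ o∉ → ¬h (o , ∈-upTo⁻ o∈ , o∉))))))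

length-concatMap : ∀ {m} (f : ℕ → List ℕ) → (∀ z → length (f z) ≡ m) → ∀ zs → length (concatMap f zs) ≡ length zs * m
length-concatMap f h [] = refl
length-concatMap f h (z ∷ zs) = trans (length-++ (f z)) (cong₂ _+_ (h z) (length-concatMap f h zs))

module _ {n x : ℕ} .{{_ : NonZero n}} (0<x : 0 < x) (x<n : x < n) where

  no-loop : ∀ {s} → s < n → s ≢ (x + s) % n
  no-loop {s} s<n e with x + s <? n
  ... | yes h = <-irrefl (trans e (m<n⇒m%n≡m h)) (m<n+m s 0<x)
  ... | no  h = <-irrefl (trans (sym (m∸n+n≡m n≤)) (cong (_+ n) (trans (sym r≡) (sym e))))
      (subst (x + s <_) (+-comm n s) (+-monoˡ-< s x<n))
    where
    n≤ = ≮⇒≥ h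
    r≡ : (x + s) % n ≡ x + s ∸ n
    r≡ = trans (sym (m≤n⇒[n∸m]%m≡n%m n≤)) (m<n⇒m%n≡m
        (+-cancelʳ-< n (x + s ∸ n) n (subst (_< n + n) (sym (m∸n+n≡m n≤)) (+-mono-< x<n s<n))))

  -- an end of a simple path lies on at most one of its arcs, so one of its two far arcs is missing
  candidate : ∀ {s t} (w : Walk (Link n) x s t) → Unique (vertices w) → s < n →
              ∃[ u ] u < n × u ∉ farLows (arcs w) × Incident {n} {x} (far , u) s
  candidate {s} w simple s<n with s ∈? farLows (arcs w)
  ... | no s∉ = s , s<n , s∉ , inj₁ refl
  ... | yes s∈ = u , m%n<n _ n , (λ u∈ → no-loop s<n (trans i (cong (λ z → (x + z) % n) (sym (same u∈))))) , inj₂ i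
    where
    u = (s + (n ∸ x)) % n
    i : s ≡ (x + u) % n
    i = sym (Rotation.unrot n x x (<⇒≤ x<n) s<n)
    same : u ∈ farLows (arcs w) → s ≡ u
    same u∈ = cong proj₂ (end-arc w simple (∈-farLows⁻ s∈) (inj₁ refl) (∈-farLows⁻ u∈) (inj₂ i))

  Incident-rot : ∀ {o} (o≤n : o ≤ n) {u s} → Incident {n} {x} (far , u) s → Incident {n} {x} (far , Rotation.rot n x o o≤n u)
      (Rotation.rot n x o o≤n s)
  Incident-rot o≤n (inj₁ refl) = inj₁ refl
  Incident-rot {o} o≤n {u} (inj₂ refl) = inj₂ (trans (%-absorbˡ n (x + u) (n ∸ o))
      (trans (cong (_% n) (+-assoc x u (n ∸ o))) (sym (%-absorbʳ n x (u + (n ∸ o))))))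

module Cutting {n x a b c : ℕ} .{{_ : NonZero n}} (2≤x : 2 ≤ x) (2x≤n : x + x ≤ n) (n≡ : n ≡ suc (a + b + c))
    (H : Ham n x a b c) where

  open Ham H

  Y = farLows (arcs walk)
  S = shortLows (arcs walk)

  private
    0<x : 0 < x
    0<x = <-trans (s≤s z≤n) 2≤x
    x<n : x < n
    x<n = <-≤-trans (m<m+n x 0<x) 2x≤n

    -- The offset that puts the vertex l at place y of the window.
    back : ℕ → ℕ → ℕ
    back l y = (l + (n ∸ y)) % n

    back≡ : ∀ {o l y} → o < n → y < x → l ≡ (o + y) % n → back l y ≡ o
    back≡ {o} {l} {y} o<n y<x refl = trans (cong (λ z → (z % n + (n ∸ y)) % n) (+-comm o y))
      (Rotation.rot-unrot n x y (<⇒≤ (<-trans y<x x<n)) o<n)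

  -- the places, other than those in ex, from which no far arc starts
  M : List ℕ → List ℕ
  M ex = filter (λ u → ¬? (u ∈? ex ++ Y)) (upTo n)

  -- The c far arcs have distinct low ends, so a + b + 1 of the n places start none, and those in
  -- `ex` are not counted.
  length-M : ∀ ex → Unique ex → (∀ {u} → u ∈ ex → u < n × u ∉ Y) → length (M ex) + length ex ≤ suc (a + b)
  length-M ex u ok = +-cancelʳ-≤ c _ _ (subst₂ _≤_ eq n≡′ (length-⊆ unique λ z∈ → ∈-upTo⁺ (small z∈)))
    where
    Z = M ex ++ ex ++ Y
    eq : length Z ≡ length (M ex) + length ex + c
    eq = trans (length-++ (M ex)) (trans (cong (length (M ex) +_)
        (trans (length-++ ex) (cong (length ex +_) (trans (length-farLows walk) fars)))) (sym (+-assoc (length (M ex)) _ c)))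
    n≡′ : length (upTo n) ≡ suc (a + b) + c
    n≡′ = trans (length-upTo n) n≡
    unique : Unique Z
    unique = Unique.++⁺ (Unique.filter⁺ _ (Unique.upTo⁺ n))
        (Unique.++⁺ u (farLows-unique (arcs-unique walk simple)) (λ (h , h′) → proj₂ (ok h) h′))
      (λ (h , h′) → proj₂ (∈-filter⁻ (λ u → ¬? (u ∈? ex ++ Y)) {xs = upTo n} h) h′)
    small : ∀ {z} → z ∈ Z → z < n
    small z∈ with ∈-++⁻ (M ex) z∈
    ... | inj₁ h = ∈-upTo⁻ (proj₁ (∈-filter⁻ (λ u → ¬? (u ∈? ex ++ Y)) {xs = upTo n} h))
    ... | inj₂ h with ∈-++⁻ ex h
    ...   | inj₁ h′ = proj₁ (ok h′)
    ...   | inj₂ h′ = bound (incident∈ walk (∈-farLows⁻ h′) (inj₁ refl))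

  -- Each missing far arc outside ex rules out x offsets, each short arc one offset for every place in js.
  offset : ∀ ex js → (∀ {j} → j ∈ js → j < x) → length (M ex) * x + (a + b) * length js < n →
           ∃[ o ] o < n × (∀ {y} → y < x → (o + y) % n ∈ ex ++ Y) × (∀ {j} → j ∈ js → (o + j) % n ∉ S)
  offset ex js js<x bad< with pigeonhole (concatMap (λ m → map (back m) (upTo x)) (M ex) ++ concatMap (λ l → map (back l) js) S)
      (subst (_< n) (sym len≡) bad<)
    where
    len≡ : length (concatMap (λ m → map (back m) (upTo x)) (M ex) ++ concatMap (λ l → map (back l) js) S) ≡ length
        (M ex) * x + (a + b) * length js
    len≡ = trans (length-++ (concatMap (λ m → map (back m) (upTo x)) (M ex)))
      (cong₂ _+_ (length-concatMap _ (λ m → trans (length-map (back m) (upTo x)) (length-upTo x)) (M ex))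
                 (trans (length-concatMap _ (λ l → length-map (back l) js) S)
                     (cong (_* length js) (trans (length-shortLows walk) (cong₂ _+_ ones twos)))))
  ... | o , o<n , o∉ = o , o<n , present , quiet
    where
    present : ∀ {y} → y < x → (o + y) % n ∈ ex ++ Y
    present {y} y<x = decidable-stable (_ ∈? ex ++ Y) λ ∉ →
        o∉ (∈-++⁺ˡ (∈-concatMap⁺′ (∈-filter⁺ (λ u → ¬? (u ∈? ex ++ Y)) (∈-upTo⁺ (m%n<n (o + y) n)) ∉)
        (subst (_∈ map (back ((o + y) % n)) (upTo x)) (back≡ o<n y<x refl) (∈-map⁺ (back ((o + y) % n)) (∈-upTo⁺ y<x)))))
      where
      ∈-concatMap⁺′ : ∀ {m z} → m ∈ M ex → z ∈ map (back m) (upTo x) → z ∈ concatMap (λ m → map (back m) (upTo x)) (M ex)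
      ∈-concatMap⁺′ m∈ z∈ = ∈-concat⁺′ z∈ (∈-map⁺ _ m∈)
    quiet : ∀ {j} → j ∈ js → (o + j) % n ∉ S
    quiet {j} j∈ l∈ = o∉ (∈-++⁺ʳ _ (∈-concat⁺′ (subst (_∈ map (back ((o + j) % n)) js) (back≡ o<n (js<x j∈) refl)
        (∈-map⁺ (back ((o + j) % n)) j∈)) (∈-map⁺ _ l∈)))

-- A far link between the two ends, which closes the path to a cycle.
record Closing {n x : ℕ} .{{_ : NonZero n}} (s t u : ℕ) : Set where
  constructor closing
  field
    link : Link n x t s
    low≡ : low link ≡ u

module _ {n x : ℕ} .{{_ : NonZero n}} where

  -- Two distinct vertices incident with the same arc are its two ends.
  close : ∀ {s t u} → u < n → Incident {n} {x} (far , u) s → Incident {n} {x} (far , u) t → s ≢ t → Closing {n} {x} s t u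
  close u<n (inj₁ refl) (inj₁ refl) s≢t = ⊥-elim (s≢t refl)
  close u<n (inj₁ refl) (inj₂ e) s≢t = closing (inj₂ (u<n , e)) refl
  close u<n (inj₂ e) (inj₁ refl) s≢t = closing (inj₁ (u<n , e)) refl
  close u<n (inj₂ e) (inj₂ e′) s≢t = ⊥-elim (s≢t (trans e (sym e′)))

  ends-differ : ∀ {s t} (w : Walk (Link n) x s t) → Unique (vertices w) → 1 < length (vertices w) → s ≢ t
  ends-differ stop u (s≤s ()) _
  ends-differ (step _ _ w) u _ refl = unique-∉ u (end∈ w)

  module _ {a b c : ℕ} (H : Ham n x a b c) {u m : ℕ}
           (r : Closing {n} {x} (Ham.s H) (Ham.t H) u) (m∈ : (far , m) ∈ arcs (Ham.walk H)) where

    open Ham H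
    open Closing r

    record Reopened : Set where
      field
        ham   : Ham n x a b c
        keeps : ∀ {e} → e ∈ arcs walk → e ≢ (far , m) → e ∈ arcs (Ham.walk ham)
        closed : (far , u) ∈ arcs (Ham.walk ham)
        olds  : ∀ {e} → e ∈ arcs (Ham.walk ham) → e ∈ arcs walk ⊎ e ≡ (far , u)
        ends  : Ham.s ham ≡ m ⊎ Ham.t ham ≡ m

    -- the path closed up by the far arc at u and reopened at the far arc at m
    reopen : Reopened
    reopen with splitAt walk m∈
    ... | splitting {p} {q} edge low′ left right rebuild = record
      { ham = record
        { walk   = w′
        ; simple = Unique-resp π simple
        ; all    = λ p<n → ∈-resp-↭ π (all p<n)
        ; bound  = λ p∈ → bound (∈-resp-↭ (↭-sym π) p∈)
        ; ones   = trans (swapped one) ones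
        ; twos   = trans (swapped two) twos
        ; fars   = trans (swapped far) fars }
      ; keeps  = keeps
      ; closed = subst ((far , u) ∈_) (sym arcs′) (∈-++⁺ʳ (arcs right) (here (cong (far ,_) (sym low≡))))
      ; olds   = olds
      ; ends   = ends edge low′ }
      where
      w′ : Walk (Link n) x q p
      w′ = right ⋆ʷ step far link left
      vertices≡ : vertices walk ≡ vertices left ++ vertices right
      vertices≡ = trans (cong vertices rebuild) (vertices-edge far edge left right)
      π : vertices walk ↭ vertices w′
      π = subst₂ _↭_ (sym vertices≡) (sym (vertices-edge far link right left)) (++-comm (vertices left) (vertices right))
      arcs≡ : arcs walk ≡ arcs left ++ (far , low edge) ∷ arcs right
      arcs≡ = trans (cong arcs rebuild) (arcs-⋆ left _)
      arcs′ : arcs w′ ≡ arcs right ++ (far , low link) ∷ arcs left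
      arcs′ = arcs-⋆ right _
      swapped : ∀ k → count k w′ ≡ count k walk
      swapped k = trans (count-⋆ k right _) (trans (exchange (count k right) (δ k far) (count k left))
                    (sym (trans (cong (count k) rebuild) (count-⋆ k left _))))
        where
        exchange : ∀ a d b → a + (d + b) ≡ b + (d + a)
        exchange = solve-∀
      keeps : ∀ {e} → e ∈ arcs walk → e ≢ (far , m) → e ∈ arcs w′
      keeps {e} e∈ e≢ with ∈-++⁻ (arcs left) (subst (e ∈_) arcs≡ e∈)
      ... | inj₁ h = subst (e ∈_) (sym arcs′) (∈-++⁺ʳ (arcs right) (there h))
      ... | inj₂ (here e≡) = ⊥-elim (e≢ (trans e≡ (cong (far ,_) low′)))
      ... | inj₂ (there h) = subst (e ∈_) (sym arcs′) (∈-++⁺ˡ h)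
      olds : ∀ {e} → e ∈ arcs w′ → e ∈ arcs walk ⊎ e ≡ (far , u)
      olds {e} e∈ with ∈-++⁻ (arcs right) (subst (e ∈_) arcs′ e∈)
      ... | inj₁ h = inj₁ (subst (e ∈_) (sym arcs≡) (∈-++⁺ʳ (arcs left) (there h)))
      ... | inj₂ (here e≡) = inj₂ (trans e≡ (cong (far ,_) low≡))
      ... | inj₂ (there h) = inj₁ (subst (e ∈_) (sym arcs≡) (∈-++⁺ˡ h))
      ends : (r : Link n x p q) → low r ≡ m → q ≡ m ⊎ p ≡ m
      ends (inj₁ _) refl = inj₂ refl
      ends (inj₂ _) refl = inj₁ refl

-- Windows behind which vertices can be inserted

module Extending {n x a b c : ℕ} .{{_ : NonZero n}} .{{_ : NonZero (n + x)}} (2≤x : 2 ≤ x) (2x≤n : x + x ≤ n)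
    (n≡ : n ≡ suc (a + b + c)) where

  open Growth n x 2≤x 2x≤n
  open Sprouting n x 2≤x 2x≤n

  private
    0<x : 0 < x
    0<x = <-trans (s≤s z≤n) 2≤x

  -- A missing arc that starts outside the window leaves no new vertex uncovered, so nothing is
  -- attached.
  budOf : ∀ {s} u → Incident {n} {x} (far , u) s → Bud s
  budOf u i with u <? x
  ... | yes u<x = bud u u<x i
  ... | no  _   = none

  ∈-budOf : ∀ {s u} (i : Incident {n} {x} (far , u) s) → u < x → u ∈ lows (budOf u i)
  ∈-budOf {u = u} i u<x with u <? x
  ... | yes _ = here refl
  ... | no ¬h = ⊥-elim (¬h u<x)

  budOf-∈ : ∀ {s u v} (i : Incident {n} {x} (far , u) s) → v ∈ lows (budOf u i) → v ≡ u
  budOf-∈ {u = u} i v∈ with u <? x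
  budOf-∈ {u = u} i (here refl) | yes _ = refl

  budOf-unique : ∀ {s u} (i : Incident {n} {x} (far , u) s) → Unique (lows (budOf u i))
  budOf-unique {u = u} i with u <? x
  ... | yes _ = [] ∷ []
  ... | no  _ = []

  -- A window of length x can only be left by a short arc from one of its last two places.
  top-two : ∀ {k l} → k ≢ far → Crossing (k , l) → l ≡ x ∸ 1 ⊎ k ≡ two × l ≡ x ∸ 2
  top-two {one} {l} k≢ (l<x , x≤) = inj₁ (cong pred (≤-antisym l<x x≤))
  top-two {two} {l} k≢ (l<x , x≤) with m≤n⇒m<n∨m≡n l<x
  ... | inj₂ e = inj₁ (cong pred e)
  ... | inj₁ h = inj₂ (refl , cong (_∸ 2) (≤-antisym h x≤))
  top-two {far} k≢ _ = ⊥-elim (k≢ refl)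

  far? : ∀ k → k ≡ far ⊎ k ≢ far
  far? one = inj₂ λ ()
  far? two = inj₂ λ ()
  far? far = inj₁ refl

  far-crossing : ∀ {y} → y < x → Crossing (far , y)
  far-crossing y<x = y<x , m≤m+n x _

  -- When only far arcs leave the window, a crossing arc is determined by its low end, which is the
  -- injectivity that `sprout` asks for.
  module Quiet (H : Ham n x a b c) (quiet : ∀ {k l} → (k , l) ∈ arcs (Ham.walk H) → Crossing (k , l) → k ≡ far) where

    open Ham H

    plain-injective : ∀ {e f} → e ∈ crossings (arcs walk) → f ∈ crossings (arcs walk) → proj₂ e ≡ proj₂ f → e ≡ f
    plain-injective {k , l} {k′ , .l} e∈ f∈ refl with ∈-crossings⁻ {es = arcs walk} e∈ | ∈-crossings⁻ {es = arcs walk} f∈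
    ... | h , cr | h′ , cr′ = cong (_, l) (trans (quiet h cr) (sym (quiet h′ cr′)))

    grown : ∀ (β : Bud s) (γ : Bud t) → (∀ {y} → y < x → (far , y) ∈ arcs walk ⊎ y ∈ lows β ++ lows γ) →
            Unique (lows β ++ lows γ) → (∀ {u} → u ∈ lows β ++ lows γ → (far , u) ∉ arcs walk) →
                Realizable (n + x) (L12x x a b (c + x))
    grown β γ cov uniq miss = sprout H n≡ β γ plain-injective covered uniq missing
      where
      covered : ∀ {y} → y < x → y ∈ map proj₂ (crossings (arcs walk)) ++ lows β ++ lows γ
      covered y<x with cov y<x
      ... | inj₁ h = ∈-++⁺ˡ (∈-map⁺ proj₂ (∈-crossings⁺ h (far-crossing y<x)))
      ... | inj₂ h = ∈-++⁺ʳ (map proj₂ (crossings (arcs walk))) h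
      missing : ∀ {e} → e ∈ crossings (arcs walk) → proj₂ e ∉ lows β ++ lows γ
      missing {k , l} e∈ l∈ with ∈-crossings⁻ {es = arcs walk} e∈
      ... | h , cr with quiet h cr
      ...   | refl = miss l∈ h

  -- the far arc at the last place x-1 of the window is absent, and a short arc from x-1 takes its new vertex
  hinged : (H : Ham n x a b c) → Ham.s H ≡ x ∸ 1 ⊎ Ham.t H ≡ x ∸ 1 →
           (∀ {y} → y < x → y ≢ x ∸ 1 → (far , y) ∈ arcs (Ham.walk H)) →
           ∃[ k ] k ≢ far × (k , x ∸ 1) ∈ arcs (Ham.walk H) → (∀ {k} → (k , x ∸ 2) ∈ arcs (Ham.walk H) → k ≡ far) →
           Realizable (n + x) (L12x x a b (c + x))
  hinged H end fars-in (k₀ , k₀≢ , k₀∈) quiet = sprout H n≡ none none injective covered [] (λ _ ())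
    where
    open Ham H
    m<x : x ∸ 1 < x
    m<x = ≤-reflexive (suc-pred x {{>-nonZero 0<x}})
    -- An end of the path lies on one arc only, so no second arc visits the new vertex above x - 1.
    sole : ∀ {e f} → e ∈ arcs walk → f ∈ arcs walk → proj₂ e ≡ x ∸ 1 → proj₂ f ≡ x ∸ 1 → e ≡ f
    sole e∈ f∈ refl f≡ = at end
      where
      at : _ → _
      at (inj₁ s≡) = end-arc walk simple e∈ (inj₁ s≡) f∈ (inj₁ (trans s≡ (sym f≡)))
      at (inj₂ t≡) = end-arc (flip walk) (vertices-flip walk simple) (arcs-flip walk e∈) (inj₁ t≡) (arcs-flip walk f∈)
          (inj₁ (trans t≡ (sym f≡)))
    far-else : ∀ {k l} → (k , l) ∈ arcs walk → Crossing (k , l) → l ≢ x ∸ 1 → k ≡ far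
    far-else {k} {l} e∈ cr l≢ with far? k
    ... | inj₁ e = e
    ... | inj₂ k≢ with top-two k≢ cr
    ...   | inj₁ e = ⊥-elim (l≢ e)
    ...   | inj₂ (_ , e) = quiet (subst (λ l → (k , l) ∈ arcs walk) e e∈)
    injective : ∀ {e f} → e ∈ crossings (arcs walk) → f ∈ crossings (arcs walk) → proj₂ e ≡ proj₂ f → e ≡ f
    injective {k , l} {k′ , .l} e∈ f∈ refl with ∈-crossings⁻ {es = arcs walk} e∈ | ∈-crossings⁻ {es = arcs walk} f∈ | l ≟ x ∸ 1
    ... | h , cr | h′ , cr′ | yes e = sole h h′ e e
    ... | h , cr | h′ , cr′ | no ne = cong (_, l) (trans (far-else h cr ne) (sym (far-else h′ cr′ ne)))
    covered : ∀ {y} → y < x → y ∈ map proj₂ (crossings (arcs walk)) ++ []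
    covered {y} y<x with y ≟ x ∸ 1
    ... | no ne = ∈-++⁺ˡ (∈-map⁺ proj₂ (∈-crossings⁺ (fars-in y<x ne) (far-crossing y<x)))
    ... | yes refl = ∈-++⁺ˡ (∈-map⁺ proj₂ (∈-crossings⁺ k₀∈ (m<x , reach k₀)))
      where
      reach : ∀ k → x ≤ span x k + (x ∸ 1)
      reach one = ≤-reflexive (sym (suc-pred x {{>-nonZero 0<x}}))
      reach two = ≤-trans (reach one) (n≤1+n _)
      reach far = m≤m+n x _

-- Counting the spoiled offsets

private
  -- Here m counts spoiling places and s short arcs. With s = 1 + m + e and x = 2 + s + f, the
  -- difference s + (x - 1)² - (m x + 2 s) is a polynomial with nonnegative coefficients, displayed
  -- in `identity`.
  window-room : ∀ m s x c → suc m ≤ s → 2 + s ≤ x → pred x * pred x ≤ c → m * x + s * 2 < suc (s + c)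
  window-room m s x c m<s s<x sq with m≤n⇒∃[o]m+o≡n m<s
  ... | e , refl with m≤n⇒∃[o]m+o≡n s<x
  ...   | f , refl = s≤s (≤-trans (≤-trans (m≤m+n _ ((e + f) * (e + f) + m * (e + f) + 3 * e + 4 * f + 3))
      (≤-reflexive (identity m e f))) (+-monoʳ-≤ (suc m + e) sq))
    where
    identity : ∀ m e f → m * (2 + (suc m + e) + f) + (suc m + e) * 2 + ((e + f) * (e + f) + m * (e + f) + 3 * e + 4 * f + 3) ≡
               suc m + e + suc (suc m + e + f) * suc (suc m + e + f)
    identity = solve-∀

  -- One more spoiling place may occur, but each short arc rules out only one offset. For e = f = 0
  -- the slack is just 1, so this case needs nearly all of (x - 1)².
  cycle-room : ∀ m s x c → m ≤ s → 2 + s ≤ x → pred x * pred x ≤ c → m * x + s * 1 < suc (s + c)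
  cycle-room m s x c m≤s s<x sq with m≤n⇒∃[o]m+o≡n m≤s
  ... | e , refl with m≤n⇒∃[o]m+o≡n s<x
  ...   | f , refl = s≤s (≤-trans (≤-trans (m≤m+n _ ((e + f) * (e + f) + m * (e + f) + 2 * (e + f) + 1))
      (≤-reflexive (identity m e f))) (+-monoʳ-≤ (m + e) sq))
    where
    identity : ∀ m e f → m * (2 + (m + e) + f) + (m + e) * 1 + ((e + f) * (e + f) + m * (e + f) + 2 * (e + f) + 1) ≡
               m + e + suc (m + e + f) * suc (m + e + f)
    identity = solve-∀

module Transfer {n x a b c : ℕ} .{{_ : NonZero n}} .{{_ : NonZero (n + x)}} (2≤x : 2 ≤ x) (2x≤n : x + x ≤ n)
    (n≡ : n ≡ suc (a + b + c))
                (few : 2 + (a + b) ≤ x) (many : pred x * pred x ≤ c) (H : Ham n x a b c) {u₁ u₂ : ℕ}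
                (u₁-spec : u₁ < n × u₁ ∉ farLows (arcs (Ham.walk H)) × Incident {n} {x} (far , u₁) (Ham.s H))
                (u₂-spec : u₂ < n × u₂ ∉ farLows (arcs (Ham.walk H)) × Incident {n} {x} (far , u₂) (Ham.t H)) where

  open Ham H
  open Growth n x 2≤x 2x≤n
  open Sprouting n x 2≤x 2x≤n
  open Extending {n} {x} {a} {b} {c} 2≤x 2x≤n n≡
  open Cutting 2≤x 2x≤n n≡ H

  private
    0<x : 0 < x
    0<x = <-trans (s≤s z≤n) 2≤x
    x<n : x < n
    x<n = <-≤-trans (m<m+n x 0<x) 2x≤n
    m<x : x ∸ 1 < x
    m<x = ≤-reflexive (suc-pred x {{>-nonZero 0<x}})

  module Turned (o : ℕ) (o<n : o < n) where

    open Rotation n x o (<⇒≤ o<n) public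

    H′ : Ham n x a b c
    H′ = rotate H

    module H′ = Ham H′

    arc⁺ : ∀ {k l} → (k , l) ∈ arcs walk → (k , rot l) ∈ arcs H′.walk
    arc⁺ h = subst (_ ∈_) (sym (arcs-rot walk)) (∈-map⁺ (map₂ rot) h)

    arc⁻ : ∀ {k l} → (k , l) ∈ arcs H′.walk → (k , (o + l) % n) ∈ arcs walk
    arc⁻ {k} {l} h with ∈-map⁻ (map₂ rot) (subst (_ ∈_) (arcs-rot walk) h)
    ... | (k′ , l′) , h′ , refl = subst (λ z → (k , z) ∈ arcs walk) (sym (unrot (bound (incident∈ walk h′ (inj₁ refl))))) h′

    present : ∀ {ex y} → y < x → (o + y) % n ∈ ex ++ Y → y ∈ map rot ex ⊎ (far , y) ∈ arcs H′.walk
    present {ex} {y} y<x h with ∈-++⁻ ex h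
    ... | inj₁ h′ = inj₁ (subst (_∈ map rot ex) (rot-unrot (<-trans y<x x<n)) (∈-map⁺ rot h′))
    ... | inj₂ h′ = inj₂ (subst (λ z → (far , z) ∈ arcs H′.walk) (rot-unrot (<-trans y<x x<n)) (arc⁺ (∈-farLows⁻ h′)))

    absent : ∀ {u} → u < n → u ∉ Y → (far , rot u) ∉ arcs H′.walk
    absent u<n u∉ h = u∉ (∈-farLows⁺ (subst (λ z → (far , z) ∈ arcs walk) (unrot u<n) (arc⁻ h)))

    quiet⇒far : ∀ {j k} → (o + j) % n ∉ S → (k , j) ∈ arcs H′.walk → k ≡ far
    quiet⇒far {j} {k} j∉ h with far? k
    ... | inj₁ e = e
    ... | inj₂ k≢ = ⊥-elim (j∉ (∈-shortLows⁺ k≢ (arc⁻ h)))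

  -- Excusing two missing arcs leaves at most a + b - 1 spoiling places, which is few enough to keep
  -- both last places free of short arcs.
  two-missing : u₁ ≢ u₂ → Realizable (n + x) (L12x x a b (c + x))
  two-missing u₁≢u₂ = from (offset (u₁ ∷ u₂ ∷ []) (x ∸ 1 ∷ x ∸ 2 ∷ []) js<x room)
    where
    js<x : ∀ {j} → j ∈ x ∸ 1 ∷ x ∸ 2 ∷ [] → j < x
    js<x (here refl) = m<x
    js<x (there (here refl)) = ≤-<-trans (∸-monoʳ-≤ {1} {2} x (s≤s z≤n)) m<x
    room : length (M (u₁ ∷ u₂ ∷ [])) * x + (a + b) * 2 < n
    room = subst (length (M (u₁ ∷ u₂ ∷ [])) * x + (a + b) * 2 <_) (sym n≡)
        (window-room (length (M (u₁ ∷ u₂ ∷ []))) (a + b) x c (s≤s⁻¹ (subst (_≤ suc (a + b)) (+-comm (length (M (u₁ ∷ u₂ ∷ []))) 2)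
             (length-M (u₁ ∷ u₂ ∷ []) ((u₁≢u₂ ∷ []) ∷ [] ∷ []) ok))) few many)
      where
      ok : ∀ {u} → u ∈ u₁ ∷ u₂ ∷ [] → u < n × u ∉ Y
      ok (here refl) = proj₁ u₁-spec , proj₁ (proj₂ u₁-spec)
      ok (there (here refl)) = proj₁ u₂-spec , proj₁ (proj₂ u₂-spec)
    from : ∃[ o ] o < n × (∀ {y} → y < x → (o + y) % n ∈ u₁ ∷ u₂ ∷ [] ++ Y) × (∀ {j} → j ∈ x ∸ 1 ∷ x ∸ 2 ∷ [] → (o + j) % n ∉ S) →
           Realizable (n + x) (L12x x a b (c + x))
    from (o , o<n , here-or , calm) = Quiet.grown H′ quiet β γ cov uniq miss
      where
      open Turned o o<n
      i₁ = Incident-rot 0<x x<n (<⇒≤ o<n) (proj₂ (proj₂ u₁-spec))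
      i₂ = Incident-rot 0<x x<n (<⇒≤ o<n) (proj₂ (proj₂ u₂-spec))
      β = budOf (rot u₁) i₁
      γ = budOf (rot u₂) i₂
      quiet : ∀ {k l} → (k , l) ∈ arcs H′.walk → Crossing (k , l) → k ≡ far
      quiet {k} h cr with far? k
      ... | inj₁ e = e
      ... | inj₂ k≢ with top-two k≢ cr
      ...   | inj₁ refl = quiet⇒far (calm (here refl)) h
      ...   | inj₂ (_ , refl) = quiet⇒far (calm (there (here refl))) h
      cov : ∀ {y} → y < x → (far , y) ∈ arcs H′.walk ⊎ y ∈ lows β ++ lows γ
      cov y<x with present {u₁ ∷ u₂ ∷ []} y<x (here-or y<x)
      ... | inj₂ h = inj₁ h
      ... | inj₁ (here refl) = inj₂ (∈-++⁺ˡ (∈-budOf i₁ y<x))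
      ... | inj₁ (there (here refl)) = inj₂ (∈-++⁺ʳ (lows β) (∈-budOf i₂ y<x))
      uniq : Unique (lows β ++ lows γ)
      uniq = Unique.++⁺ (budOf-unique i₁) (budOf-unique i₂) λ (h₁ , h₂) →
        u₁≢u₂ (trans (sym (unrot (proj₁ u₁-spec))) (trans (cong (λ z → (o + z) % n) (trans (sym (budOf-∈ i₁ h₁)) (budOf-∈ i₂ h₂)))
            (unrot (proj₁ u₂-spec))))
      miss : ∀ {u} → u ∈ lows β ++ lows γ → (far , u) ∉ arcs H′.walk
      miss u∈ h with ∈-++⁻ (lows β) u∈
      ... | inj₁ h₁ rewrite budOf-∈ i₁ h₁ = absent (proj₁ u₁-spec) (proj₁ (proj₂ u₁-spec)) h
      ... | inj₂ h₂ rewrite budOf-∈ i₂ h₂ = absent (proj₁ u₂-spec) (proj₁ (proj₂ u₂-spec)) h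

  -- Only one missing arc can be excused, so the count keeps just the place x - 2 free of short
  -- arcs. A short arc at x - 1 is tolerated by making x - 1 an end of the path.
  cyclic : Incident {n} {x} (far , u₁) t → Realizable (n + x) (L12x x a b (c + x))
  cyclic it = from (offset (u₁ ∷ []) (x ∸ 2 ∷ []) js<x room)
    where
    js<x : ∀ {j} → j ∈ x ∸ 2 ∷ [] → j < x
    js<x (here refl) = ≤-<-trans (∸-monoʳ-≤ {1} {2} x (s≤s z≤n)) m<x
    room : length (M (u₁ ∷ [])) * x + (a + b) * 1 < n
    room = subst (length (M (u₁ ∷ [])) * x + (a + b) * 1 <_) (sym n≡)
        (cycle-room (length (M (u₁ ∷ []))) (a + b) x c (s≤s⁻¹ (subst (_≤ suc (a + b)) (+-comm (length (M (u₁ ∷ []))) 1)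
             (length-M (u₁ ∷ []) ([] ∷ []) λ { (here refl) → proj₁ u₁-spec , proj₁ (proj₂ u₁-spec) }))) few many)
    from : ∃[ o ] o < n × (∀ {y} → y < x → (o + y) % n ∈ u₁ ∷ [] ++ Y) × (∀ {j} → j ∈ x ∸ 2 ∷ [] → (o + j) % n ∉ S) →
           Realizable (n + x) (L12x x a b (c + x))
    from (o , o<n , here-or , calm) = go (x ∸ 1 ∈? shortLows (arcs H′.walk))
      where
      open Turned o o<n
      u = rot u₁
      iₛ = Incident-rot 0<x x<n (<⇒≤ o<n) (proj₂ (proj₂ u₁-spec))
      iₜ = Incident-rot 0<x x<n (<⇒≤ o<n) it
      cov : ∀ {y} → y < x → (far , y) ∈ arcs H′.walk ⊎ y ≡ u
      cov y<x with present {u₁ ∷ []} y<x (here-or y<x)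
      ... | inj₂ h = inj₁ h
      ... | inj₁ (here e) = inj₂ e
      calm′ : ∀ {k} → (k , x ∸ 2) ∈ arcs H′.walk → k ≡ far
      calm′ = quiet⇒far (calm (here refl))
      nontrivial : 1 < length (vertices H′.walk)
      nontrivial = subst (1 <_) (sym (trans (length-vertices H′.walk)
          (trans (cong suc (cong₂ _+_ (cong₂ _+_ H′.ones H′.twos) H′.fars)) (sym n≡)))) (≤-trans 2≤x (<⇒≤ x<n))
      loop : Closing {n} {x} H′.s H′.t u
      loop = close (m%n<n _ n) iₛ iₜ (ends-differ H′.walk H′.simple nontrivial)
      go : Dec (x ∸ 1 ∈ shortLows (arcs H′.walk)) → Realizable (n + x) (L12x x a b (c + x))
      -- Both ends miss the same arc, so its new vertex must be attached to one of them only.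
      go (no m∉) = Quiet.grown H′ quiet (budOf u iₛ) none cov′ (subst Unique (sym (++-identityʳ _)) (budOf-unique iₛ)) miss
        where
        quiet : ∀ {k l} → (k , l) ∈ arcs H′.walk → Crossing (k , l) → k ≡ far
        quiet {k} h cr with far? k
        ... | inj₁ e = e
        ... | inj₂ k≢ with top-two k≢ cr
        ...   | inj₁ refl = ⊥-elim (m∉ (∈-shortLows⁺ k≢ h))
        ...   | inj₂ (_ , refl) = calm′ h
        cov′ : ∀ {y} → y < x → (far , y) ∈ arcs H′.walk ⊎ y ∈ lows (budOf u iₛ) ++ []
        cov′ y<x with cov y<x
        ... | inj₁ h = inj₁ h
        ... | inj₂ refl = inj₂ (∈-++⁺ˡ (∈-budOf iₛ y<x))
        miss : ∀ {v} → v ∈ lows (budOf u iₛ) ++ [] → (far , v) ∉ arcs H′.walk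
        miss v∈ h with ∈-++⁻ (lows (budOf u iₛ)) v∈
        ... | inj₁ h₁ rewrite budOf-∈ iₛ h₁ = absent (proj₁ u₁-spec) (proj₁ (proj₂ u₁-spec)) h
      -- Either the missing far arc is the one at x - 1, and x - 1 is already an end, or that arc is
      -- present and the cycle is reopened there.
      go (yes m∈) with cov m<x
      ... | inj₂ m≡ = hinged H′ (ends loop) far-in (∈-shortLows⁻ m∈) calm′
        where
        ends : Closing {n} {x} H′.s H′.t u → H′.s ≡ x ∸ 1 ⊎ H′.t ≡ x ∸ 1
        ends (closing (inj₁ _) e) = inj₂ (trans e (sym m≡))
        ends (closing (inj₂ _) e) = inj₁ (trans e (sym m≡))
        far-in : ∀ {y} → y < x → y ≢ x ∸ 1 → (far , y) ∈ arcs H′.walk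
        far-in y<x y≢ with cov y<x
        ... | inj₁ h = h
        ... | inj₂ e = ⊥-elim (y≢ (trans e (sym m≡)))
      ... | inj₁ fm∈ = hinged R.ham R.ends far-in (short-in (∈-shortLows⁻ m∈)) calm″
        where
        module R = Reopened (reopen H′ loop fm∈)
        far-in : ∀ {y} → y < x → y ≢ x ∸ 1 → (far , y) ∈ arcs (Ham.walk R.ham)
        far-in y<x y≢ with cov y<x
        ... | inj₁ h = R.keeps h (λ e → y≢ (cong proj₂ e))
        ... | inj₂ refl = R.closed
        short-in : ∃[ k ] k ≢ far × (k , x ∸ 1) ∈ arcs H′.walk → ∃[ k ] k ≢ far × (k , x ∸ 1) ∈ arcs (Ham.walk R.ham)
        short-in (k , k≢ , h) = k , k≢ , R.keeps h (λ e → k≢ (cong proj₁ e))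
        calm″ : ∀ {k} → (k , x ∸ 2) ∈ arcs (Ham.walk R.ham) → k ≡ far
        calm″ h with R.olds h
        ... | inj₁ h′ = calm′ h′
        ... | inj₂ e = cong proj₁ e

  -- If both ends miss the same far arc, that arc closes the path to a cycle.
  transferred : Dec (u₁ ≡ u₂) → Realizable (n + x) (L12x x a b (c + x))
  transferred (no ne) = two-missing ne
  transferred (yes refl) = cyclic (proj₂ (proj₂ u₂-spec))

module _ {n x a b c : ℕ} .{{_ : NonZero n}} .{{_ : NonZero (n + x)}} (2≤x : 2 ≤ x) (2x≤n : x + x ≤ n) (n≡ : n ≡ suc (a + b + c))
         (few : 2 + (a + b) ≤ x) (many : pred x * pred x ≤ c) (H : Ham n x a b c) where

  open Ham H

  transfer : Realizable (n + x) (L12x x a b (c + x))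
  transfer = from (candidate 0<x x<n walk simple (bound (start∈ walk)))
                  (candidate 0<x x<n (flip walk) (vertices-flip walk simple) (bound (end∈ walk)))
    where
    0<x : 0 < x
    0<x = <-trans (s≤s z≤n) 2≤x
    x<n : x < n
    x<n = <-≤-trans (m<m+n x 0<x) 2x≤n
    from : ∃[ u ] u < n × u ∉ farLows (arcs walk) × Incident {n} {x} (far , u) s →
           ∃[ u ] u < n × u ∉ farLows (arcs (flip walk)) × Incident {n} {x} (far , u) t →
           Realizable (n + x) (L12x x a b (c + x))
    from (u₁ , spec₁) (u₂ , u<n , u∉ , i) =
      Transfer.transferred 2≤x 2x≤n n≡ few many H spec₁ (u<n , (λ u∈ → u∉ (∈-farLows⁺ (arcs-flip walk (∈-farLows⁻ u∈)))) , i)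
          (u₁ ≟ u₂)

-- Descent in the number of far steps

All-L : ∀ {P : ℕ → Set} x a b c → (0 < a → P 1) → (0 < b → P 2) → (0 < c → P x) → All P (L12x x a b c)
All-L x a b c p q r = All.++⁺ (rep a p) (All.++⁺ (rep b q) (rep c r))
  where
  rep : ∀ {P : ℕ → Set} {z} n → (0 < n → P z) → All P (replicate n z)
  rep zero    _ = []
  rep (suc n) h = All.replicate⁺ (suc n) (h (s≤s z≤n))

length-L : ∀ x a b c → length (L12x x a b c) ≡ a + b + c
length-L x a b c = trans (length-++ (replicate a 1)) (trans (cong₂ _+_ (length-replicate a)
  (trans (length-++ (replicate b 2)) (cong₂ _+_ (length-replicate b) (length-replicate c)))) (sym (+-assoc a b c)))

countMultiples-++ : ∀ d L M → countMultiples d (L ++ M) ≡ countMultiples d L + countMultiples d M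
countMultiples-++ d L M = trans (cong length (filter-++ (d ∣?_) L M)) (length-++ (filter (d ∣?_) L))

countMultiples-all : ∀ {d x} n → d ∣ x → countMultiples d (replicate n x) ≡ n
countMultiples-all {d} n d∣x = trans (cong length (filter-all (d ∣?_) (All.replicate⁺ n d∣x))) (length-replicate n)

countMultiples-+ : ∀ {d x} a b c → d ∣ x → countMultiples d (L12x x a b (c + x)) ≡ countMultiples d (L12x x a b c) + x
countMultiples-+ {d} {x} a b c d∣x = trans (expand (c + x)) (trans (solve-sum m₁ m₂ c x) (cong (_+ x) (sym (expand c))))
  where
  m₁ = countMultiples d (replicate a 1)
  m₂ = countMultiples d (replicate b 2)
  expand : ∀ c → countMultiples d (L12x x a b c) ≡ m₁ + (m₂ + c)
  expand c = trans (countMultiples-++ d (replicate a 1) _)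
      (cong (m₁ +_) (trans (countMultiples-++ d (replicate b 2) _) (cong (m₂ +_) (countMultiples-all c d∣x))))
  solve-sum : ∀ m₁ m₂ c x → m₁ + (m₂ + (c + x)) ≡ m₁ + (m₂ + c) + x
  solve-sum = solve-∀

-- As x is even, a divisor of 1 or 2 also divides x.
countMultiples-none : ∀ {d x} a b c → 2 ∣ x → ¬ d ∣ x → countMultiples d (L12x x a b c) ≡ 0
countMultiples-none {d} {x} a b c 2∣x d∤x = cong length (filter-none (d ∣?_)
  (All-L x a b c (λ _ d∣1 → d∤x (∣-trans d∣1 (1∣ x))) (λ _ d∣2 → d∤x (∣-trans d∣2 2∣x)) (λ _ → d∤x)))

-- A d dividing both v and x also divides v + x, and removing x far steps lowers both sides of its
-- condition by x; for any other d the count is 0.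
shrink : ∀ {x a b c} → 2 ∣ x → 2 ≤ x → x * 2 ≤ suc (a + b + c) →
         Admissible (suc (a + b + (c + x))) (L12x x a b (c + x)) → Admissible (suc (a + b + c)) (L12x x a b c)
shrink {x} {a} {b} {c} 2∣x 2≤x 2x≤ (_ , _ , _ , few) = length-L x a b c
  , All-L x a b c (λ _ → ≤-refl) (λ _ → s≤s z≤n) (λ _ → ≤-trans (s≤s z≤n) 2≤x)
  , All-L x a b c (λ _ → half (≤-trans (s≤s z≤n) 2≤x)) (λ _ → half 2≤x) (λ _ → half ≤-refl)
  , divisors
  where
  v = suc (a + b + c)
  half : ∀ {ℓ} → ℓ ≤ x → ℓ ≤ v / 2
  half {ℓ} h = subst (_≤ v / 2) (m*n/n≡m ℓ 2) (/-monoˡ-≤ 2 (≤-trans (*-monoˡ-≤ 2 h) 2x≤))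
  v+x : suc (a + b + (c + x)) ≡ v + x
  v+x = cong suc (sym (+-assoc (a + b) c x))
  divisors : ∀ d → d ∣ v → countMultiples d (L12x x a b c) ≤ v ∸ d
  divisors d d∣v with d ∣? x
  ... | no  d∤x = subst (_≤ v ∸ d) (sym (countMultiples-none a b c 2∣x d∤x)) z≤n
  ... | yes d∣x = +-cancelʳ-≤ x _ _ (subst₂ _≤_ (countMultiples-+ a b c d∣x)
      (trans (cong (_∸ d) v+x) (+-∸-comm x (∣⇒≤ d∣v))) (few d (subst (d ∣_) (sym v+x) (∣m∣n⇒∣m+n d∣v d∣x))))

private
  -- With x = m + 1 the bound is (x - 1)² + x, so (x - 1)² far steps remain after x are removed.
  square : ∀ m c → suc m ^ 2 ∸ suc m + 1 ≤ c → ∃[ c′ ] c ≡ c′ + suc m × m * m ≤ c′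
  square m c h with m≤n⇒∃[o]m+o≡n h
  ... | o , refl = m * m + o , trans (cong (λ z → z + 1 + o) (trans (cong (_∸ suc m) (pow m)) (m+n∸m≡n (suc m) _))) (eq m o) ,
      m≤m+n (m * m) o
    where
    pow : ∀ m → suc m * (suc m * 1) ≡ suc m + m * suc m
    pow = solve-∀
    eq : ∀ m o → m * suc m + 1 + o ≡ m * m + o + suc m
    eq = solve-∀

  -- Here x ≥ 4 enters: m² ≥ 3m ≥ 2m + 1 makes the smaller order at least 2x, as both `shrink` and
  -- the insertion require.
  roomy : ∀ m s c → 3 ≤ m → m * m ≤ c → suc m + suc m ≤ suc (s + c)
  roomy m s c 3≤m sq = ≤-trans (s≤s (≤-trans bound sq)) (s≤s (m≤n+m c s))
    where
    eq : ∀ m → m + suc m ≡ 1 + 2 * m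
    eq = solve-∀
    bound : m + suc m ≤ m * m
    bound = ≤-trans (≤-trans (≤-reflexive (eq m)) (+-monoˡ-≤ (2 * m) (≤-trans (s≤s z≤n) 3≤m))) (*-monoˡ-≤ m 3≤m)

Small : ℕ → Set
Small x = ∃[ a ] ∃[ b ] ∃[ c ] (Counterexample x a b c × (a + b < x ∸ 1) × (c < (x ^ 2 ∸ x) + 1))

-- Only c descends. The smaller list is again a counterexample, since `transfer` would turn a
-- realization of it into one of the given list.
few-short : ∀ x a b → 4 ≤ x → 2 ∣ x → 2 + (a + b) ≤ x → ∀ c → Acc _<_ c → Counterexample x a b c → Small x
few-short x@(suc m) a b (s≤s 3≤m) 2∣x few c (acc rec) cx@(adm , unreal) with c <? (x ^ 2 ∸ x) + 1
... | yes c< = a , b , c , cx , s≤s⁻¹ few , c<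
... | no  c≮ with square m c (≮⇒≥ c≮)
...   | c′ , refl , many = few-short x a b (s≤s 3≤m) 2∣x few c′ (rec (m<m+n c′ z<s))
        ( shrink {a = a} {b} {c′} 2∣x 2≤x (≤-trans (≤-reflexive 2x≡) 2x≤) adm
        , λ real → unreal (subst (λ v → Realizable v (L12x x a b (c′ + x))) (cong suc (+-assoc (a + b) c′ x))
                     (transfer 2≤x 2x≤ refl few many (realizable⇒ham {a = a} {b} {c′} (s≤s (≤-trans (n≤1+n 2) 3≤m)) real))))
  where
  2≤x : 2 ≤ x
  2≤x = s≤s (≤-trans (s≤s z≤n) 3≤m)
  2x≤ : x + x ≤ suc (a + b + c′)
  2x≤ = roomy m (a + b) c′ 3≤m many
  2x≡ : x * 2 ≡ x + x
  2x≡ = trans (*-comm x 2) (cong (x +_) (+-identityʳ x))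

theorem4p3 : (x : ℕ) → 4 ≤ x → 2 ∣ x →
    (∃[ a ] ∃[ b ] ∃[ c ] Counterexample x a b c) →
    ∃[ a ] ∃[ b ] ∃[ c ] (Counterexample x a b c × (a + b < x ∸ 1) × (c < (x ^ 2 ∸ x) + 1))
theorem4p3 x 4≤x 2∣x@(divides y refl) (a , b , c , cx@(adm , unreal)) with y * 2 ≤? suc (a + b)
... | no  few = few-short x a b 4≤x 2∣x (≰⇒> few) c (<-wellFounded c) cx
... | yes enough = ⊥-elim (unreal (many-short y {{>-nonZero (<-≤-trans z<s 2≤y)}} a b c 2≤y enough adm))
  where
  2≤y : 2 ≤ y
  2≤y = *-cancelʳ-≤ 2 y 2 4≤x
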